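{- Let $P \subset \mathbb{R}^2$ be a lattice square (a square whose four vertices all lie in $\mathbb{Z}^2$) with area $A$. Then $P$ is $\mu_{\mathrm{av}}$-measurable, and \[\mu_{\mathrm{av}}(P) = \frac{2}{15}A.\]
   Context: Here $d=2$. A polytope is a $d$-dimensional convex polytope in $\mathbb{R}^d$. Two polytopes are similar ($M \sim P$) if one is the image of the other under a similarity transformation of $\mathbb{R}^d$ (a composition of an isometry and a dilation by a positive factor). A miniature of a polytope $P$ is a polytope $M \subset \mathbb{R}^d$ with $M \subset P$ and $M \sim P$. For an integer $n>0$, a miniature $M$ has resolution $n$ if every vertex of $M$ lies in $(\mathbb{Z}[1/n])^d$. Let $\mathcal{M}_n(P)$ denote the set of all miniatures of $P$ with resolution $n$. A lattice polytope $P$ is called $\mu_{\mathrm{av}}$-measurable if the limit \[\mu_{\mathrm{av}}(P) := \lim_{n\to\infty} \frac{\sum_{M \in \mathcal{M}_n(P)} \mathrm{vol}(M)}{\#\mathcal{M}_n(P)}\] exists in $\mathbb{R}$, where $\mathrm{vol}$ denotes $d$-dimensional volume (here area).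
   Formalization: "Resolution n" is taken to mean that every vertex lies in the grid ((1/n)ℤ)²; with ℤ[1/n] read literally as a ring, the set of miniatures would be infinite for every n ≥ 2 and the average undefined. -}

module Defs where

open import Data.Nat as ℕ using (ℕ; suc)
open import Data.Integer using (ℤ; +_)
open import Data.Rational using (ℚ; _/_; _+_; _-_; _*_; -_; _≤_; _<_; 0ℚ)
open import Data.Product using (_×_; _,_; ∃)
open import Data.List using (List; []; _∷_; map; length)
open import Data.List.Relation.Unary.All using (All)
open import Data.List.Relation.Unary.Unique.Propositional using (Unique)
open import Data.List.Membership.Propositional using (_∈_)
open import Relation.Binary.PropositionalEquality using (_≡_)
open import Relation.Nullary using (¬_)
open import Function.Bundles using (_⇔_)

Point : Set
Point = ℚ × ℚ

_⊕_ : Point → Point → Point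
(a , b) ⊕ (c , d) = (a + c , b + d)

_⊖_ : Point → Point → Point
(a , b) ⊖ (c , d) = (a - c , b - d)

_·_ : Point → Point → ℚ
(a , b) · (c , d) = a * c + b * d

perp : Point → Point
perp (a , b) = (- b , a)

record Square : Set where
  constructor square
  field
    corner : Point
    edge   : Point
open Square public

vertices : Square → List Point
vertices (square c e) = c ∷ (c ⊕ e) ∷ ((c ⊕ e) ⊕ perp e) ∷ (c ⊕ perp e) ∷ []

NonDegenerate : Square → Set
NonDegenerate s = ¬ (edge s ≡ (0ℚ , 0ℚ))

area : Square → ℚ
area s = edge s · edge s

_∈□_ : Point → Square → Set
q ∈□ s = (0ℚ ≤ w · e) × (w · e ≤ e · e) × (0ℚ ≤ w · perp e) × (w · perp e ≤ e · e)
  where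
    w = q ⊖ corner s
    e = edge s

_⊆□_ : Square → Square → Set
M ⊆□ P = ∀ q → q ∈□ M → q ∈□ P

IsInt : ℚ → Set
IsInt x = ∃ λ (k : ℤ) → x ≡ k / 1

IsLatticePoint : Point → Set
IsLatticePoint (x , y) = IsInt x × IsInt y

LatticeSquare : Square → Set
LatticeSquare P = NonDegenerate P × All IsLatticePoint (vertices P)

-- x ∈ (1/n)ℤ  (for n > 0)
OnGrid : (n : ℕ) → ℚ → Set
OnGrid n x = IsInt ((+ n / 1) * x)

OnGridPoint : ℕ → Point → Set
OnGridPoint n (x , y) = OnGrid n x × OnGrid n y

-- Each square has exactly one representation with edge (a , b), a > 0, b ≥ 0
-- (its four edge vectors are ±e, ±perp e); this makes "set of squares"
-- correspond to a set of representations.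
Canonical : Square → Set
Canonical s = (0ℚ < proj₁' (edge s)) × (0ℚ ≤ proj₂' (edge s))
  where
    proj₁' : Point → ℚ
    proj₁' (a , _) = a
    proj₂' : Point → ℚ
    proj₂' (_ , b) = b

-- M is a miniature of the square P of resolution n.
-- (Every polytope similar to a square is a square, and every two squares
-- are similar, so the miniatures of P are exactly the squares inside P.)
IsMiniature : ℕ → Square → Square → Set
IsMiniature n P M =
  Canonical M × NonDegenerate M × (M ⊆□ P) × All (OnGridPoint n) (vertices M)

Enumerates : ℕ → Square → List Square → Set
Enumerates n P L = Unique L × (∀ M → (M ∈ L) ⇔ IsMiniature n P M)

sumℚ : List ℚ → ℚ
sumℚ [] = 0ℚ
sumℚ (x ∷ xs) = x + sumℚ xs

avgArea : List Square → ℚ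
avgArea [] = 0ℚ
avgArea L@(_ ∷ xs) = sumℚ (map area L) * (+ 1 / suc (length xs))

{-# OPTIONS --safe #-}
module Submission where

-- Let D be the area of P = c + [0, 1] e + [0, 1] (perp e). Scale by n and take dot products with e and
-- perp e as coordinates; then P becomes [0, n D]², and a miniature has a corner (u , u′) and an edge (α , β).
-- Listing it from another vertex, one may take α > 0 and β ≥ 0, and then it lies in P iff u - β ≥ 0,
-- u + α ≤ n D, u′ ≥ 0 and u′ + α + β ≤ n D. The lattice points have coordinates in a lattice that contains
-- (D ℤ)². Division with remainder by D therefore relates miniatures to pairs of residues together with
-- quadruples (a , b , i , k) of natural numbers with i + a + b ≤ n and k + a + b ≤ n, up to replacing n by
-- n - 4; here a and b are the quotients of α and β. The number of residue pairs cancels from the average, and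
-- the sums over quadruples are polynomials: there are n⁴/12 + O(n³) quadruples, and a² + b² sums over them to
-- n⁶/90 + O(n⁵). The area of a miniature being D (a² + b²)/n² up to lower order, the average tends to
-- D (1/90)/(1/12) = (2/15) D.

open import Defs
open import Data.Nat using (ℕ; _≤_)
open import Data.Integer using (+_)
open import Data.Rational using (ℚ; _/_; _*_; _-_; _<_; ∣_∣; 0ℚ)
open import Data.Product using (∃; _×_)
open import Data.List using (List)

open import Data.Bool using (Bool; true; false; T; _∧_)
open import Data.Bool.Properties using (T-∧)
open import Data.Empty using (⊥; ⊥-elim)
open import Data.Integer as ℤ using (ℤ; -[1+_]; 0ℤ; 1ℤ)
import Data.Integer.DivMod as ℤ
import Data.Integer.Properties as ℤ
import Data.Integer.Tactic.RingSolver as ℤR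
open import Data.List using ([]; _∷_; map; length; _++_; upTo; filter; deduplicate)
open import Data.List.Membership.Propositional using (_∈_)
open import Data.List.Membership.Propositional.Properties
  using (∈-map⁺; ∈-map⁻; ∈-++⁺ˡ; ∈-++⁺ʳ; ∈-++⁻; ∈-∃++; ∈-upTo⁺; ∈-upTo⁻; ∈-filter⁺; ∈-filter⁻; ∈-deduplicate⁺; ∈-deduplicate⁻)
open import Data.List.Properties using (map-++; map-cong; map-∘; length-upTo; length-map)
open import Data.List.Relation.Unary.All as All using (All; []; _∷_)
open import Data.List.Relation.Unary.AllPairs as AllPairs using ([]; _∷_)
import Data.List.Relation.Unary.AllPairs.Properties as AllPairs
open import Data.List.Relation.Unary.Any using (here; there)
import Data.List.Relation.Unary.Unique.DecPropositional.Properties as DecUnique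
open import Data.List.Relation.Unary.Unique.Propositional using (Unique)
import Data.List.Relation.Unary.Unique.Propositional.Properties as Unique
open import Data.Nat as ℕ using (zero; suc; z≤n; s≤s)
open import Data.Nat.ListAction using (sum)
open import Data.Nat.ListAction.Properties using (sum-++)
import Data.Nat.Properties as ℕ
import Data.Nat.Tactic.RingSolver as ℕR
open import Data.Product using (_,_; ∃₂; proj₁; proj₂)
open import Data.Product.Properties using (≡-dec)
open import Data.Rational as ℚ using (mkℚ; 1ℚ)
import Data.Rational.Properties as ℚ
open import Data.Rational.Unnormalised as ℚᵘ using (mkℚᵘ; *≡*; *≤*)
import Data.Rational.Unnormalised.Properties as ℚᵘ
open import Data.Sum using (inj₁; inj₂)
open import Function using (_∘_; id)
open import Function.Bundles using (Equivalence; mk⇔)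
open import Level using (0ℓ)
open import Relation.Binary.Definitions using (DecidableEquality)
open import Relation.Binary.PropositionalEquality
  using (_≡_; _≢_; refl; sym; trans; cong; cong₂; subst; subst₂; module ≡-Reasoning)
open import Relation.Nullary using (Dec; yes; no; _×-dec_)
open import Relation.Nullary.Decidable using (dec⇒maybe)
open import Tactic.RingSolver using (solve-∀)
open import Tactic.RingSolver.Core.AlmostCommutativeRing using (AlmostCommutativeRing; fromCommutativeRing)

-- Remainders blur the boundary of the box, so no bijection between miniatures and indices is set
-- up, only two injections: miniatures of resolution n into the indices of size n, and indices of
-- size n - 4, slightly shifted, back into the miniatures. Along each of them the area is bounded on
-- the side required, and passing from one size to the other costs a relative error O(1/n). A second
-- obstacle: the listing of a square is normalised in the original axes, while the box belongs to
-- the tilted frame. Squares are therefore matched only up to the four choices of a first vertex.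
-- The two constants are Beta integrals. With s = a + b measured in units of n, the pairs (i , k)
-- contribute (1 - s)², so the count is the integral of s (1 - s)² over [0, 1], which is 1/12, and
-- the second moment is 2/3 of the integral of s³ (1 - s)², which is 1/90. Estimates stay
-- inequalities between natural numbers until the final division by n² and by the number of
-- miniatures.

-- Sums over lists, injective matchings and lists of dependent pairs

sumBy : {A : Set} → (A → ℕ) → List A → ℕ
sumBy f xs = sum (map f xs)

sumBy-++ : {A : Set} (f : A → ℕ) (xs ys : List A) → sumBy f (xs ++ ys) ≡ sumBy f xs ℕ.+ sumBy f ys
sumBy-++ f xs ys = trans (cong sum (map-++ f xs ys)) (sum-++ (map f xs) (map f ys))

sumBy-+ : {A : Set} (f g : A → ℕ) (xs : List A) → sumBy (λ x → f x ℕ.+ g x) xs ≡ sumBy f xs ℕ.+ sumBy g xs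
sumBy-+ f g [] = refl
sumBy-+ f g (x ∷ xs) = trans (cong (f x ℕ.+ g x ℕ.+_) (sumBy-+ f g xs))
  (ring (f x) (g x) (sumBy f xs) (sumBy g xs))
  where
  ring : ∀ a b c d → a ℕ.+ b ℕ.+ (c ℕ.+ d) ≡ a ℕ.+ c ℕ.+ (b ℕ.+ d)
  ring = ℕR.solve-∀

sumBy-* : {A : Set} (c : ℕ) (f : A → ℕ) (xs : List A) → sumBy (λ x → c ℕ.* f x) xs ≡ c ℕ.* sumBy f xs
sumBy-* c f [] = sym (ℕ.*-zeroʳ c)
sumBy-* c f (x ∷ xs) = trans (cong (c ℕ.* f x ℕ.+_) (sumBy-* c f xs)) (sym (ℕ.*-distribˡ-+ c (f x) (sumBy f xs)))

sumBy-const : {A : Set} (c : ℕ) (xs : List A) → sumBy (λ _ → c) xs ≡ length xs ℕ.* c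
sumBy-const c [] = refl
sumBy-const c (x ∷ xs) = cong (c ℕ.+_) (sumBy-const c xs)

sumBy-cong : {A : Set} {f g : A → ℕ} → (∀ x → f x ≡ g x) → (xs : List A) → sumBy f xs ≡ sumBy g xs
sumBy-cong f≡g xs = cong sum (map-cong f≡g xs)

sumBy-map : {A B : Set} (f : B → ℕ) (g : A → B) (xs : List A) → sumBy f (map g xs) ≡ sumBy (f ∘ g) xs
sumBy-map f g xs = cong sum (sym (map-∘ xs))

-- Each x takes its partner out of ys, and injectivity of `R` keeps later partners away from the
-- position removed. A relation serves instead of a function because miniatures and indices are
-- matched through an unspecified number of turns, and in both directions.
sumBy-≤-correspondence : {A B : Set} (R : A → B → Set) (f : A → ℕ) (g : B → ℕ) →
  (∀ {x y} → R x y → f x ℕ.≤ g y) →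
  (∀ {x x′ y} → R x y → R x′ y → x ≡ x′) →
  (xs : List A) (ys : List B) → Unique xs →
  (∀ {x} → x ∈ xs → ∃ λ y → y ∈ ys × R x y) →
  sumBy f xs ℕ.≤ sumBy g ys
sumBy-≤-correspondence R f g f≤g inj [] ys _ _ = z≤n
sumBy-≤-correspondence {A} {B} R f g f≤g inj (x ∷ xs) ys (x∉xs ∷ uxs) total
  with total (here refl)
... | y , y∈ys , xRy with ∈-∃++ y∈ys
... | as , bs , refl = begin
  f x ℕ.+ sumBy f xs                         ≤⟨ ℕ.+-mono-≤ (f≤g xRy) (sumBy-≤-correspondence R f g f≤g inj xs (as ++ bs) uxs total′) ⟩
  g y ℕ.+ sumBy g (as ++ bs)                 ≡⟨ cong (g y ℕ.+_) (sumBy-++ g as bs) ⟩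
  g y ℕ.+ (sumBy g as ℕ.+ sumBy g bs)        ≡⟨ ring (g y) (sumBy g as) (sumBy g bs) ⟩
  sumBy g as ℕ.+ (g y ℕ.+ sumBy g bs)        ≡⟨ sumBy-++ g as (y ∷ bs) ⟨
  sumBy g (as ++ y ∷ bs)                     ∎
  where
  open ℕ.≤-Reasoning
  ring : ∀ a b c → a ℕ.+ (b ℕ.+ c) ≡ b ℕ.+ (a ℕ.+ c)
  ring = ℕR.solve-∀
  total′ : ∀ {x′} → x′ ∈ xs → ∃ λ y′ → y′ ∈ as ++ bs × R x′ y′
  total′ x′∈xs with total (there x′∈xs)
  ... | y′ , y′∈ys , x′Ry′ with ∈-++⁻ as y′∈ys
  ... | inj₁ y′∈as = y′ , ∈-++⁺ˡ y′∈as , x′Ry′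
  ... | inj₂ (there y′∈bs) = y′ , ∈-++⁺ʳ as y′∈bs , x′Ry′
  ... | inj₂ (here refl) = ⊥-elim (All.lookup x∉xs x′∈xs (inj xRy x′Ry′))

dependentPairs : {A B : Set} → List A → (A → List B) → List (A × B)
dependentPairs [] ys = []
dependentPairs (x ∷ xs) ys = map (x ,_) (ys x) ++ dependentPairs xs ys

module _ {A B : Set} where

  ∈-dependentPairs⁺ : ∀ {xs : List A} {ys : A → List B} {x y} → x ∈ xs → y ∈ ys x → (x , y) ∈ dependentPairs xs ys
  ∈-dependentPairs⁺ (here refl) y∈ = ∈-++⁺ˡ (∈-map⁺ (_ ,_) y∈)
  ∈-dependentPairs⁺ {x′ ∷ _} {ys} (there x∈) y∈ = ∈-++⁺ʳ (map (x′ ,_) (ys x′)) (∈-dependentPairs⁺ x∈ y∈)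

  ∈-dependentPairs⁻ : ∀ (xs : List A) {ys : A → List B} {x y} → (x , y) ∈ dependentPairs xs ys → x ∈ xs × y ∈ ys x
  ∈-dependentPairs⁻ (x′ ∷ xs) {ys} xy∈ with ∈-++⁻ (map (x′ ,_) (ys x′)) xy∈
  ... | inj₁ xy∈map with ∈-map⁻ (x′ ,_) xy∈map
  ... | _ , y∈ , refl = here refl , y∈
  ∈-dependentPairs⁻ (x′ ∷ xs) xy∈ | inj₂ xy∈rest with ∈-dependentPairs⁻ xs xy∈rest
  ... | x∈ , y∈ = there x∈ , y∈

  unique-dependentPairs : ∀ {xs : List A} {ys : A → List B} → Unique xs → (∀ x → Unique (ys x)) →
    Unique (dependentPairs xs ys)
  unique-dependentPairs [] uys = []
  unique-dependentPairs {x ∷ xs} {ys} (x∉xs ∷ uxs) uys =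
    Unique.++⁺ (Unique.map⁺ (cong proj₂) (uys x)) (unique-dependentPairs uxs uys) disjoint
    where
    disjoint : ∀ {z} → z ∈ map (x ,_) (ys x) × z ∈ dependentPairs xs ys → _
    disjoint (z∈₁ , z∈₂) with ∈-map⁻ (x ,_) z∈₁
    ... | _ , _ , refl = All.lookup x∉xs (proj₁ (∈-dependentPairs⁻ xs z∈₂)) refl

  sumBy-dependentPairs : (f : A × B → ℕ) (xs : List A) (ys : A → List B) →
    sumBy f (dependentPairs xs ys) ≡ sumBy (λ x → sumBy (λ y → f (x , y)) (ys x)) xs
  sumBy-dependentPairs f [] ys = refl
  sumBy-dependentPairs f (x ∷ xs) ys = trans (sumBy-++ f (map (x ,_) (ys x)) _)
    (cong₂ ℕ._+_ (sumBy-map f (x ,_) (ys x)) (sumBy-dependentPairs f xs ys))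

-- Convolution sums and their closed forms

splits : ℕ → List (ℕ × ℕ)
splits zero = (0 , 0) ∷ []
splits (suc m) = (0 , suc m) ∷ map (λ (a , b) → suc a , b) (splits m)

∈-splits⁺ : ∀ a b → (a , b) ∈ splits (a ℕ.+ b)
∈-splits⁺ zero zero = here refl
∈-splits⁺ zero (suc b) = here refl
∈-splits⁺ (suc a) b = there (∈-map⁺ _ (∈-splits⁺ a b))

∈-splits⁻ : ∀ m {a b} → (a , b) ∈ splits m → a ℕ.+ b ≡ m
∈-splits⁻ zero (here refl) = refl
∈-splits⁻ (suc m) (here refl) = refl
∈-splits⁻ (suc m) (there ab∈) with ∈-map⁻ _ ab∈
... | _ , ab∈′ , refl = cong suc (∈-splits⁻ m ab∈′)

unique-splits : ∀ m → Unique (splits m)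
unique-splits zero = [] ∷ []
unique-splits (suc m) = All.tabulate head≢ ∷ Unique.map⁺ (λ { refl → refl }) (unique-splits m)
  where
  head≢ : ∀ {z} → z ∈ map (λ (a , b) → suc a , b) (splits m) → (0 , suc m) ≢ z
  head≢ z∈ refl with ∈-map⁻ _ z∈
  ... | _ , _ , ()

-- `S₀`, `S₁`, `S₂` are the moments of a against g b over a + b = m. Separating a = 0 and lowering
-- every other a by one expresses each of them at m + 1 through those at m; `S₁` closes the
-- recursion for `S₂`.
module Convolution (g : ℕ → ℕ) where

  abstract
    S₀ S₁ S₂ : ℕ → ℕ
    S₀ m = sumBy (λ (a , b) → g b) (splits m)
    S₁ m = sumBy (λ (a , b) → a ℕ.* g b) (splits m)
    S₂ m = sumBy (λ (a , b) → a ℕ.* a ℕ.* g b) (splits m)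

    S₀-def : ∀ m → sumBy (λ (a , b) → g b) (splits m) ≡ S₀ m
    S₀-def m = refl

    S₂-def : ∀ m → sumBy (λ (a , b) → a ℕ.* a ℕ.* g b) (splits m) ≡ S₂ m
    S₂-def m = refl

    S₀-zero : S₀ 0 ≡ g 0
    S₀-zero = ℕ.+-identityʳ (g 0)

    S₁-zero : S₁ 0 ≡ 0
    S₁-zero = refl

    S₂-zero : S₂ 0 ≡ 0
    S₂-zero = refl

    S₀-suc : ∀ m → S₀ (suc m) ≡ g (suc m) ℕ.+ S₀ m
    S₀-suc m = cong (g (suc m) ℕ.+_) (sumBy-map _ _ (splits m))

    S₁-suc : ∀ m → S₁ (suc m) ≡ S₀ m ℕ.+ S₁ m
    S₁-suc m = trans (sumBy-map _ _ (splits m)) (sumBy-+ (λ (a , b) → g b) _ (splits m))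

    S₂-suc : ∀ m → S₂ (suc m) ≡ S₀ m ℕ.+ 2 ℕ.* S₁ m ℕ.+ S₂ m
    S₂-suc m = begin
      S₂ (suc m)                    ≡⟨ sumBy-map _ _ (splits m) ⟩
      sumBy (λ (a , b) → suc a ℕ.* suc a ℕ.* g b) (splits m)
        ≡⟨ sumBy-cong (λ (a , b) → ring a (g b)) (splits m) ⟩
      sumBy (λ (a , b) → g b ℕ.+ 2 ℕ.* (a ℕ.* g b) ℕ.+ a ℕ.* a ℕ.* g b) (splits m)
        ≡⟨ sumBy-+ (λ (a , b) → g b ℕ.+ 2 ℕ.* (a ℕ.* g b)) _ (splits m) ⟩
      sumBy (λ (a , b) → g b ℕ.+ 2 ℕ.* (a ℕ.* g b)) (splits m) ℕ.+ S₂ m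
        ≡⟨ cong (ℕ._+ S₂ m) (sumBy-+ (λ (a , b) → g b) _ (splits m)) ⟩
      S₀ m ℕ.+ sumBy (λ (a , b) → 2 ℕ.* (a ℕ.* g b)) (splits m) ℕ.+ S₂ m
        ≡⟨ cong (λ z → S₀ m ℕ.+ z ℕ.+ S₂ m) (sumBy-* 2 _ (splits m)) ⟩
      S₀ m ℕ.+ 2 ℕ.* S₁ m ℕ.+ S₂ m  ∎
      where
      open ≡-Reasoning
      ring : ∀ a x → suc a ℕ.* suc a ℕ.* x ≡ x ℕ.+ 2 ℕ.* (a ℕ.* x) ℕ.+ a ℕ.* a ℕ.* x
      ring = ℕR.solve-∀

weighted-suc : ∀ c {x p q r} y z → x ≡ y ℕ.+ z → c ℕ.* y ≡ p → c ℕ.* z ≡ q → p ℕ.+ q ≡ r → c ℕ.* x ≡ r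
weighted-suc c y z refl refl refl refl = ℕ.*-distribˡ-+ c y z

nextSquare : ℕ → ℕ
nextSquare b = suc b ℕ.* suc b

-- For quadruples with a + r = m and b + d = r, the pairs (i , k) number (d + 1)², which is
-- `nextSquare d`. Hence `Squares.S₀ r` counts the choices of b, i and k, `Squares².S₀ m` counts all
-- quadruples, `Squares².S₂ m` sums a² over them and `Moments.S₀ m` sums b².
module Squares = Convolution nextSquare
module Squares² = Convolution Squares.S₀
module Moments = Convolution Squares.S₂

Squares-S₀-closed : ∀ m → 6 ℕ.* Squares.S₀ m ≡ suc m ℕ.* (2 ℕ.+ m) ℕ.* (3 ℕ.+ 2 ℕ.* m)
Squares-S₀-closed zero = cong (6 ℕ.*_) Squares.S₀-zero
Squares-S₀-closed (suc m) = weighted-suc 6 (nextSquare (suc m)) (Squares.S₀ m) (Squares.S₀-suc m) refl (Squares-S₀-closed m) (ring m)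
  where
  ring : ∀ m → 6 ℕ.* ((2 ℕ.+ m) ℕ.* (2 ℕ.+ m)) ℕ.+ suc m ℕ.* (2 ℕ.+ m) ℕ.* (3 ℕ.+ 2 ℕ.* m)
    ≡ (2 ℕ.+ m) ℕ.* (3 ℕ.+ m) ℕ.* (3 ℕ.+ 2 ℕ.* suc m)
  ring = ℕR.solve-∀

Squares-S₁-closed : ∀ m → 12 ℕ.* Squares.S₁ m ≡ m ℕ.* suc m ℕ.* suc m ℕ.* (2 ℕ.+ m)
Squares-S₁-closed zero = cong (12 ℕ.*_) Squares.S₁-zero
Squares-S₁-closed (suc m) = weighted-suc 12 (Squares.S₀ m) (Squares.S₁ m) (Squares.S₁-suc m)
  (trans (ℕ.*-assoc 2 6 (Squares.S₀ m)) (cong (2 ℕ.*_) (Squares-S₀-closed m))) (Squares-S₁-closed m) (ring m)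
  where
  ring : ∀ m → 2 ℕ.* (suc m ℕ.* (2 ℕ.+ m) ℕ.* (3 ℕ.+ 2 ℕ.* m)) ℕ.+ m ℕ.* suc m ℕ.* suc m ℕ.* (2 ℕ.+ m)
    ≡ suc m ℕ.* (2 ℕ.+ m) ℕ.* (2 ℕ.+ m) ℕ.* (3 ℕ.+ m)
  ring = ℕR.solve-∀

squares-S₂-poly : ℕ → ℕ
squares-S₂-poly m = m ℕ.* (4 ℕ.+ m ℕ.* (10 ℕ.+ m ℕ.* (10 ℕ.+ m ℕ.* (5 ℕ.+ m))))

Squares-S₂-closed : ∀ m → 30 ℕ.* Squares.S₂ m ≡ squares-S₂-poly m
Squares-S₂-closed zero = cong (30 ℕ.*_) Squares.S₂-zero
Squares-S₂-closed (suc m) = weighted-suc 30 (Squares.S₀ m ℕ.+ 2 ℕ.* Squares.S₁ m) (Squares.S₂ m) (Squares.S₂-suc m)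
  (trans (split (Squares.S₀ m) (Squares.S₁ m)) (cong₂ (λ x y → 5 ℕ.* x ℕ.+ 5 ℕ.* y) (Squares-S₀-closed m) (Squares-S₁-closed m)))
  (Squares-S₂-closed m) (ring m)
  where
  split : ∀ x y → 30 ℕ.* (x ℕ.+ 2 ℕ.* y) ≡ 5 ℕ.* (6 ℕ.* x) ℕ.+ 5 ℕ.* (12 ℕ.* y)
  split = ℕR.solve-∀
  ring : ∀ m → 5 ℕ.* (suc m ℕ.* (2 ℕ.+ m) ℕ.* (3 ℕ.+ 2 ℕ.* m)) ℕ.+ 5 ℕ.* (m ℕ.* suc m ℕ.* suc m ℕ.* (2 ℕ.+ m))
    ℕ.+ m ℕ.* (4 ℕ.+ m ℕ.* (10 ℕ.+ m ℕ.* (10 ℕ.+ m ℕ.* (5 ℕ.+ m))))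
    ≡ suc m ℕ.* (4 ℕ.+ suc m ℕ.* (10 ℕ.+ suc m ℕ.* (10 ℕ.+ suc m ℕ.* (5 ℕ.+ suc m))))
  ring = ℕR.solve-∀

count-poly : ℕ → ℕ
count-poly m = suc m ℕ.* (2 ℕ.+ m) ℕ.* (2 ℕ.+ m) ℕ.* (3 ℕ.+ m)

Squares²-S₀-closed : ∀ m → 12 ℕ.* Squares².S₀ m ≡ count-poly m
Squares²-S₀-closed zero = cong (12 ℕ.*_) (trans Squares².S₀-zero Squares.S₀-zero)
Squares²-S₀-closed (suc m) = weighted-suc 12 (Squares.S₀ (suc m)) (Squares².S₀ m) (Squares².S₀-suc m)
  (trans (ℕ.*-assoc 2 6 (Squares.S₀ (suc m))) (cong (2 ℕ.*_) (Squares-S₀-closed (suc m)))) (Squares²-S₀-closed m) (ring m)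
  where
  ring : ∀ m → 2 ℕ.* ((2 ℕ.+ m) ℕ.* (3 ℕ.+ m) ℕ.* (3 ℕ.+ 2 ℕ.* suc m)) ℕ.+ suc m ℕ.* (2 ℕ.+ m) ℕ.* (2 ℕ.+ m) ℕ.* (3 ℕ.+ m)
    ≡ (2 ℕ.+ m) ℕ.* (3 ℕ.+ m) ℕ.* (3 ℕ.+ m) ℕ.* (4 ℕ.+ m)
  ring = ℕR.solve-∀

Squares²-S₁-closed : ∀ m → 120 ℕ.* Squares².S₁ m ≡ m ℕ.* (18 ℕ.+ m ℕ.* (45 ℕ.+ m ℕ.* (40 ℕ.+ m ℕ.* (15 ℕ.+ 2 ℕ.* m))))
Squares²-S₁-closed zero = cong (120 ℕ.*_) Squares².S₁-zero
Squares²-S₁-closed (suc m) = weighted-suc 120 (Squares².S₀ m) (Squares².S₁ m) (Squares².S₁-suc m)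
  (trans (ℕ.*-assoc 10 12 (Squares².S₀ m)) (cong (10 ℕ.*_) (Squares²-S₀-closed m))) (Squares²-S₁-closed m) (ring m)
  where
  ring : ∀ m → 10 ℕ.* (suc m ℕ.* (2 ℕ.+ m) ℕ.* (2 ℕ.+ m) ℕ.* (3 ℕ.+ m))
    ℕ.+ m ℕ.* (18 ℕ.+ m ℕ.* (45 ℕ.+ m ℕ.* (40 ℕ.+ m ℕ.* (15 ℕ.+ 2 ℕ.* m))))
    ≡ suc m ℕ.* (18 ℕ.+ suc m ℕ.* (45 ℕ.+ suc m ℕ.* (40 ℕ.+ suc m ℕ.* (15 ℕ.+ 2 ℕ.* suc m))))
  ring = ℕR.solve-∀

-- This is 360 times the sum of a² over the quadruples and, by the symmetry between a and b, also
-- 360 times that of b²; hence the factor 180 for a² + b².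
weight-poly : ℕ → ℕ
weight-poly m = m ℕ.* (42 ℕ.+ m ℕ.* (113 ℕ.+ m ℕ.* (120 ℕ.+ m ℕ.* (65 ℕ.+ m ℕ.* (18 ℕ.+ 2 ℕ.* m)))))

Squares²-S₂-closed : ∀ m → 360 ℕ.* Squares².S₂ m ≡ weight-poly m
Squares²-S₂-closed zero = cong (360 ℕ.*_) Squares².S₂-zero
Squares²-S₂-closed (suc m) = weighted-suc 360 (Squares².S₀ m ℕ.+ 2 ℕ.* Squares².S₁ m) (Squares².S₂ m) (Squares².S₂-suc m)
  (trans (split (Squares².S₀ m) (Squares².S₁ m)) (cong₂ (λ x y → 30 ℕ.* x ℕ.+ 6 ℕ.* y) (Squares²-S₀-closed m) (Squares²-S₁-closed m)))
  (Squares²-S₂-closed m) (ring m)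
  where
  split : ∀ x y → 360 ℕ.* (x ℕ.+ 2 ℕ.* y) ≡ 30 ℕ.* (12 ℕ.* x) ℕ.+ 6 ℕ.* (120 ℕ.* y)
  split = ℕR.solve-∀
  ring : ∀ m → 30 ℕ.* (suc m ℕ.* (2 ℕ.+ m) ℕ.* (2 ℕ.+ m) ℕ.* (3 ℕ.+ m))
    ℕ.+ 6 ℕ.* (m ℕ.* (18 ℕ.+ m ℕ.* (45 ℕ.+ m ℕ.* (40 ℕ.+ m ℕ.* (15 ℕ.+ 2 ℕ.* m)))))
    ℕ.+ m ℕ.* (42 ℕ.+ m ℕ.* (113 ℕ.+ m ℕ.* (120 ℕ.+ m ℕ.* (65 ℕ.+ m ℕ.* (18 ℕ.+ 2 ℕ.* m)))))
    ≡ suc m ℕ.* (42 ℕ.+ suc m ℕ.* (113 ℕ.+ suc m ℕ.* (120 ℕ.+ suc m ℕ.* (65 ℕ.+ suc m ℕ.* (18 ℕ.+ 2 ℕ.* suc m)))))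
  ring = ℕR.solve-∀

Moments-S₀-closed : ∀ m → 360 ℕ.* Moments.S₀ m ≡ weight-poly m
Moments-S₀-closed zero = cong (360 ℕ.*_) (trans Moments.S₀-zero Squares.S₂-zero)
Moments-S₀-closed (suc m) = weighted-suc 360 (Squares.S₂ (suc m)) (Moments.S₀ m) (Moments.S₀-suc m)
  (trans (ℕ.*-assoc 12 30 (Squares.S₂ (suc m))) (cong (12 ℕ.*_) (Squares-S₂-closed (suc m)))) (Moments-S₀-closed m) (ring m)
  where
  ring : ∀ m → 12 ℕ.* (suc m ℕ.* (4 ℕ.+ suc m ℕ.* (10 ℕ.+ suc m ℕ.* (10 ℕ.+ suc m ℕ.* (5 ℕ.+ suc m)))))
    ℕ.+ m ℕ.* (42 ℕ.+ m ℕ.* (113 ℕ.+ m ℕ.* (120 ℕ.+ m ℕ.* (65 ℕ.+ m ℕ.* (18 ℕ.+ 2 ℕ.* m)))))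
    ≡ suc m ℕ.* (42 ℕ.+ suc m ℕ.* (113 ℕ.+ suc m ℕ.* (120 ℕ.+ suc m ℕ.* (65 ℕ.+ suc m ℕ.* (18 ℕ.+ 2 ℕ.* suc m)))))
  ring = ℕR.solve-∀

-- Enumeration of the quadruples

-- ((a , r) , (b , d) , (i , k)) stands for (a , b , i , k), where quads m imposes i + a + b ≤ m and
-- k + a + b ≤ m; the components r = m - a and d = r - b record the room left.
Quad : Set
Quad = (ℕ × ℕ) × (ℕ × ℕ) × (ℕ × ℕ)

pairsUpTo : ℕ → List (ℕ × ℕ)
pairsUpTo d = dependentPairs (upTo d) (λ _ → upTo d)

quadsOver : ℕ × ℕ → List ((ℕ × ℕ) × (ℕ × ℕ))
quadsOver (_ , r) = dependentPairs (splits r) (λ (_ , d) → pairsUpTo (suc d))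

quads : ℕ → List Quad
quads m = dependentPairs (splits m) quadsOver

unique-quads : ∀ m → Unique (quads m)
unique-quads m = unique-dependentPairs (unique-splits m) λ (_ , r) →
  unique-dependentPairs (unique-splits r) λ (_ , d) →
  unique-dependentPairs (Unique.upTo⁺ (suc d)) (λ _ → Unique.upTo⁺ (suc d))

∈-quads⁺ : ∀ m a b i k → i ℕ.+ (a ℕ.+ b) ℕ.≤ m → k ℕ.+ (a ℕ.+ b) ℕ.≤ m →
  ∃₂ λ r d → ((a , r) , (b , d) , (i , k)) ∈ quads m
∈-quads⁺ m a b i k i≤ k≤ = b ℕ.+ d , d ,
  ∈-dependentPairs⁺ (subst (λ z → (a , b ℕ.+ d) ∈ splits z) m≡ (∈-splits⁺ a (b ℕ.+ d)))
    (∈-dependentPairs⁺ {xs = splits (b ℕ.+ d)} (∈-splits⁺ b d)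
      (∈-dependentPairs⁺ (∈-upTo⁺ (s≤s (≤d i≤))) (∈-upTo⁺ (s≤s (≤d k≤)))))
  where
  d = m ℕ.∸ (a ℕ.+ b)
  m≡ : a ℕ.+ (b ℕ.+ d) ≡ m
  m≡ = trans (sym (ℕ.+-assoc a b d)) (ℕ.m+[n∸m]≡n (ℕ.m+n≤o⇒n≤o i i≤))
  ≤d : ∀ {x} → x ℕ.+ (a ℕ.+ b) ℕ.≤ m → x ℕ.≤ d
  ≤d {x} x≤ = ℕ.m+n≤o⇒m≤o∸n x x≤

-- The first two equations say that r and d are determined by the other entries, which later lets
-- the digits alone identify an index.
∈-quads⁻ : ∀ m {a r b d i k} → ((a , r) , (b , d) , (i , k)) ∈ quads m →
  r ≡ m ℕ.∸ a × d ≡ r ℕ.∸ b × i ℕ.+ (a ℕ.+ b) ℕ.≤ m × k ℕ.+ (a ℕ.+ b) ℕ.≤ m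
∈-quads⁻ m {a} {r} {b} {d} {i} {k} x∈ with ∈-dependentPairs⁻ (splits m) x∈
... | ar∈ , y∈ with ∈-dependentPairs⁻ (splits r) y∈
... | bd∈ , ik∈ with ∈-dependentPairs⁻ (upTo (suc d)) {λ _ → upTo (suc d)} ik∈ | ∈-splits⁻ m ar∈ | ∈-splits⁻ r bd∈
... | i∈ , k∈ | refl | refl = sym (ℕ.m+n∸m≡n a r) , sym (ℕ.m+n∸m≡n b d) , ≤m (∈-upTo⁻ i∈) , ≤m (∈-upTo⁻ k∈)
  where
  ring : ∀ a b d → d ℕ.+ (a ℕ.+ b) ≡ a ℕ.+ (b ℕ.+ d)
  ring = ℕR.solve-∀
  ≤m : ∀ {x} → x ℕ.< suc d → x ℕ.+ (a ℕ.+ b) ℕ.≤ a ℕ.+ (b ℕ.+ d)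
  ≤m {x} (s≤s x≤d) = subst (x ℕ.+ (a ℕ.+ b) ℕ.≤_) (ring a b d) (ℕ.+-monoˡ-≤ (a ℕ.+ b) x≤d)

length≡sumBy : {A : Set} (xs : List A) → length xs ≡ sumBy (λ _ → 1) xs
length≡sumBy xs = sym (trans (sumBy-const 1 xs) (ℕ.*-identityʳ _))

quadsOver-sum : (f : ℕ → ℕ) (p : ℕ × ℕ) →
  sumBy (λ ((b , _) , _) → f b) (quadsOver p) ≡ sumBy (λ (b , d) → f b ℕ.* nextSquare d) (splits (proj₂ p))
quadsOver-sum f (_ , r) = trans (sumBy-dependentPairs _ (splits r) (λ (_ , d) → pairsUpTo (suc d))) (sumBy-cong inner (splits r))
  where
  inner : ∀ ((b , d) : ℕ × ℕ) → sumBy (λ _ → f b) (pairsUpTo (suc d)) ≡ f b ℕ.* nextSquare d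
  inner (b , d) = begin
    sumBy (λ _ → f b) (pairsUpTo (suc d))         ≡⟨ sumBy-dependentPairs _ us (λ _ → us) ⟩
    sumBy (λ _ → sumBy (λ _ → f b) us) us         ≡⟨ sumBy-const _ us ⟩
    length us ℕ.* sumBy (λ _ → f b) us            ≡⟨ cong (length us ℕ.*_) (sumBy-const (f b) us) ⟩
    length us ℕ.* (length us ℕ.* f b)             ≡⟨ cong (λ z → z ℕ.* (z ℕ.* f b)) (length-upTo (suc d)) ⟩
    suc d ℕ.* (suc d ℕ.* f b)                     ≡⟨ ring (suc d) (f b) ⟩
    f b ℕ.* nextSquare d                              ∎
    where
    open ≡-Reasoning
    us = upTo (suc d)
    ring : ∀ d x → d ℕ.* (d ℕ.* x) ≡ x ℕ.* (d ℕ.* d)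
    ring = ℕR.solve-∀

length-quadsOver : ∀ p → length (quadsOver p) ≡ Squares.S₀ (proj₂ p)
length-quadsOver p = trans (length≡sumBy (quadsOver p))
  (trans (quadsOver-sum (λ _ → 1) p)
    (trans (sumBy-cong (λ (_ , d) → ℕ.*-identityˡ (nextSquare d)) (splits (proj₂ p))) (Squares.S₀-def (proj₂ p))))

length-quads : ∀ m → length (quads m) ≡ Squares².S₀ m
length-quads m = trans (length≡sumBy (quads m)) (trans (sumBy-dependentPairs _ (splits m) _)
  (trans (sumBy-cong (λ p → trans (sym (length≡sumBy (quadsOver p))) (length-quadsOver p)) (splits m)) (Squares².S₀-def m)))

quadWeight : Quad → ℕ
quadWeight ((a , _) , (b , _) , _) = a ℕ.* a ℕ.+ b ℕ.* b

sum-quadWeight : ∀ m → sumBy quadWeight (quads m) ≡ Squares².S₂ m ℕ.+ Moments.S₀ m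
sum-quadWeight m = trans (sumBy-dependentPairs quadWeight (splits m) _)
  (trans (sumBy-cong outer (splits m)) 
    (trans (sumBy-+ (λ (a , r) → a ℕ.* a ℕ.* Squares.S₀ r) _ (splits m)) (cong₂ ℕ._+_ (Squares².S₂-def m) (Moments.S₀-def m))))
  where
  outer : ∀ ((a , r) : ℕ × ℕ) → sumBy (λ y → quadWeight ((a , r) , y)) (quadsOver (a , r)) ≡
    a ℕ.* a ℕ.* Squares.S₀ r ℕ.+ Squares.S₂ r
  outer (a , r) = trans (sumBy-+ (λ _ → a ℕ.* a) _ (quadsOver (a , r)))
    (cong₂ ℕ._+_
      (trans (sumBy-const _ (quadsOver (a , r)))
        (trans (cong (ℕ._* (a ℕ.* a)) (length-quadsOver (a , r))) (ℕ.*-comm (Squares.S₀ r) (a ℕ.* a))))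
      (trans (quadsOver-sum (λ b → b ℕ.* b) (a , r)) (Squares.S₂-def r)))

length-quads-closed : ∀ m → 12 ℕ.* length (quads m) ≡ count-poly m
length-quads-closed m = trans (cong (12 ℕ.*_) (length-quads m)) (Squares²-S₀-closed m)

sum-quadWeight-closed : ∀ m → 180 ℕ.* sumBy quadWeight (quads m) ≡ weight-poly m
sum-quadWeight-closed m = ℕ.*-cancelˡ-≡ _ _ 2 (begin
  2 ℕ.* (180 ℕ.* sumBy quadWeight (quads m))  ≡⟨ cong (λ z → 2 ℕ.* (180 ℕ.* z)) (sum-quadWeight m) ⟩
  2 ℕ.* (180 ℕ.* (Squares².S₂ m ℕ.+ Moments.S₀ m))         ≡⟨ split (Squares².S₂ m) (Moments.S₀ m) ⟩
  360 ℕ.* Squares².S₂ m ℕ.+ 360 ℕ.* Moments.S₀ m           ≡⟨ cong₂ ℕ._+_ (Squares²-S₂-closed m) (Moments-S₀-closed m) ⟩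
  weight-poly m ℕ.+ weight-poly m                       ≡⟨ cong (weight-poly m ℕ.+_) (ℕ.+-identityʳ (weight-poly m)) ⟨
  2 ℕ.* weight-poly m                              ∎)
  where
  open ≡-Reasoning
  split : ∀ x y → 2 ℕ.* (180 ℕ.* (x ℕ.+ y)) ≡ 360 ℕ.* x ℕ.+ 360 ℕ.* y
  split = ℕR.solve-∀

-- Polynomial inequalities behind the rate of convergence

-- Inequalities between polynomials with natural coefficients, decided by comparing coefficients.
infixl 6 _⊞_
infixl 7 _⊠_

data Poly : Set where
  con : ℕ → Poly
  X : Poly
  _⊞_ _⊠_ : Poly → Poly → Poly

⟦_⟧ : Poly → ℕ → ℕ
⟦ con k ⟧ m = k
⟦ X ⟧ m = m
⟦ p ⊞ q ⟧ m = ⟦ p ⟧ m ℕ.+ ⟦ q ⟧ m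
⟦ p ⊠ q ⟧ m = ⟦ p ⟧ m ℕ.* ⟦ q ⟧ m

horner : List ℕ → ℕ → ℕ
horner [] m = 0
horner (a ∷ as) m = a ℕ.+ m ℕ.* horner as m

addCoeffs : List ℕ → List ℕ → List ℕ
addCoeffs [] bs = bs
addCoeffs as@(_ ∷ _) [] = as
addCoeffs (a ∷ as) (b ∷ bs) = a ℕ.+ b ∷ addCoeffs as bs

mulCoeffs : List ℕ → List ℕ → List ℕ
mulCoeffs [] bs = []
mulCoeffs (a ∷ as) bs = addCoeffs (map (a ℕ.*_) bs) (0 ∷ mulCoeffs as bs)

coeffs : Poly → List ℕ
coeffs (con k) = k ∷ []
coeffs X = 0 ∷ 1 ∷ []
coeffs (p ⊞ q) = addCoeffs (coeffs p) (coeffs q)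
coeffs (p ⊠ q) = mulCoeffs (coeffs p) (coeffs q)

horner-add : ∀ as bs m → horner (addCoeffs as bs) m ≡ horner as m ℕ.+ horner bs m
horner-add [] bs m = refl
horner-add (a ∷ as) [] m = sym (ℕ.+-identityʳ _)
horner-add (a ∷ as) (b ∷ bs) m = trans (cong (λ z → a ℕ.+ b ℕ.+ m ℕ.* z) (horner-add as bs m))
  (ring a b m (horner as m) (horner bs m))
  where
  ring : ∀ a b m x y → a ℕ.+ b ℕ.+ m ℕ.* (x ℕ.+ y) ≡ a ℕ.+ m ℕ.* x ℕ.+ (b ℕ.+ m ℕ.* y)
  ring = ℕR.solve-∀

horner-map : ∀ a bs m → horner (map (a ℕ.*_) bs) m ≡ a ℕ.* horner bs m
horner-map a [] m = sym (ℕ.*-zeroʳ a)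
horner-map a (b ∷ bs) m = trans (cong (λ z → a ℕ.* b ℕ.+ m ℕ.* z) (horner-map a bs m)) (ring a b m (horner bs m))
  where
  ring : ∀ a b m x → a ℕ.* b ℕ.+ m ℕ.* (a ℕ.* x) ≡ a ℕ.* (b ℕ.+ m ℕ.* x)
  ring = ℕR.solve-∀

horner-mul : ∀ as bs m → horner (mulCoeffs as bs) m ≡ horner as m ℕ.* horner bs m
horner-mul [] bs m = refl
horner-mul (a ∷ as) bs m = trans (horner-add (map (a ℕ.*_) bs) (0 ∷ mulCoeffs as bs) m)
  (trans (cong₂ (λ x y → x ℕ.+ m ℕ.* y) (horner-map a bs m) (horner-mul as bs m))
    (ring a m (horner as m) (horner bs m)))
  where
  ring : ∀ a m x y → a ℕ.* y ℕ.+ m ℕ.* (x ℕ.* y) ≡ (a ℕ.+ m ℕ.* x) ℕ.* y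
  ring = ℕR.solve-∀

horner-coeffs : ∀ p m → horner (coeffs p) m ≡ ⟦ p ⟧ m
horner-coeffs (con k) m = trans (cong (k ℕ.+_) (ℕ.*-zeroʳ m)) (ℕ.+-identityʳ k)
horner-coeffs X m = trans (cong (λ z → m ℕ.* (1 ℕ.+ z)) (ℕ.*-zeroʳ m)) (ℕ.*-identityʳ m)
horner-coeffs (p ⊞ q) m = trans (horner-add (coeffs p) (coeffs q) m) (cong₂ ℕ._+_ (horner-coeffs p m) (horner-coeffs q m))
horner-coeffs (p ⊠ q) m = trans (horner-mul (coeffs p) (coeffs q) m) (cong₂ ℕ._*_ (horner-coeffs p m) (horner-coeffs q m))

-- A sufficient criterion only. The bounds are therefore written in m with n = 4 + m: in terms of n,
-- the polynomials at n - 4 would have negative coefficients.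
_≼ᵇ_ : List ℕ → List ℕ → Bool
[] ≼ᵇ bs = true
(_ ∷ _) ≼ᵇ [] = false
(a ∷ as) ≼ᵇ (b ∷ bs) = (a ℕ.≤ᵇ b) ∧ (as ≼ᵇ bs)

horner-mono : ∀ as bs m → T (as ≼ᵇ bs) → horner as m ℕ.≤ horner bs m
horner-mono [] bs m _ = z≤n
horner-mono (a ∷ as) (b ∷ bs) m as≼bs with Equivalence.to T-∧ as≼bs
... | a≤b , as≼bs′ = ℕ.+-mono-≤ (ℕ.≤ᵇ⇒≤ a b a≤b) (ℕ.*-monoʳ-≤ m (horner-mono as bs m as≼bs′))

poly-mono : ∀ p q {_ : T (coeffs p ≼ᵇ coeffs q)} → ∀ m → ⟦ p ⟧ m ℕ.≤ ⟦ q ⟧ m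
poly-mono p q {p≼q} m = subst₂ ℕ._≤_ (horner-coeffs p m) (horner-coeffs q m) (horner-mono (coeffs p) (coeffs q) m p≼q)

countᴾ weightᴾ : Poly → Poly
countᴾ p = (con 1 ⊞ p) ⊠ (con 2 ⊞ p) ⊠ (con 2 ⊞ p) ⊠ (con 3 ⊞ p)
weightᴾ p = p ⊠ (con 42 ⊞ p ⊠ (con 113 ⊞ p ⊠ (con 120 ⊞ p ⊠ (con 65 ⊞ p ⊠ (con 18 ⊞ con 2 ⊠ p)))))

abstract
  -- Any constant for which the two coefficientwise comparisons succeed will do.
  K : ℕ
  K = 6000

  -- The leading terms agree, so the left side exceeds 2 n² times the count by a polynomial of
  -- degree 5 at most, which the term with `K` absorbs. The constant coefficients account for the
  -- size of `K`: at m = 0 the inequality reads 241920 ≤ 12 (32 + 4 K), that is, K ≥ 5032.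
  count-weight-upper : ∀ m → let n = 4 ℕ.+ m in
    weight-poly n ℕ.+ 15 ℕ.* count-poly n ℕ.* (2 ℕ.* n ℕ.+ 2) ℕ.≤ (2 ℕ.* (n ℕ.* n) ℕ.+ K ℕ.* n) ℕ.* count-poly m
  count-weight-upper = poly-mono (weightᴾ N ⊞ con 15 ⊠ countᴾ N ⊠ (con 2 ⊠ N ⊞ con 2)) ((con 2 ⊠ (N ⊠ N) ⊞ con K ⊠ N) ⊠ countᴾ X)
    where
    N : Poly
    N = con 4 ⊞ X

  count-weight-lower : ∀ m → let n = 4 ℕ.+ m in
    2 ℕ.* (n ℕ.* n) ℕ.* count-poly n ℕ.≤ weight-poly m ℕ.+ K ℕ.* n ℕ.* count-poly m
  count-weight-lower = poly-mono (con 2 ⊠ (N ⊠ N) ⊠ countᴾ N) (weightᴾ X ⊞ con K ⊠ N ⊠ countᴾ X)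
    where
    N : Poly
    N = con 4 ⊞ X

-- The term 2 n + 2 is the largest excess of (a + 1)² + (b + 1)² over a² + b² when a + b ≤ n. The
-- left side concerns the quadruples that bound the total area from above, the right side those that
-- bound the number of miniatures from below.
upper-quads-bound : ∀ m → let n = 4 ℕ.+ m in
  15 ℕ.* (sumBy quadWeight (quads n) ℕ.+ length (quads n) ℕ.* (2 ℕ.* n ℕ.+ 2)) ℕ.≤
  (2 ℕ.* (n ℕ.* n) ℕ.+ K ℕ.* n) ℕ.* length (quads m)
upper-quads-bound m = scale (4 ℕ.+ m)
  {sumBy quadWeight (quads (4 ℕ.+ m))} {length (quads (4 ℕ.+ m))} {length (quads m)}
  (sum-quadWeight-closed (4 ℕ.+ m)) (length-quads-closed (4 ℕ.+ m))
  (length-quads-closed m) (count-weight-upper m)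
  where
  split₁ : ∀ w l n → 180 ℕ.* w ℕ.+ 15 ℕ.* (12 ℕ.* l) ℕ.* (2 ℕ.* n ℕ.+ 2) ≡ 12 ℕ.* (15 ℕ.* (w ℕ.+ l ℕ.* (2 ℕ.* n ℕ.+ 2)))
  split₁ = ℕR.solve-∀
  split₂ : ∀ x l → x ℕ.* (12 ℕ.* l) ≡ 12 ℕ.* (x ℕ.* l)
  split₂ = ℕR.solve-∀
  scale : ∀ n {w l l′ W D D′} → 180 ℕ.* w ≡ W → 12 ℕ.* l ≡ D → 12 ℕ.* l′ ≡ D′ →
    W ℕ.+ 15 ℕ.* D ℕ.* (2 ℕ.* n ℕ.+ 2) ℕ.≤ (2 ℕ.* (n ℕ.* n) ℕ.+ K ℕ.* n) ℕ.* D′ →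
    15 ℕ.* (w ℕ.+ l ℕ.* (2 ℕ.* n ℕ.+ 2)) ℕ.≤ (2 ℕ.* (n ℕ.* n) ℕ.+ K ℕ.* n) ℕ.* l′
  scale n {w} {l} {l′} refl refl refl ≤ = ℕ.*-cancelˡ-≤ 12 (subst₂ ℕ._≤_ (split₁ w l n) (split₂ (2 ℕ.* (n ℕ.* n) ℕ.+ K ℕ.* n) l′) ≤)

lower-quads-bound : ∀ m → let n = 4 ℕ.+ m in
  2 ℕ.* (n ℕ.* n) ℕ.* length (quads n) ℕ.≤
  15 ℕ.* sumBy quadWeight (quads m) ℕ.+ K ℕ.* n ℕ.* length (quads m)
lower-quads-bound m = scale (4 ℕ.+ m)
  {sumBy quadWeight (quads m)} {length (quads (4 ℕ.+ m))} {length (quads m)}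
  (sum-quadWeight-closed m) (length-quads-closed (4 ℕ.+ m))
  (length-quads-closed m) (count-weight-lower m)
  where
  split₁ : ∀ w x l → 180 ℕ.* w ℕ.+ x ℕ.* (12 ℕ.* l) ≡ 12 ℕ.* (15 ℕ.* w ℕ.+ x ℕ.* l)
  split₁ = ℕR.solve-∀
  split₂ : ∀ x l → x ℕ.* (12 ℕ.* l) ≡ 12 ℕ.* (x ℕ.* l)
  split₂ = ℕR.solve-∀
  scale : ∀ n {w l l′ W D D′} → 180 ℕ.* w ≡ W → 12 ℕ.* l ≡ D → 12 ℕ.* l′ ≡ D′ →
    2 ℕ.* (n ℕ.* n) ℕ.* D ℕ.≤ W ℕ.+ K ℕ.* n ℕ.* D′ →
    2 ℕ.* (n ℕ.* n) ℕ.* l ℕ.≤ 15 ℕ.* w ℕ.+ K ℕ.* n ℕ.* l′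
  scale n {w} {l} {l′} refl refl refl ≤ = ℕ.*-cancelˡ-≤ 12 (subst₂ ℕ._≤_ (split₂ (2 ℕ.* (n ℕ.* n)) l) (split₁ w (K ℕ.* n) l′) ≤)

length-quads-positive : ∀ m → 1 ℕ.≤ length (quads m)
length-quads-positive zero = s≤s z≤n
length-quads-positive (suc m) = subst (1 ℕ.≤_) (sym (trans (length-quads (suc m)) (Squares².S₀-suc m)))
  (ℕ.≤-trans (subst (1 ℕ.≤_) (length-quads m) (length-quads-positive m)) (ℕ.m≤n+m _ (Squares.S₀ (suc m))))

-- Integer squares and their four listings

Vec : Set
Vec = ℤ × ℤ

infixl 6 _+ᵛ_
_+ᵛ_ : Vec → Vec → Vec
(a , b) +ᵛ (c , d) = a ℤ.+ c , b ℤ.+ d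

rot : Vec → Vec
rot (a , b) = ℤ.- b , a

+ᵛ-cancelˡ : ∀ x {y z} → x +ᵛ y ≡ x +ᵛ z → y ≡ z
+ᵛ-cancelˡ (x₁ , x₂) eq = cong₂ _,_ (∙-cancelˡ x₁ _ _ (cong proj₁ eq)) (∙-cancelˡ x₂ _ _ (cong proj₂ eq))
  where open import Algebra.Properties.AbelianGroup ℤ.+-0-abelianGroup using (∙-cancelˡ)

Rep : Set
Rep = Vec × Vec

-- The same square, listed from the next vertex.
turn : Rep → Rep
turn (w , v) = w +ᵛ v , rot v

turns : ℕ → Rep → Rep
turns zero r = r
turns (suc t) r = turn (turns t r)

turns-+ : ∀ s t r → turns s (turns t r) ≡ turns (s ℕ.+ t) r
turns-+ zero t r = refl
turns-+ (suc s) t r = cong turn (turns-+ s t r)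

turns-4 : ∀ r → turns 4 r ≡ r
turns-4 ((w₁ , w₂) , (v₁ , v₂)) = cong₂ _,_ (cong₂ _,_ (ring₁ w₁ v₁ v₂) (ring₂ w₂ v₁ v₂)) (cong₂ _,_ (ring₃ v₁) (ring₃ v₂))
  where
  ring₁ : ∀ w a b → w ℤ.+ a ℤ.+ (ℤ.- b) ℤ.+ (ℤ.- a) ℤ.+ (ℤ.- (ℤ.- b)) ≡ w
  ring₁ = ℤR.solve-∀
  ring₂ : ∀ w a b → w ℤ.+ b ℤ.+ a ℤ.+ (ℤ.- b) ℤ.+ (ℤ.- a) ≡ w
  ring₂ = ℤR.solve-∀
  ring₃ : ∀ a → ℤ.- (ℤ.- a) ≡ a
  ring₃ = ℤR.solve-∀

turns-4* : ∀ t r → turns (4 ℕ.* t) r ≡ r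
turns-4* zero r = refl
turns-4* (suc t) r = trans (cong (λ s → turns s r) (ring t))
  (trans (sym (turns-+ 4 (4 ℕ.* t) r)) (trans (turns-4 _) (turns-4* t r)))
  where
  ring : ∀ t → 4 ℕ.* suc t ≡ 4 ℕ.+ 4 ℕ.* t
  ring = ℕR.solve-∀

_~_ : Rep → Rep → Set
r ~ s = ∃ λ t → turns t r ≡ s

~-trans : ∀ {x y z} → x ~ y → y ~ z → x ~ z
~-trans {x} (s , refl) (t , refl) = t ℕ.+ s , sym (turns-+ t s x)

-- After t turns, another 3 t complete t full circles.
~-sym : ∀ {x y} → x ~ y → y ~ x
~-sym {x} (t , refl) = 3 ℕ.* t , trans (turns-+ (3 ℕ.* t) t x) (trans (cong (λ s → turns s x) (ring t)) (turns-4* t x))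
  where
  ring : ∀ t → 3 ℕ.* t ℕ.+ t ≡ 4 ℕ.* t
  ring = ℕR.solve-∀

-- Half-open, so that its four quarter turns partition the nonzero vectors: each nondegenerate
-- square has exactly one listing with such an edge.
FirstQuadrant : Vec → Set
FirstQuadrant (a , b) = 0ℤ ℤ.< a × 0ℤ ℤ.≤ b

firstQuadrant-turn : ∀ w v → v ≢ (0ℤ , 0ℤ) → ∃ λ s → (w , v) ~ s × FirstQuadrant (proj₂ s)
firstQuadrant-turn w (+ 0 , + 0) v≢0 = ⊥-elim (v≢0 refl)
firstQuadrant-turn w (+ suc a , + b) _ = _ , (0 , refl) , ℤ.+<+ (s≤s z≤n) , ℤ.+≤+ z≤n
firstQuadrant-turn w (+ 0 , + suc b) _ = _ , (3 , refl) , ℤ.+<+ (s≤s z≤n) , ℤ.+≤+ z≤n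
firstQuadrant-turn w (-[1+ a ] , + suc b) _ = _ , (3 , refl) , ℤ.+<+ (s≤s z≤n) , ℤ.+≤+ z≤n
firstQuadrant-turn w (-[1+ a ] , + 0) _ = _ , (2 , refl) , ℤ.+<+ (s≤s z≤n) , ℤ.+≤+ z≤n
firstQuadrant-turn w (-[1+ a ] , -[1+ b ]) _ = _ , (2 , refl) , ℤ.+<+ (s≤s z≤n) , ℤ.+≤+ z≤n
firstQuadrant-turn w (+ a , -[1+ b ]) _ = _ , (1 , refl) , ℤ.+<+ (s≤s z≤n) , ℤ.+≤+ z≤n

firstQuadrant-unique : ∀ {r s} → r ~ s → FirstQuadrant (proj₂ r) → FirstQuadrant (proj₂ s) → r ≡ s
firstQuadrant-unique (zero , refl) _ _ = refl
firstQuadrant-unique {_ , (+ suc a , + zero)} (1 , refl) _ (ℤ.+<+ () , _)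
firstQuadrant-unique {_ , (+ suc a , + suc b)} (1 , refl) _ (() , _)
firstQuadrant-unique {_ , (+ zero , _)} (suc _ , _) (ℤ.+<+ () , _) _
firstQuadrant-unique {_ , (-[1+ _ ] , _)} (suc _ , _) (() , _) _
firstQuadrant-unique {_ , (_ , -[1+ _ ])} (suc _ , _) (_ , ()) _
firstQuadrant-unique {_ , (+ suc a , b)} (2 , refl) _ (() , _)
firstQuadrant-unique {_ , (+ suc a , + b)} (3 , refl) _ (_ , ())
firstQuadrant-unique {r} (suc (suc (suc (suc t))) , refl) p q =
  trans (firstQuadrant-unique (t , refl) p (subst (λ s → FirstQuadrant (proj₂ s)) (turns-4 (turns t r)) q))
    (sym (turns-4 (turns t r)))

norm² : Vec → ℕ
norm² (a , b) = ℤ.∣ a ∣ ℕ.* ℤ.∣ a ∣ ℕ.+ ℤ.∣ b ∣ ℕ.* ℤ.∣ b ∣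

norm²-rot : ∀ v → norm² (rot v) ≡ norm² v
norm²-rot (a , b) rewrite ℤ.∣-i∣≡∣i∣ b = ℕ.+-comm (ℤ.∣ b ∣ ℕ.* ℤ.∣ b ∣) _

norm²-~ : ∀ {r s} → r ~ s → norm² (proj₂ r) ≡ norm² (proj₂ s)
norm²-~ (zero , refl) = refl
norm²-~ {r} (suc t , refl) = trans (norm²-~ {r} (t , refl)) (sym (norm²-rot (proj₂ (turns t r))))

+∣i∣*∣i∣ : ∀ i → + (ℤ.∣ i ∣ ℕ.* ℤ.∣ i ∣) ≡ i ℤ.* i
+∣i∣*∣i∣ (+ n) = ℤ.pos-* n n
+∣i∣*∣i∣ -[1+ n ] = refl

+norm² : ∀ a b → + norm² (a , b) ≡ a ℤ.* a ℤ.+ b ℤ.* b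
+norm² a b = cong₂ ℤ._+_ (+∣i∣*∣i∣ a) (+∣i∣*∣i∣ b)

InBox : ℕ → Vec → Set
InBox N (a , b) = 0ℤ ℤ.≤ a × a ℤ.≤ + N × 0ℤ ℤ.≤ b × b ℤ.≤ + N

Inside : ℕ → Rep → Set
Inside N (w , v) = InBox N w × InBox N (w +ᵛ v) × InBox N (w +ᵛ v +ᵛ rot v) × InBox N (w +ᵛ rot v)

inside-turn : ∀ N r → Inside N r → Inside N (turn r)
inside-turn N ((w₁ , w₂) , (v₁ , v₂)) (A , B , C , D) =
  B , C , subst (InBox N) (cong₂ _,_ (ring₁ w₁ v₁ (ℤ.- v₂)) (ring₁ w₂ v₂ v₁)) D ,
  subst (InBox N) (cong₂ _,_ (ring₂ w₁ v₁) (ring₂ w₂ v₂)) A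
  where
  ring₁ : ∀ w v u → w ℤ.+ u ≡ w ℤ.+ v ℤ.+ u ℤ.+ ℤ.- v
  ring₁ = ℤR.solve-∀
  ring₂ : ∀ w v → w ≡ w ℤ.+ v ℤ.+ ℤ.- v
  ring₂ = ℤR.solve-∀

inside-~ : ∀ N {r s} → r ~ s → Inside N r → Inside N s
inside-~ N (zero , refl) ins = ins
inside-~ N {r} (suc t , refl) ins = inside-turn N (turns t r) (inside-~ N {r} (t , refl) ins)

0≤x+y : ∀ {x y} → 0ℤ ℤ.≤ x → 0ℤ ℤ.≤ y → 0ℤ ℤ.≤ x ℤ.+ y
0≤x+y = ℤ.+-mono-≤

x+y≤z⇒x≤z : ∀ {x y z} → 0ℤ ℤ.≤ y → x ℤ.+ y ℤ.≤ z → x ℤ.≤ z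
x+y≤z⇒x≤z {x} {y} 0≤y x+y≤z =
  ℤ.≤-trans (subst (ℤ._≤ x ℤ.+ y) (ℤ.+-identityʳ x) (ℤ.+-monoʳ-≤ x 0≤y)) x+y≤z

-- With such an edge, each side of the box is critical at a single vertex: the left one at w + rot
-- v, the right one at w + v, the lower one at w and the upper one at w + v + rot v. The other
-- coordinates lie between these extremes.
inside-firstQuadrant : ∀ N u u′ a b → 0ℤ ℤ.≤ a → 0ℤ ℤ.≤ b → 0ℤ ℤ.≤ u ℤ.- b → u ℤ.+ a ℤ.≤ + N →
  0ℤ ℤ.≤ u′ → u′ ℤ.+ a ℤ.+ b ℤ.≤ + N → Inside N ((u , u′) , (a , b))
inside-firstQuadrant N u u′ a b 0≤a 0≤b 0≤u-b u+a≤N 0≤u′ u′+a+b≤N =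
  (0≤u , x+y≤z⇒x≤z 0≤a u+a≤N , 0≤u′ , x+y≤z⇒x≤z 0≤a u′+a≤N) ,
  (0≤x+y 0≤u 0≤a , u+a≤N , 0≤x+y 0≤u′ 0≤b , x+y≤z⇒x≤z 0≤a u′+b+a≤N) ,
  (subst (0ℤ ℤ.≤_) (swap u (ℤ.- b) a) (0≤x+y 0≤u-b 0≤a) , x+y≤z⇒x≤z 0≤b (subst (ℤ._≤ + N) (cancel (u ℤ.+ a) b) u+a≤N) ,
    0≤x+y (0≤x+y 0≤u′ 0≤b) 0≤a , u′+b+a≤N) ,
  (0≤u-b , x+y≤z⇒x≤z 0≤a (x+y≤z⇒x≤z 0≤b (subst (ℤ._≤ + N) (trans (cancel (u ℤ.+ a) b) (cong (ℤ._+ b) (swap u a (ℤ.- b)))) u+a≤N)) ,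
    0≤x+y 0≤u′ 0≤a , u′+a≤N)
  where
  swap : ∀ x y z → x ℤ.+ y ℤ.+ z ≡ x ℤ.+ z ℤ.+ y
  swap = ℤR.solve-∀
  cancel : ∀ x y → x ≡ x ℤ.+ ℤ.- y ℤ.+ y
  cancel = ℤR.solve-∀
  0≤u : 0ℤ ℤ.≤ u
  0≤u = subst (0ℤ ℤ.≤_) (sym (cancel u b)) (0≤x+y 0≤u-b 0≤b)
  u′+a≤N : u′ ℤ.+ a ℤ.≤ + N
  u′+a≤N = x+y≤z⇒x≤z 0≤b u′+a+b≤N
  u′+b+a≤N : u′ ℤ.+ b ℤ.+ a ℤ.≤ + N
  u′+b+a≤N = subst (ℤ._≤ + N) (swap u′ a b) u′+a+b≤N

-- Division with remainder by the sublattice of the outer square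

intRange : ℕ → List ℤ
intRange B = map +_ (upTo (suc B)) ++ map -[1+_] (upTo B)

∈-intRange : ∀ {B} z → ℤ.∣ z ∣ ℕ.≤ B → z ∈ intRange B
∈-intRange (+ n) n≤B = ∈-++⁺ˡ (∈-map⁺ +_ (∈-upTo⁺ (s≤s n≤B)))
∈-intRange {B} -[1+ n ] n<B = ∈-++⁺ʳ (map +_ (upTo (suc B))) (∈-map⁺ -[1+_] (∈-upTo⁺ n<B))

unique-intRange : ∀ B → Unique (intRange B)
unique-intRange B = Unique.++⁺ (Unique.map⁺ (λ { refl → refl }) (Unique.upTo⁺ (suc B)))
  (Unique.map⁺ (λ { refl → refl }) (Unique.upTo⁺ B)) disjoint
  where
  disjoint : ∀ {z} → z ∈ map +_ (upTo (suc B)) × z ∈ map -[1+_] (upTo B) → ⊥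
  disjoint (z∈₁ , z∈₂) with ∈-map⁻ +_ z∈₁ | ∈-map⁻ -[1+_] z∈₂
  ... | _ , _ , refl | _ , _ , ()

-- The sublattice spanned by (p , q) and (- q , p), of index D = suc d. Squares are described in the frame
-- of this basis, in which the outer square of side n becomes the box [0, n D]².
module Frame (p q : ℤ) (d : ℕ) (p²+q²≡D : p ℤ.* p ℤ.+ q ℤ.* q ≡ + suc d) where

  D : ℕ
  D = suc d

  -- In terms of Gaussian integers, `frame` is multiplication by p - q i, `combine` is
  -- multiplication by p + q i and `rot` is multiplication by i. So `frame` commutes with `rot`,
  -- both composites of `frame` and `combine` are multiplication by D, and `norm²-frame` is the
  -- multiplicativity of the norm.
  frame : Vec → Vec
  frame (x , y) = x ℤ.* p ℤ.+ y ℤ.* q , x ℤ.* (ℤ.- q) ℤ.+ y ℤ.* p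

  combine : Vec → Vec
  combine (j , k) = p ℤ.* j ℤ.+ ℤ.- (q ℤ.* k) , q ℤ.* j ℤ.+ p ℤ.* k

  frame-+ : ∀ x y → frame (x +ᵛ y) ≡ frame x +ᵛ frame y
  frame-+ (x₁ , x₂) (y₁ , y₂) = cong₂ _,_ (ring x₁ x₂ y₁ y₂ p q) (ring x₁ x₂ y₁ y₂ (ℤ.- q) p)
    where
    ring : ∀ a b c d p q → (a ℤ.+ c) ℤ.* p ℤ.+ (b ℤ.+ d) ℤ.* q ≡ a ℤ.* p ℤ.+ b ℤ.* q ℤ.+ (c ℤ.* p ℤ.+ d ℤ.* q)
    ring = ℤR.solve-∀

  frame-rot : ∀ x → frame (rot x) ≡ rot (frame x)
  frame-rot (x , y) = cong₂ _,_ (ring₁ x y p q) (ring₂ x y p q)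
    where
    ring₁ : ∀ x y p q → ℤ.- y ℤ.* p ℤ.+ x ℤ.* q ≡ ℤ.- (x ℤ.* (ℤ.- q) ℤ.+ y ℤ.* p)
    ring₁ = ℤR.solve-∀
    ring₂ : ∀ x y p q → ℤ.- y ℤ.* (ℤ.- q) ℤ.+ x ℤ.* p ≡ x ℤ.* p ℤ.+ y ℤ.* q
    ring₂ = ℤR.solve-∀

  frame-combine : ∀ j k → frame (combine (j , k)) ≡ (+ D ℤ.* j , + D ℤ.* k)
  frame-combine j k = cong₂ _,_ (trans (ring₁ j k p q) (cong (ℤ._* j) p²+q²≡D)) (trans (ring₂ j k p q) (cong (ℤ._* k) p²+q²≡D))
    where
    ring₁ : ∀ j k p q → (p ℤ.* j ℤ.+ ℤ.- (q ℤ.* k)) ℤ.* p ℤ.+ (q ℤ.* j ℤ.+ p ℤ.* k) ℤ.* q ≡ (p ℤ.* p ℤ.+ q ℤ.* q) ℤ.* j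
    ring₁ = ℤR.solve-∀
    ring₂ : ∀ j k p q → (p ℤ.* j ℤ.+ ℤ.- (q ℤ.* k)) ℤ.* (ℤ.- q) ℤ.+ (q ℤ.* j ℤ.+ p ℤ.* k) ℤ.* p ≡ (p ℤ.* p ℤ.+ q ℤ.* q) ℤ.* k
    ring₂ = ℤR.solve-∀

  combine-frame : ∀ x y → combine (frame (x , y)) ≡ (+ D ℤ.* x , + D ℤ.* y)
  combine-frame x y = cong₂ _,_ (trans (ring₁ x y p q) (cong (ℤ._* x) p²+q²≡D)) (trans (ring₂ x y p q) (cong (ℤ._* y) p²+q²≡D))
    where
    ring₁ : ∀ x y p q → p ℤ.* (x ℤ.* p ℤ.+ y ℤ.* q) ℤ.+ ℤ.- (q ℤ.* (x ℤ.* (ℤ.- q) ℤ.+ y ℤ.* p)) ≡ (p ℤ.* p ℤ.+ q ℤ.* q) ℤ.* x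
    ring₁ = ℤR.solve-∀
    ring₂ : ∀ x y p q → q ℤ.* (x ℤ.* p ℤ.+ y ℤ.* q) ℤ.+ p ℤ.* (x ℤ.* (ℤ.- q) ℤ.+ y ℤ.* p) ≡ (p ℤ.* p ℤ.+ q ℤ.* q) ℤ.* y
    ring₂ = ℤR.solve-∀

  frame-injective : ∀ {x y} → frame x ≡ frame y → x ≡ y
  frame-injective {x₁ , x₂} {y₁ , y₂} fx≡fy = cong₂ _,_ (cancel (cong proj₁ eq)) (cancel (cong proj₂ eq))
    where
    eq : (+ D ℤ.* x₁ , + D ℤ.* x₂) ≡ (+ D ℤ.* y₁ , + D ℤ.* y₂)
    eq = trans (sym (combine-frame x₁ x₂)) (trans (cong combine fx≡fy) (combine-frame y₁ y₂))
    cancel : ∀ {z t} → + D ℤ.* z ≡ + D ℤ.* t → z ≡ t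
    cancel = ℤ.*-cancelˡ-≡ (+ D) _ _

  frame≢0 : ∀ x → x ≢ (0ℤ , 0ℤ) → frame x ≢ (0ℤ , 0ℤ)
  frame≢0 x x≢0 fx≡0 = x≢0 (frame-injective {x} {0ℤ , 0ℤ} fx≡0)

  norm²-frame : ∀ x → D ℕ.* norm² x ≡ norm² (frame x)
  norm²-frame (x , y) = ℤ.+-injective (begin
    + (D ℕ.* norm² (x , y))                               ≡⟨ ℤ.pos-* D (norm² (x , y)) ⟩
    + D ℤ.* + norm² (x , y)                               ≡⟨ cong₂ ℤ._*_ (sym p²+q²≡D) (+norm² x y) ⟩
    (p ℤ.* p ℤ.+ q ℤ.* q) ℤ.* (x ℤ.* x ℤ.+ y ℤ.* y)       ≡⟨ ring x y p q ⟩
    (x ℤ.* p ℤ.+ y ℤ.* q) ℤ.* (x ℤ.* p ℤ.+ y ℤ.* q) ℤ.+ (x ℤ.* (ℤ.- q) ℤ.+ y ℤ.* p) ℤ.* (x ℤ.* (ℤ.- q) ℤ.+ y ℤ.* p)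
                                                          ≡⟨ +norm² (x ℤ.* p ℤ.+ y ℤ.* q) (x ℤ.* (ℤ.- q) ℤ.+ y ℤ.* p) ⟨
    + norm² (frame (x , y))                               ∎)
    where
    open ≡-Reasoning
    ring : ∀ x y p q → (p ℤ.* p ℤ.+ q ℤ.* q) ℤ.* (x ℤ.* x ℤ.+ y ℤ.* y) ≡
      (x ℤ.* p ℤ.+ y ℤ.* q) ℤ.* (x ℤ.* p ℤ.+ y ℤ.* q) ℤ.+ (x ℤ.* (ℤ.- q) ℤ.+ y ℤ.* p) ℤ.* (x ℤ.* (ℤ.- q) ℤ.+ y ℤ.* p)
    ring = ℤR.solve-∀

  frameRep : Rep → Rep
  frameRep (w , v) = frame w , frame v

  frameRep-turns : ∀ t r → frameRep (turns t r) ≡ turns t (frameRep r)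
  frameRep-turns zero r = refl
  frameRep-turns (suc t) r = trans
    (cong₂ _,_ (frame-+ (proj₁ (turns t r)) (proj₂ (turns t r))) (frame-rot (proj₂ (turns t r))))
    (cong turn (frameRep-turns t r))

  frameRep-~ : ∀ {r s} → r ~ s → frameRep r ~ frameRep s
  frameRep-~ {r} (t , refl) = t , sym (frameRep-turns t r)

  HalfOpenBox : Vec → Set
  HalfOpenBox (x , y) = 0ℤ ℤ.≤ x × x ℤ.< + D × 0ℤ ℤ.≤ y × y ℤ.< + D

  -- Residues fill a half-open fundamental square of the sublattice: every vector is, in exactly one
  -- way, the sum of a sublattice vector and a residue.
  Residue : Vec → Set
  Residue s = HalfOpenBox (frame s)

  residue? : ∀ s → Dec (Residue s)
  residue? s = (0ℤ ℤ.≤? proj₁ (frame s)) ×-dec (proj₁ (frame s) ℤ.<? + D) ×-dec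
    (0ℤ ℤ.≤? proj₂ (frame s)) ×-dec (proj₂ (frame s) ℤ.<? + D)

  residue-coordinates : ∀ {s} → Residue s → ∃₂ λ x y → x ℕ.< D × y ℕ.< D × frame s ≡ (+ x , + y)
  residue-coordinates {s} = coordinates (frame s)
    where
    coordinates : ∀ v → HalfOpenBox v → ∃₂ λ x y → x ℕ.< D × y ℕ.< D × v ≡ (+ x , + y)
    coordinates (+ x , + y) (_ , ℤ.+<+ x<D , _ , ℤ.+<+ y<D) = x , y , x<D , y<D , refl
    coordinates (-[1+ _ ] , _) (() , _)
    coordinates (+ _ , -[1+ _ ]) (_ , _ , () , _)

  -- For a residue s, D s is `combine (frame s)`, and the coordinates of `frame s` are below D.
  -- Hence each coordinate of s has absolute value at most |p| + |q|, which gives a finite box to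
  -- search.
  radius : ℕ
  radius = ℤ.∣ p ∣ ℕ.+ ℤ.∣ q ∣

  residues : List Vec
  residues = filter residue? (dependentPairs (intRange radius) (λ _ → intRange radius))

  unique-residues : Unique residues
  unique-residues = Unique.filter⁺ residue? (unique-dependentPairs (unique-intRange radius) (λ _ → unique-intRange radius))

  ∈-residues⁻ : ∀ {s} → s ∈ residues → Residue s
  ∈-residues⁻ s∈ = proj₂ (∈-filter⁻ residue? {xs = dependentPairs (intRange radius) (λ _ → intRange radius)} s∈)

  combination-bound : ∀ p q x y z → x ℕ.≤ D → y ℕ.≤ D → p ℤ.* + x ℤ.+ q ℤ.* + y ≡ + D ℤ.* z →
    ℤ.∣ z ∣ ℕ.≤ ℤ.∣ p ∣ ℕ.+ ℤ.∣ q ∣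
  combination-bound p q x y z x≤D y≤D eq = ℕ.*-cancelˡ-≤ D (begin
    D ℕ.* ℤ.∣ z ∣                                  ≡⟨ ℤ.∣i*j∣≡∣i∣*∣j∣ (+ D) z ⟨
    ℤ.∣ + D ℤ.* z ∣                                ≡⟨ cong ℤ.∣_∣ eq ⟨
    ℤ.∣ p ℤ.* + x ℤ.+ q ℤ.* + y ∣                  ≤⟨ ℤ.∣i+j∣≤∣i∣+∣j∣ (p ℤ.* + x) (q ℤ.* + y) ⟩
    ℤ.∣ p ℤ.* + x ∣ ℕ.+ ℤ.∣ q ℤ.* + y ∣            ≡⟨ cong₂ ℕ._+_ (ℤ.∣i*j∣≡∣i∣*∣j∣ p (+ x)) (ℤ.∣i*j∣≡∣i∣*∣j∣ q (+ y)) ⟩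
    ℤ.∣ p ∣ ℕ.* x ℕ.+ ℤ.∣ q ∣ ℕ.* y                ≤⟨ ℕ.+-mono-≤ (ℕ.*-monoʳ-≤ ℤ.∣ p ∣ x≤D) (ℕ.*-monoʳ-≤ ℤ.∣ q ∣ y≤D) ⟩
    ℤ.∣ p ∣ ℕ.* D ℕ.+ ℤ.∣ q ∣ ℕ.* D                ≡⟨ ℕ.*-distribʳ-+ D ℤ.∣ p ∣ ℤ.∣ q ∣ ⟨
    (ℤ.∣ p ∣ ℕ.+ ℤ.∣ q ∣) ℕ.* D                    ≡⟨ ℕ.*-comm (ℤ.∣ p ∣ ℕ.+ ℤ.∣ q ∣) D ⟩
    D ℕ.* (ℤ.∣ p ∣ ℕ.+ ℤ.∣ q ∣)                    ∎)
    where open ℕ.≤-Reasoning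

  ∈-residues⁺ : ∀ s → Residue s → s ∈ residues
  ∈-residues⁺ s@(s₁ , s₂) res with residue-coordinates {s} res
  ... | x , y , x<D , y<D , fs≡ = ∈-filter⁺ residue? (∈-dependentPairs⁺ (∈-intRange s₁ bound₁) (∈-intRange s₂ bound₂)) res
    where
    eq : (p ℤ.* + x ℤ.+ ℤ.- (q ℤ.* + y) , q ℤ.* + x ℤ.+ p ℤ.* + y) ≡ (+ D ℤ.* s₁ , + D ℤ.* s₂)
    eq = trans (cong combine (sym fs≡)) (combine-frame s₁ s₂)
    bound₁ : ℤ.∣ s₁ ∣ ℕ.≤ radius
    bound₁ = subst (λ z → ℤ.∣ s₁ ∣ ℕ.≤ ℤ.∣ p ∣ ℕ.+ z) (ℤ.∣-i∣≡∣i∣ q) (combination-bound p (ℤ.- q) x y s₁ (ℕ.<⇒≤ x<D) (ℕ.<⇒≤ y<D)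
      (trans (cong (λ z → p ℤ.* + x ℤ.+ z) (sym (ℤ.neg-distribˡ-* q (+ y)))) (cong proj₁ eq)))
    bound₂ : ℤ.∣ s₂ ∣ ℕ.≤ radius
    bound₂ = subst (ℤ.∣ s₂ ∣ ℕ.≤_) (ℕ.+-comm ℤ.∣ q ∣ ℤ.∣ p ∣) (combination-bound q p x y s₂ (ℕ.<⇒≤ x<D) (ℕ.<⇒≤ y<D) (cong proj₂ eq))

  0∈residues : (0ℤ , 0ℤ) ∈ residues
  0∈residues = ∈-residues⁺ (0ℤ , 0ℤ) (ℤ.+≤+ z≤n , ℤ.+<+ (s≤s z≤n) , ℤ.+≤+ z≤n , ℤ.+<+ (s≤s z≤n))

  -- Divide both frame coordinates by D. The sublattice vector with these quotients j has frame D j,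
  -- so subtracting it leaves precisely the remainders.
  residue-division : ∀ v → ∃₂ λ j s → Residue s × v ≡ combine j +ᵛ s
  residue-division v@(v₁ , v₂) = (j₁ , j₂) , s , subst HalfOpenBox (sym frame-s) bounds , v≡
    where
    a b j₁ j₂ : ℤ
    a = proj₁ (frame v)
    b = proj₂ (frame v)
    j₁ = a ℤ./ + D
    j₂ = b ℤ./ + D
    negᵛ : Vec → Vec
    negᵛ (x , y) = ℤ.- x , ℤ.- y
    s : Vec
    s = v +ᵛ negᵛ (combine (j₁ , j₂))
    ring : ∀ v c → v ≡ c ℤ.+ (v ℤ.+ ℤ.- c)
    ring = ℤR.solve-∀
    v≡ : v ≡ combine (j₁ , j₂) +ᵛ s
    v≡ = cong₂ _,_ (ring v₁ (proj₁ (combine (j₁ , j₂)))) (ring v₂ (proj₂ (combine (j₁ , j₂))))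
    cancel : ∀ x k r → x ≡ r ℤ.+ k ℤ.* + D → + D ℤ.* k ℤ.+ r ≡ x
    cancel _ k r refl = trans (ℤ.+-comm (+ D ℤ.* k) r) (cong (λ z → r ℤ.+ z) (ℤ.*-comm (+ D) k))
    frame-s : frame s ≡ (+ (a ℤ.% + D) , + (b ℤ.% + D))
    frame-s = +ᵛ-cancelˡ (+ D ℤ.* j₁ , + D ℤ.* j₂) (begin
      (+ D ℤ.* j₁ , + D ℤ.* j₂) +ᵛ frame s    ≡⟨ cong (_+ᵛ frame s) (frame-combine j₁ j₂) ⟨
      frame (combine (j₁ , j₂)) +ᵛ frame s    ≡⟨ frame-+ (combine (j₁ , j₂)) s ⟨
      frame (combine (j₁ , j₂) +ᵛ s)          ≡⟨ cong frame v≡ ⟨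
      frame v                                 ≡⟨ cong₂ _,_ (cancel a j₁ _ (ℤ.a≡a%n+[a/n]*n a (+ D))) (cancel b j₂ _ (ℤ.a≡a%n+[a/n]*n b (+ D))) ⟨
      (+ D ℤ.* j₁ , + D ℤ.* j₂) +ᵛ (+ (a ℤ.% + D) , + (b ℤ.% + D))  ∎)
      where open ≡-Reasoning
    bounds : HalfOpenBox (+ (a ℤ.% + D) , + (b ℤ.% + D))
    bounds = ℤ.+≤+ z≤n , ℤ.+<+ (ℤ.n%d<d a (+ D)) , ℤ.+≤+ z≤n , ℤ.+<+ (ℤ.n%d<d b (+ D))

  frame-combine-+ : ∀ j k s {x y} → frame s ≡ (+ x , + y) →
    frame (combine (j , k) +ᵛ s) ≡ (+ D ℤ.* j ℤ.+ + x , + D ℤ.* k ℤ.+ + y)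
  frame-combine-+ j k s eq = trans (frame-+ (combine (j , k)) s) (cong₂ _+ᵛ_ (frame-combine j k) eq)

  frame-combine-+ℕ : ∀ a b s {x y} → frame s ≡ (+ x , + y) →
    frame (combine (+ a , + b) +ᵛ s) ≡ (+ (D ℕ.* a ℕ.+ x) , + (D ℕ.* b ℕ.+ y))
  frame-combine-+ℕ a b s {x} {y} eq = trans (frame-combine-+ (+ a) (+ b) s eq)
    (cong₂ (λ α β → α ℤ.+ + x , β ℤ.+ + y) (sym (ℤ.pos-* D a)) (sym (ℤ.pos-* D b)))

  -- From D j < D (k + 1) follows j < k + 1. This comparison of quotients gives the uniqueness of
  -- digits and all the inequalities between digits in `index-of-digits`.
  D*-cancel-≤ : ∀ {j k x y} → x ℤ.≤ y → + D ℤ.* j ℤ.≤ x → y ℤ.< + D ℤ.* k ℤ.+ + D → j ℤ.≤ k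
  D*-cancel-≤ {j} {k} x≤y Dj≤x y<Dk+D = subst (j ℤ.≤_) (ℤ.pred-suc k) (ℤ.i<j⇒i≤pred[j]
    (ℤ.*-cancelˡ-<-nonNeg (+ D) (subst (+ D ℤ.* j ℤ.<_) (ring (+ D) k) (ℤ.≤-<-trans (ℤ.≤-trans Dj≤x x≤y) y<Dk+D))))
    where
    ring : ∀ d k → d ℤ.* k ℤ.+ d ≡ d ℤ.* (1ℤ ℤ.+ k)
    ring = ℤR.solve-∀

  i≤i+ : ∀ i x → i ℤ.≤ i ℤ.+ + x
  i≤i+ i x = subst (ℤ._≤ i ℤ.+ + x) (ℤ.+-identityʳ i) (ℤ.+-monoʳ-≤ i (ℤ.+≤+ z≤n))

  D*-unique : ∀ j k {x y} → x ℕ.< D → y ℕ.< D → + D ℤ.* j ℤ.+ + x ≡ + D ℤ.* k ℤ.+ + y → j ≡ k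
  D*-unique j k {x} {y} x<D y<D eq = ℤ.≤-antisym
    (D*-cancel-≤ (ℤ.≤-reflexive eq) (i≤i+ _ x) (ℤ.+-monoʳ-< (+ D ℤ.* k) (ℤ.+<+ y<D)))
    (D*-cancel-≤ (ℤ.≤-reflexive (sym eq)) (i≤i+ _ y) (ℤ.+-monoʳ-< (+ D ℤ.* j) (ℤ.+<+ x<D)))

  combine-+-unique : ∀ j k s t → Residue s → Residue t → combine j +ᵛ s ≡ combine k +ᵛ t → j ≡ k × s ≡ t
  combine-+-unique (j₁ , j₂) (k₁ , k₂) s t res-s res-t eq
    with residue-coordinates {s} res-s | residue-coordinates {t} res-t
  ... | x , y , x<D , y<D , fs≡ | x′ , y′ , x′<D , y′<D , ft≡ = j≡k , s≡t
    where
    feq : (+ D ℤ.* j₁ ℤ.+ + x , + D ℤ.* j₂ ℤ.+ + y) ≡ (+ D ℤ.* k₁ ℤ.+ + x′ , + D ℤ.* k₂ ℤ.+ + y′)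
    feq = trans (sym (frame-combine-+ j₁ j₂ s fs≡)) (trans (cong frame eq) (frame-combine-+ k₁ k₂ t ft≡))
    j≡k : (j₁ , j₂) ≡ (k₁ , k₂)
    j≡k = cong₂ _,_ (D*-unique j₁ k₁ x<D x′<D (cong proj₁ feq)) (D*-unique j₂ k₂ y<D y′<D (cong proj₂ feq))
    s≡t : s ≡ t
    s≡t = +ᵛ-cancelˡ (combine (j₁ , j₂)) (trans eq (cong (λ z → combine z +ᵛ t) (sym j≡k)))

-- Miniatures as integer listings, and their indices

_≟ᵛ_ : DecidableEquality Vec
_≟ᵛ_ = ≡-dec ℤ._≟_ ℤ._≟_

_≟ʳ_ : DecidableEquality Rep
_≟ʳ_ = ≡-dec _≟ᵛ_ _≟ᵛ_

firstQuadrant? : ∀ v → Dec (FirstQuadrant v)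
firstQuadrant? (a , b) = (0ℤ ℤ.<? a) ×-dec (0ℤ ℤ.≤? b)

inBox? : ∀ N v → Dec (InBox N v)
inBox? N (a , b) = (0ℤ ℤ.≤? a) ×-dec (a ℤ.≤? + N) ×-dec (0ℤ ℤ.≤? b) ×-dec (b ℤ.≤? + N)

inside? : ∀ N r → Dec (Inside N r)
inside? N (w , v) = inBox? N _ ×-dec inBox? N _ ×-dec inBox? N _ ×-dec inBox? N _

canonical : Rep → Rep
canonical (w , v) with v ≟ᵛ (0ℤ , 0ℤ)
-- A degenerate listing has no form with edge in the first quadrant. It is returned as it is, and
-- the filter in `miniatures` discards it.
... | yes _ = w , v
... | no v≢0 = proj₁ (firstQuadrant-turn w v v≢0)

firstQuadrant≢0 : ∀ {v} → FirstQuadrant v → v ≢ (0ℤ , 0ℤ)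
firstQuadrant≢0 (ℤ.+<+ () , _) refl

canonical-~ : ∀ r s → FirstQuadrant (proj₂ r) → r ~ s → canonical s ≡ r
canonical-~ r (w , v) fq r~s with v ≟ᵛ (0ℤ , 0ℤ)
... | yes refl = ⊥-elim (norm²≢0 (proj₂ r) fq (norm²-~ r~s))
  where
  norm²≢0 : ∀ v → FirstQuadrant v → norm² v ≢ 0
  norm²≢0 (+ suc a , _) _ ()
  norm²≢0 (+ zero , _) (ℤ.+<+ () , _) _
  norm²≢0 (-[1+ _ ] , _) (() , _) _
... | no v≢0 with firstQuadrant-turn w v v≢0
... | s′ , s~s′ , fq′ = sym (firstQuadrant-unique (~-trans r~s s~s′) fq fq′)

module Miniatures (p q : ℤ) (d : ℕ) (p²+q²≡D : p ℤ.* p ℤ.+ q ℤ.* q ≡ + suc d) where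
  open Frame p q d p²+q²≡D

  -- The two conditions refer to different axes: the edge is normalised in the original ones, as in
  -- `Canonical`, whereas containment is read off in the frame.
  IsMini : ℕ → Rep → Set
  IsMini n r = FirstQuadrant (proj₂ r) × Inside (n ℕ.* D) (frameRep r)

  Index : Set
  Index = Quad × (Vec × Vec)

  residuePairs : List (Vec × Vec)
  residuePairs = dependentPairs residues (λ _ → residues)

  indices : ℕ → List Index
  indices n = dependentPairs (quads n) (λ _ → residuePairs)

  -- The corner has first quotient k + b, so k measures the room to the left of the whole square. On
  -- quotients, the left and right conditions then become 0 ≤ k and k + a + b ≤ n, of the same shape
  -- as the lower and upper ones for i.
  decode : Index → Rep
  decode (((a , _) , (b , _) , (k , i)) , (s′ , s)) =
    combine (+ (k ℕ.+ b) , + i) +ᵛ s′ , combine (+ a , + b) +ᵛ s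

  -- In the frame, u - b ≥ 0 is the leftmost abscissa of the square, hence the first index is the quotient of u minus that of b.
  index-of-digits : ∀ n w v → FirstQuadrant (frame v) → Inside (n ℕ.* D) (frame w , frame v) →
    ∀ i₁ i₂ j₁ j₂ s s′ → Residue s → Residue s′ → w ≡ combine (i₁ , i₂) +ᵛ s′ → v ≡ combine (j₁ , j₂) +ᵛ s →
    ∀ {y₁ y₂ x₁ x₂} → y₁ ℕ.< D → y₂ ℕ.< D → x₁ ℕ.< D → x₂ ℕ.< D →
    frame s′ ≡ (+ y₁ , + y₂) → frame s ≡ (+ x₁ , + x₂) →
    ∃ λ x → x ∈ indices n × decode x ≡ (w , v)
  index-of-digits n w v fq ins i₁ i₂ j₁ j₂ s s′ res res′ w≡ v≡ {y₁} {y₂} {x₁} {x₂} y₁<D y₂<D x₁<D x₂<D fs′≡ fs≡ =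
    build i₁ i₂ j₁ j₂ 0≤j₁ 0≤j₂ 0≤i₂ j₂≤i₁ i₁+j₁≤n i₂+j₁+j₂≤n w≡ v≡
    where
    u u′ a b : ℤ
    u = + D ℤ.* i₁ ℤ.+ + y₁
    u′ = + D ℤ.* i₂ ℤ.+ + y₂
    a = + D ℤ.* j₁ ℤ.+ + x₁
    b = + D ℤ.* j₂ ℤ.+ + x₂
    fw≡ : frame w ≡ (u , u′)
    fw≡ = trans (cong frame w≡) (frame-combine-+ i₁ i₂ s′ fs′≡)
    fv≡ : frame v ≡ (a , b)
    fv≡ = trans (cong frame v≡) (frame-combine-+ j₁ j₂ s fs≡)
    fq′ : FirstQuadrant (a , b)
    fq′ = subst FirstQuadrant fv≡ fq
    ins′ : Inside (n ℕ.* D) ((u , u′) , (a , b))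
    ins′ = subst (Inside (n ℕ.* D)) (cong₂ _,_ fw≡ fv≡) ins
    below-next : ∀ k {x} → x ℕ.< D → + D ℤ.* k ℤ.+ + x ℤ.< + D ℤ.* k ℤ.+ + D
    below-next k x<D = ℤ.+-monoʳ-< (+ D ℤ.* k) (ℤ.+<+ x<D)
    quotient≥0 : ∀ k {x} → x ℕ.< D → 0ℤ ℤ.≤ + D ℤ.* k ℤ.+ + x → 0ℤ ℤ.≤ k
    quotient≥0 k x<D 0≤ = D*-cancel-≤ 0≤ (ℤ.≤-reflexive (ℤ.*-zeroʳ (+ D))) (below-next k x<D)
    quotient≤n : ∀ k {x} → + D ℤ.* k ℤ.≤ x → x ℤ.≤ + (n ℕ.* D) → k ℤ.≤ + n
    quotient≤n k Dk≤x x≤nD = D*-cancel-≤ x≤nD Dk≤x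
      (subst (ℤ._< + D ℤ.* + n ℤ.+ + D) (trans (ℤ.*-comm (+ D) (+ n)) (sym (ℤ.pos-* n D)))
        (subst (ℤ._< + D ℤ.* + n ℤ.+ + D) (ℤ.+-identityʳ _) (ℤ.+-monoʳ-< (+ D ℤ.* + n) (ℤ.+<+ (s≤s z≤n)))))
    0≤j₁ : 0ℤ ℤ.≤ j₁
    0≤j₁ = quotient≥0 j₁ x₁<D (ℤ.<⇒≤ (proj₁ fq′))
    0≤j₂ : 0ℤ ℤ.≤ j₂
    0≤j₂ = quotient≥0 j₂ x₂<D (proj₂ fq′)
    0≤i₂ : 0ℤ ℤ.≤ i₂
    0≤i₂ = quotient≥0 i₂ y₂<D (proj₁ (proj₂ (proj₂ (proj₁ ins′))))
    j₂≤i₁ : j₂ ℤ.≤ i₁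
    j₂≤i₁ = D*-cancel-≤ (ℤ.0≤i-j⇒j≤i (proj₁ (proj₂ (proj₂ (proj₂ ins′))))) (i≤i+ _ x₂) (below-next i₁ y₁<D)
    i₁+j₁≤n : i₁ ℤ.+ j₁ ℤ.≤ + n
    i₁+j₁≤n = quotient≤n (i₁ ℤ.+ j₁)
      (subst (+ D ℤ.* (i₁ ℤ.+ j₁) ℤ.≤_) (ring (+ D) i₁ j₁ (+ y₁) (+ x₁)) (i≤i+ _ (y₁ ℕ.+ x₁)))
      (proj₁ (proj₂ (proj₁ (proj₂ ins′))))
      where
      ring : ∀ d i j y x → d ℤ.* (i ℤ.+ j) ℤ.+ (y ℤ.+ x) ≡ d ℤ.* i ℤ.+ y ℤ.+ (d ℤ.* j ℤ.+ x)
      ring = ℤR.solve-∀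
    i₂+j₁+j₂≤n : i₂ ℤ.+ (j₁ ℤ.+ j₂) ℤ.≤ + n
    i₂+j₁+j₂≤n = quotient≤n (i₂ ℤ.+ (j₁ ℤ.+ j₂))
      (subst (+ D ℤ.* (i₂ ℤ.+ (j₁ ℤ.+ j₂)) ℤ.≤_) (ring (+ D) i₂ j₁ j₂ (+ y₂) (+ x₁) (+ x₂)) (i≤i+ _ (y₂ ℕ.+ (x₁ ℕ.+ x₂))))
      (proj₂ (proj₂ (proj₂ (proj₁ (proj₂ (proj₂ ins′))))))
      where
      ring : ∀ d i j k y x z → d ℤ.* (i ℤ.+ (j ℤ.+ k)) ℤ.+ (y ℤ.+ (x ℤ.+ z)) ≡
        d ℤ.* i ℤ.+ y ℤ.+ (d ℤ.* k ℤ.+ z) ℤ.+ (d ℤ.* j ℤ.+ x)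
      ring = ℤR.solve-∀
    build : ∀ i₁ i₂ j₁ j₂ → 0ℤ ℤ.≤ j₁ → 0ℤ ℤ.≤ j₂ → 0ℤ ℤ.≤ i₂ → j₂ ℤ.≤ i₁ → i₁ ℤ.+ j₁ ℤ.≤ + n →
      i₂ ℤ.+ (j₁ ℤ.+ j₂) ℤ.≤ + n → w ≡ combine (i₁ , i₂) +ᵛ s′ → v ≡ combine (j₁ , j₂) +ᵛ s →
      ∃ λ x → x ∈ indices n × decode x ≡ (w , v)
    build (+ c) (+ i) (+ a) (+ b) _ _ _ (ℤ.+≤+ b≤c) (ℤ.+≤+ c+a≤n) (ℤ.+≤+ i+a+b≤n) w≡ v≡ =
      let _ , _ , quad∈ = ∈-quads⁺ n a b (c ℕ.∸ b) i k+a+b≤n i+a+b≤n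
      in (((a , _) , (b , _) , (c ℕ.∸ b , i)) , (s′ , s)) ,
         ∈-dependentPairs⁺ quad∈ (∈-dependentPairs⁺ (∈-residues⁺ s′ res′) (∈-residues⁺ s res)) ,
         cong₂ _,_ (trans (cong (λ z → combine (+ z , + i) +ᵛ s′) (ℕ.m∸n+n≡m b≤c)) (sym w≡)) (sym v≡)
      where
      ring : ∀ k b a → k ℕ.+ b ℕ.+ a ≡ k ℕ.+ (a ℕ.+ b)
      ring = ℕR.solve-∀
      k+a+b≤n : c ℕ.∸ b ℕ.+ (a ℕ.+ b) ℕ.≤ n
      k+a+b≤n = subst (ℕ._≤ n) (trans (cong (ℕ._+ a) (sym (ℕ.m∸n+n≡m b≤c))) (ring (c ℕ.∸ b) b a)) c+a≤n

  index-of-inside : ∀ n r → FirstQuadrant (frame (proj₂ r)) → Inside (n ℕ.* D) (frameRep r) →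
    ∃ λ x → x ∈ indices n × decode x ≡ r
  index-of-inside n r@(w , v) fq ins =
    let (i₁ , i₂) , s′ , res′ , w≡ = residue-division w
        (j₁ , j₂) , s , res , v≡ = residue-division v
        y₁ , y₂ , y₁<D , y₂<D , fs′≡ = residue-coordinates {s′} res′
        x₁ , x₂ , x₁<D , x₂<D , fs≡ = residue-coordinates {s} res
    in index-of-digits n w v fq ins i₁ i₂ j₁ j₂ s s′ res res′ w≡ v≡ y₁<D y₂<D x₁<D x₂<D fs′≡ fs≡

  frameRep-~⁻ : ∀ r {f} → frameRep r ~ f → ∃ λ r′ → r ~ r′ × frameRep r′ ≡ f
  frameRep-~⁻ r (t , refl) = turns t r , (t , refl) , frameRep-turns t r

  -- A listing normalised in the original axes need not be normalised in the frame. Since `frame`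
  -- commutes with turning, the turns that normalise the framed edge can be performed on r itself,
  -- and containment survives them.
  index-of-mini : ∀ n r → IsMini n r → ∃ λ x → x ∈ indices n × r ~ decode x
  index-of-mini n r@(w , v) (fq , ins) =
    let f , f~ , fq′ = firstQuadrant-turn (frame w) (frame v) (frame≢0 v (firstQuadrant≢0 fq))
        r′ , r~r′ , r′≡ = frameRep-~⁻ r f~
        x , x∈ , x≡ = index-of-inside n r′ (subst (λ f → FirstQuadrant (proj₂ f)) (sym r′≡) fq′)
          (inside-~ (n ℕ.* D) {frameRep r} {frameRep r′} (frameRep-~ {r} {r′} r~r′) ins)
    in x , x∈ , subst (r ~_) (sym x≡) r~r′

  isMini? : ∀ n r → Dec (IsMini n r)
  isMini? n r = firstQuadrant? (proj₂ r) ×-dec inside? (n ℕ.* D) (frameRep r)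

  -- By `index-of-mini` the indices reach every miniature up to turning, so they form a finite
  -- search space. Distinct indices may list one square from different vertices, for instance when
  -- an edge is parallel to a side of the box; hence the deduplication.
  miniatures : ℕ → List Rep
  miniatures n = deduplicate _≟ʳ_ (filter (isMini? n) (map (canonical ∘ decode) (indices n)))

  unique-miniatures : ∀ n → Unique (miniatures n)
  unique-miniatures n = DecUnique.deduplicate-! _≟ʳ_ _

  ∈-miniatures⁻ : ∀ n {r} → r ∈ miniatures n → IsMini n r
  ∈-miniatures⁻ n r∈ = proj₂ (∈-filter⁻ (isMini? n) {xs = map (canonical ∘ decode) (indices n)} (∈-deduplicate⁻ _≟ʳ_ _ r∈))

  ∈-miniatures⁺ : ∀ n {r} → IsMini n r → r ∈ miniatures n
  ∈-miniatures⁺ n {r} mini =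
    let x , x∈ , r~ = index-of-mini n r mini
    in ∈-deduplicate⁺ _≟ʳ_ (∈-filter⁺ (isMini? n)
      (subst (_∈ map (canonical ∘ decode) (indices n)) (canonical-~ r (decode x) (proj₁ mini) r~)
        (∈-map⁺ (canonical ∘ decode) x∈)) mini)

-- Bounds on the number and the total area of the miniatures

canonical-firstQuadrant : ∀ r → proj₂ r ≢ (0ℤ , 0ℤ) → r ~ canonical r × FirstQuadrant (proj₂ (canonical r))
canonical-firstQuadrant (w , v) v≢0 with v ≟ᵛ (0ℤ , 0ℤ)
... | yes v≡0 = ⊥-elim (v≢0 v≡0)
... | no v≢0′ = proj₂ (firstQuadrant-turn w v v≢0′)

length-positive : {A : Set} {x : A} {xs : List A} → x ∈ xs → 1 ℕ.≤ length xs
length-positive {xs = _ ∷ _} _ = s≤s z≤n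

square-mono : ∀ {x y} → x ℕ.≤ y → x ℕ.* x ℕ.≤ y ℕ.* y
square-mono x≤y = ℕ.*-mono-≤ x≤y x≤y

module Counting (p q : ℤ) (d : ℕ) (p²+q²≡D : p ℤ.* p ℤ.+ q ℤ.* q ≡ + suc d) where
  open Frame p q d p²+q²≡D
  open Miniatures p q d p²+q²≡D

  -- A residue is shorter than D in each coordinate, so enlarging the first and third index by one and
  -- the box by four leaves room for it: the shifted index always yields a square inside the larger box.
  shift : Index → Index
  shift (((a , r) , (b , e) , (k , i)) , ss) = (((suc a , r) , (b , e) , (suc k , i)) , ss)

  weight : Index → ℕ
  weight x = quadWeight (proj₁ x)

  indices⁻ : ∀ n {a r b e k i s′ s} → (((a , r) , (b , e) , (k , i)) , (s′ , s)) ∈ indices n →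
    (r ≡ n ℕ.∸ a × e ≡ r ℕ.∸ b × k ℕ.+ (a ℕ.+ b) ℕ.≤ n × i ℕ.+ (a ℕ.+ b) ℕ.≤ n) × Residue s′ × Residue s
  indices⁻ n x∈ =
    let quad∈ , ss∈ = ∈-dependentPairs⁻ (quads n) {λ _ → residuePairs} x∈
        s′∈ , s∈ = ∈-dependentPairs⁻ residues {λ _ → residues} ss∈
    in ∈-quads⁻ n quad∈ , ∈-residues⁻ s′∈ , ∈-residues⁻ s∈

  unique-indices : ∀ n → Unique (indices n)
  unique-indices n = unique-dependentPairs (unique-quads n)
    (λ _ → unique-dependentPairs unique-residues (λ _ → unique-residues))

  -- Raising a makes the first frame coordinate of the edge positive, and raising k pays for the
  -- remainder of b on the left. On the right, two increments and two remainders cost at most 4 D;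
  -- at the top, one increment and three remainders cost as much. This is the origin of the 4.
  inside-shift : ∀ m a b k i s′ s → k ℕ.+ (a ℕ.+ b) ℕ.≤ m → i ℕ.+ (a ℕ.+ b) ℕ.≤ m → Residue s′ → Residue s →
    let v = combine (+ suc a , + b) +ᵛ s in
    FirstQuadrant (frame v) × Inside ((4 ℕ.+ m) ℕ.* D) (frame (combine (+ (suc k ℕ.+ b) , + i) +ᵛ s′) , frame v)
  inside-shift m a b k i s′ s k+a+b≤m i+a+b≤m res′ res =
    let y₁ , y₂ , y₁<D , y₂<D , fs′≡ = residue-coordinates {s′} res′
        x₁ , x₂ , x₁<D , x₂<D , fs≡ = residue-coordinates {s} res
        fq , ins = bounds (ℕ.<⇒≤ y₁<D) (ℕ.<⇒≤ y₂<D) (ℕ.<⇒≤ x₁<D) (ℕ.<⇒≤ x₂<D)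
        fv≡ = frame-combine-+ℕ (suc a) b s fs≡
        fw≡ = frame-combine-+ℕ (suc k ℕ.+ b) i s′ fs′≡
    in subst FirstQuadrant (sym fv≡) fq , subst (Inside ((4 ℕ.+ m) ℕ.* D)) (sym (cong₂ _,_ fw≡ fv≡)) ins
    where
    open ℕ.≤-Reasoning
    bounds : ∀ {y₁ y₂ x₁ x₂} → y₁ ℕ.≤ D → y₂ ℕ.≤ D → x₁ ℕ.≤ D → x₂ ℕ.≤ D →
      FirstQuadrant (+ (D ℕ.* suc a ℕ.+ x₁) , + (D ℕ.* b ℕ.+ x₂)) ×
      Inside ((4 ℕ.+ m) ℕ.* D) ((+ (D ℕ.* (suc k ℕ.+ b) ℕ.+ y₁) , + (D ℕ.* i ℕ.+ y₂)) ,
        (+ (D ℕ.* suc a ℕ.+ x₁) , + (D ℕ.* b ℕ.+ x₂)))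
    bounds {y₁} {y₂} {x₁} {x₂} y₁≤D y₂≤D x₁≤D x₂≤D =
      (ℤ.+<+ (s≤s z≤n) , ℤ.+≤+ z≤n) ,
      inside-firstQuadrant _ _ _ _ _ (ℤ.+≤+ z≤n) (ℤ.+≤+ z≤n) (ℤ.i≤j⇒0≤j-i (ℤ.+≤+ left)) (ℤ.+≤+ right) (ℤ.+≤+ z≤n) (ℤ.+≤+ top)
      where
      left : D ℕ.* b ℕ.+ x₂ ℕ.≤ D ℕ.* (suc k ℕ.+ b) ℕ.+ y₁
      left = begin
        D ℕ.* b ℕ.+ x₂                     ≤⟨ ℕ.+-monoʳ-≤ (D ℕ.* b) x₂≤D ⟩
        D ℕ.* b ℕ.+ D                      ≤⟨ ℕ.m≤m+n _ (D ℕ.* k ℕ.+ y₁) ⟩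
        D ℕ.* b ℕ.+ D ℕ.+ (D ℕ.* k ℕ.+ y₁) ≡⟨ ring D b k y₁ ⟩
        D ℕ.* (suc k ℕ.+ b) ℕ.+ y₁         ∎
        where
        ring : ∀ D b k y → D ℕ.* b ℕ.+ D ℕ.+ (D ℕ.* k ℕ.+ y) ≡ D ℕ.* (suc k ℕ.+ b) ℕ.+ y
        ring = ℕR.solve-∀
      right : D ℕ.* (suc k ℕ.+ b) ℕ.+ y₁ ℕ.+ (D ℕ.* suc a ℕ.+ x₁) ℕ.≤ (4 ℕ.+ m) ℕ.* D
      right = begin
        D ℕ.* (suc k ℕ.+ b) ℕ.+ y₁ ℕ.+ (D ℕ.* suc a ℕ.+ x₁)  ≤⟨ ℕ.+-mono-≤ (ℕ.+-monoʳ-≤ (D ℕ.* (suc k ℕ.+ b)) y₁≤D) (ℕ.+-monoʳ-≤ (D ℕ.* suc a) x₁≤D) ⟩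
        D ℕ.* (suc k ℕ.+ b) ℕ.+ D ℕ.+ (D ℕ.* suc a ℕ.+ D)    ≡⟨ ring D a b k ⟩
        (4 ℕ.+ (k ℕ.+ (a ℕ.+ b))) ℕ.* D                      ≤⟨ ℕ.*-monoˡ-≤ D (ℕ.+-monoʳ-≤ 4 k+a+b≤m) ⟩
        (4 ℕ.+ m) ℕ.* D                                      ∎
        where
        ring : ∀ D a b k → D ℕ.* (suc k ℕ.+ b) ℕ.+ D ℕ.+ (D ℕ.* suc a ℕ.+ D) ≡ (4 ℕ.+ (k ℕ.+ (a ℕ.+ b))) ℕ.* D
        ring = ℕR.solve-∀
      top : D ℕ.* i ℕ.+ y₂ ℕ.+ (D ℕ.* suc a ℕ.+ x₁) ℕ.+ (D ℕ.* b ℕ.+ x₂) ℕ.≤ (4 ℕ.+ m) ℕ.* D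
      top = begin
        D ℕ.* i ℕ.+ y₂ ℕ.+ (D ℕ.* suc a ℕ.+ x₁) ℕ.+ (D ℕ.* b ℕ.+ x₂)
          ≤⟨ ℕ.+-mono-≤ (ℕ.+-mono-≤ (ℕ.+-monoʳ-≤ (D ℕ.* i) y₂≤D) (ℕ.+-monoʳ-≤ (D ℕ.* suc a) x₁≤D)) (ℕ.+-monoʳ-≤ (D ℕ.* b) x₂≤D) ⟩
        D ℕ.* i ℕ.+ D ℕ.+ (D ℕ.* suc a ℕ.+ D) ℕ.+ (D ℕ.* b ℕ.+ D)
          ≡⟨ ring D a b i ⟩
        (4 ℕ.+ (i ℕ.+ (a ℕ.+ b))) ℕ.* D                      ≤⟨ ℕ.*-monoˡ-≤ D (ℕ.+-monoʳ-≤ 4 i+a+b≤m) ⟩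
        (4 ℕ.+ m) ℕ.* D                                      ∎
        where
        ring : ∀ D a b i → D ℕ.* i ℕ.+ D ℕ.+ (D ℕ.* suc a ℕ.+ D) ℕ.+ (D ℕ.* b ℕ.+ D) ≡ (4 ℕ.+ (i ℕ.+ (a ℕ.+ b))) ℕ.* D
        ring = ℕR.solve-∀

  shifted-index-inside : ∀ m {x} → x ∈ indices m →
    FirstQuadrant (frame (proj₂ (decode (shift x)))) × Inside ((4 ℕ.+ m) ℕ.* D) (frameRep (decode (shift x)))
  shifted-index-inside m {((a , _) , (b , _) , (k , i)) , (s′ , s)} x∈ =
    let (_ , _ , k≤ , i≤) , res′ , res = indices⁻ m x∈
    in inside-shift m a b k i s′ s k≤ i≤ res′ res

  decode-shift-injective : ∀ m {x y} → x ∈ indices m → y ∈ indices m → decode (shift x) ≡ decode (shift y) → x ≡ y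
  decode-shift-injective m {((a , _) , (b , _) , (k , i)) , (s′ , s)} {((a₁ , _) , (b₁ , _) , (k₁ , i₁)) , (s₁′ , s₁)} x∈ y∈ eq =
    let (r≡ , e≡ , _) , res′ , res = indices⁻ m x∈
        (r₁≡ , e₁≡ , _) , res₁′ , res₁ = indices⁻ m y∈
        k+b≡ , s′≡ = combine-+-unique _ _ s′ s₁′ res′ res₁′ (cong proj₁ eq)
        a≡ , s≡ = combine-+-unique _ _ s s₁ res res₁ (cong proj₂ eq)
    in rebuild r≡ e≡ r₁≡ e₁≡ (cong proj₁ k+b≡) (cong proj₂ k+b≡) (cong proj₁ a≡) (cong proj₂ a≡) s′≡ s≡
    where
    rebuild : ∀ {a b k i a₁ b₁ k₁ i₁ r e r₁ e₁ : ℕ} {s s′ s₁ s₁′ : Vec} →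
      r ≡ m ℕ.∸ a → e ≡ r ℕ.∸ b → r₁ ≡ m ℕ.∸ a₁ → e₁ ≡ r₁ ℕ.∸ b₁ →
      + (suc k ℕ.+ b) ≡ + (suc k₁ ℕ.+ b₁) → + i ≡ + i₁ → + suc a ≡ + suc a₁ → + b ≡ + b₁ → s′ ≡ s₁′ → s ≡ s₁ →
      (((a , r) , (b , e) , (k , i)) , (s′ , s)) ≡ (((a₁ , r₁) , (b₁ , e₁) , (k₁ , i₁)) , (s₁′ , s₁))
    rebuild {a} {b} {k} {i} {k₁ = k₁} refl refl refl refl k+b≡ refl refl refl refl refl =
      cong (λ k → (((a , m ℕ.∸ a) , (b , m ℕ.∸ a ℕ.∸ b) , (k , i)) , _))
        (ℕ.suc-injective (ℕ.+-cancelʳ-≡ b (suc k) (suc k₁) (ℤ.+-injective k+b≡)))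

  -- The frame coordinates lie between D a and D (a + 1), and between D b and D (b + 1). Their
  -- squares carry a factor D², one D of which cancels against `norm²-frame`.
  norm²-digits : ∀ a b s → Residue s →
    D ℕ.* (a ℕ.* a ℕ.+ b ℕ.* b) ℕ.≤ norm² (combine (+ a , + b) +ᵛ s) ×
    norm² (combine (+ a , + b) +ᵛ s) ℕ.≤ D ℕ.* (suc a ℕ.* suc a ℕ.+ suc b ℕ.* suc b)
  norm²-digits a b s res =
    let x , y , x<D , y<D , fs≡ = residue-coordinates {s} res
        eq = trans (norm²-frame v) (cong norm² (frame-combine-+ℕ a b s fs≡))
    in ℕ.*-cancelˡ-≤ D (subst₂ ℕ._≤_ (ring D a b) (sym eq) (ℕ.+-mono-≤ (square-mono (ℕ.m≤m+n (D ℕ.* a) x)) (square-mono (ℕ.m≤m+n (D ℕ.* b) y)))) ,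
       ℕ.*-cancelˡ-≤ D (subst₂ ℕ._≤_ (sym eq) (ring D (suc a) (suc b)) (ℕ.+-mono-≤ (square-mono (next a x<D)) (square-mono (next b y<D))))
    where
    v = combine (+ a , + b) +ᵛ s
    ring : ∀ D a b → D ℕ.* a ℕ.* (D ℕ.* a) ℕ.+ D ℕ.* b ℕ.* (D ℕ.* b) ≡ D ℕ.* (D ℕ.* (a ℕ.* a ℕ.+ b ℕ.* b))
    ring = ℕR.solve-∀
    next : ∀ a {x} → x ℕ.< D → D ℕ.* a ℕ.+ x ℕ.≤ D ℕ.* suc a
    next a {x} x<D = subst (D ℕ.* a ℕ.+ x ℕ.≤_) (trans (ℕ.+-comm (D ℕ.* a) D) (sym (ℕ.*-suc D a))) (ℕ.+-monoʳ-≤ (D ℕ.* a) (ℕ.<⇒≤ x<D))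

  norm²-upper : ∀ n {x} → x ∈ indices n → norm² (proj₂ (decode x)) ℕ.≤ D ℕ.* (weight x ℕ.+ (2 ℕ.* n ℕ.+ 2))
  norm²-upper n {((a , _) , (b , _) , (k , i)) , (s′ , s)} x∈ =
    let (_ , _ , k≤ , _) , _ , res = indices⁻ n x∈
    in ℕ.≤-trans (proj₂ (norm²-digits a b s res)) (ℕ.*-monoʳ-≤ D (begin
      suc a ℕ.* suc a ℕ.+ suc b ℕ.* suc b                ≡⟨ ring a b ⟩
      a ℕ.* a ℕ.+ b ℕ.* b ℕ.+ (2 ℕ.* (a ℕ.+ b) ℕ.+ 2)
        ≤⟨ ℕ.+-monoʳ-≤ (a ℕ.* a ℕ.+ b ℕ.* b) (ℕ.+-monoˡ-≤ 2 (ℕ.*-monoʳ-≤ 2 (ℕ.m+n≤o⇒n≤o k k≤))) ⟩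
      a ℕ.* a ℕ.+ b ℕ.* b ℕ.+ (2 ℕ.* n ℕ.+ 2)            ∎))
    where
    open ℕ.≤-Reasoning
    ring : ∀ a b → suc a ℕ.* suc a ℕ.+ suc b ℕ.* suc b ≡ a ℕ.* a ℕ.+ b ℕ.* b ℕ.+ (2 ℕ.* (a ℕ.+ b) ℕ.+ 2)
    ring = ℕR.solve-∀

  norm²-lower : ∀ m {x} → x ∈ indices m → D ℕ.* weight x ℕ.≤ norm² (proj₂ (decode (shift x)))
  norm²-lower m {((a , _) , (b , _) , (k , i)) , (s′ , s)} x∈ =
    ℕ.≤-trans (ℕ.*-monoʳ-≤ D (ℕ.+-monoˡ-≤ (b ℕ.* b) (square-mono (ℕ.n≤1+n a))))
      (proj₁ (norm²-digits (suc a) b s (proj₂ (proj₂ (indices⁻ m x∈)))))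

  sumBy-indices : ∀ n (f : Quad → ℕ) → sumBy (f ∘ proj₁) (indices n) ≡ length residuePairs ℕ.* sumBy f (quads n)
  sumBy-indices n f = trans (sumBy-dependentPairs (f ∘ proj₁) (quads n) (λ _ → residuePairs))
    (trans (sumBy-cong (λ x → sumBy-const (f x) residuePairs) (quads n)) (sumBy-* (length residuePairs) f (quads n)))

  module _ {n : ℕ} {L : List Rep} (unique : Unique L)
    (L⊆ : ∀ {r} → r ∈ L → IsMini n r) (⊆L : ∀ {r} → IsMini n r → r ∈ L) where

    -- Two miniatures with a common index are turns of one another, hence equal, as both edges lie
    -- in the first quadrant of the original axes.
    sum-upper : (f : Rep → ℕ) (g : Quad → ℕ) →
      (∀ {r x} → x ∈ indices n → r ~ decode x → f r ℕ.≤ g (proj₁ x)) →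
      sumBy f L ℕ.≤ length residuePairs ℕ.* sumBy g (quads n)
    sum-upper f g f≤g = subst (sumBy f L ℕ.≤_) (sumBy-indices n g)
      (sumBy-≤-correspondence (λ r x → r ∈ L × x ∈ indices n × r ~ decode x) f (g ∘ proj₁)
        (λ (_ , x∈ , r~) → f≤g x∈ r~)
        (λ (r∈ , _ , r~) (r′∈ , _ , r′~) →
          firstQuadrant-unique (~-trans r~ (~-sym r′~)) (proj₁ (L⊆ r∈)) (proj₁ (L⊆ r′∈)))
        L (indices n) unique
        (λ {r} r∈ → let x , x∈ , r~ = index-of-mini n r (L⊆ r∈) in x , x∈ , r∈ , x∈ , r~))

    -- Here injectivity comes from the frame: shifted indices decode to listings whose framed edges
    -- lie in the first quadrant, so two of them that list the same square coincide.
    sum-lower : ∀ {m} → n ≡ 4 ℕ.+ m → (f : Quad → ℕ) (g : Rep → ℕ) →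
      (∀ {x r} → x ∈ indices m → decode (shift x) ~ r → f (proj₁ x) ℕ.≤ g r) →
      length residuePairs ℕ.* sumBy f (quads m) ℕ.≤ sumBy g L
    sum-lower {m} refl f g f≤g = subst (ℕ._≤ sumBy g L) (sumBy-indices m f)
      (sumBy-≤-correspondence (λ x r → x ∈ indices m × decode (shift x) ~ r) (f ∘ proj₁) g
        (λ (x∈ , ~r) → f≤g x∈ ~r)
        (λ {x} {x′} (x∈ , x~) (x′∈ , x′~) → decode-shift-injective m x∈ x′∈
          (same (decode (shift x)) (decode (shift x′)) (proj₁ (shifted-index-inside m x∈))
            (proj₁ (shifted-index-inside m x′∈)) (~-trans x~ (~-sym x′~))))
        (indices m) L (unique-indices m)
        (λ {x} x∈ → let fq , ins = shifted-index-inside m x∈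
                        y = decode (shift x)
                        ~c , fqc = canonical-firstQuadrant y (nonzero (proj₂ y) fq)
                    in canonical y , ⊆L (fqc , inside-~ ((4 ℕ.+ m) ℕ.* D) (frameRep-~ ~c) ins) , x∈ , ~c))
      where
      nonzero : ∀ v → FirstQuadrant (frame v) → v ≢ (0ℤ , 0ℤ)
      nonzero v fq v≡0 = firstQuadrant≢0 fq (cong frame v≡0)
      same : ∀ r s → FirstQuadrant (frame (proj₂ r)) → FirstQuadrant (frame (proj₂ s)) → r ~ s → r ≡ s
      same r s fq fq′ r~s = cong₂ _,_
        (frame-injective (cong proj₁ eq)) (frame-injective (cong proj₂ eq))
        where
        eq : frameRep r ≡ frameRep s
        eq = firstQuadrant-unique (frameRep-~ r~s) fq fq′

    totalArea : ℕ
    totalArea = sumBy (norm² ∘ proj₂) L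

    module _ {m : ℕ} (n≡4+m : n ≡ 4 ℕ.+ m) where

      ρ : ℕ
      ρ = length residuePairs

      1≤ρ : 1 ℕ.≤ ρ
      1≤ρ = length-positive (∈-dependentPairs⁺ {ys = λ _ → residues} 0∈residues 0∈residues)

      count-upper : length L ℕ.≤ ρ ℕ.* length (quads n)
      count-upper = subst₂ (λ x y → x ℕ.≤ ρ ℕ.* y) (sym (length≡sumBy L)) (sym (length≡sumBy (quads n)))
        (sum-upper (λ _ → 1) (λ _ → 1) (λ _ _ → ℕ.≤-refl))

      count-lower : ρ ℕ.* length (quads m) ℕ.≤ length L
      count-lower = subst₂ (λ x y → ρ ℕ.* x ℕ.≤ y) (sym (length≡sumBy (quads m))) (sym (length≡sumBy L))
        (sum-lower n≡4+m (λ _ → 1) (λ _ → 1) (λ _ _ → ℕ.≤-refl))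

      area-upper : totalArea ℕ.≤ ρ ℕ.* (D ℕ.* (sumBy quadWeight (quads n) ℕ.+ length (quads n) ℕ.* (2 ℕ.* n ℕ.+ 2)))
      area-upper = subst (λ x → totalArea ℕ.≤ ρ ℕ.* x)
        (trans (sumBy-* D _ (quads n)) (cong (D ℕ.*_)
          (trans (sumBy-+ quadWeight _ (quads n)) (cong (sumBy quadWeight (quads n) ℕ.+_) (sumBy-const _ (quads n))))))
        (sum-upper (norm² ∘ proj₂) (λ x → D ℕ.* (quadWeight x ℕ.+ (2 ℕ.* n ℕ.+ 2)))
          (λ {r} {x} x∈ r~ → subst (ℕ._≤ D ℕ.* (weight x ℕ.+ (2 ℕ.* n ℕ.+ 2))) (sym (norm²-~ r~)) (norm²-upper n x∈)))

      area-lower : ρ ℕ.* (D ℕ.* sumBy quadWeight (quads m)) ℕ.≤ totalArea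
      area-lower = subst (λ x → ρ ℕ.* x ℕ.≤ totalArea) (sumBy-* D quadWeight (quads m))
        (sum-lower n≡4+m (λ x → D ℕ.* quadWeight x) (norm² ∘ proj₂)
          (λ {x} {r} x∈ x~ → subst (D ℕ.* weight x ℕ.≤_) (norm²-~ x~) (norm²-lower m x∈)))

      -- This excludes the empty list, on which `avgArea` has its default value 0.
      length-pos : 1 ℕ.≤ length L
      length-pos = ℕ.≤-trans (ℕ.*-mono-≤ 1≤ρ (length-quads-positive m)) count-lower

      totalArea-upper : 15 ℕ.* totalArea ℕ.≤ D ℕ.* (2 ℕ.* (n ℕ.* n) ℕ.+ K ℕ.* n) ℕ.* length L
      totalArea-upper = combine-bounds (2 ℕ.* (n ℕ.* n) ℕ.+ K ℕ.* n)
        (subst (λ n → 15 ℕ.* (sumBy quadWeight (quads n) ℕ.+ length (quads n) ℕ.* (2 ℕ.* n ℕ.+ 2)) ℕ.≤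
          (2 ℕ.* (n ℕ.* n) ℕ.+ K ℕ.* n) ℕ.* length (quads m)) (sym n≡4+m) (upper-quads-bound m))
        area-upper count-lower
        where
        combine-bounds : ∀ b {w l′ A C} → 15 ℕ.* w ℕ.≤ b ℕ.* l′ → A ℕ.≤ ρ ℕ.* (D ℕ.* w) → ρ ℕ.* l′ ℕ.≤ C →
          15 ℕ.* A ℕ.≤ D ℕ.* b ℕ.* C
        combine-bounds b {w} {l′} {A} {C} w≤ A≤ ≤C = begin
          15 ℕ.* A                    ≤⟨ ℕ.*-monoʳ-≤ 15 A≤ ⟩
          15 ℕ.* (ρ ℕ.* (D ℕ.* w))    ≡⟨ ring₁ ρ D w ⟩
          ρ ℕ.* D ℕ.* (15 ℕ.* w)      ≤⟨ ℕ.*-monoʳ-≤ (ρ ℕ.* D) w≤ ⟩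
          ρ ℕ.* D ℕ.* (b ℕ.* l′)      ≡⟨ ring₂ ρ D b l′ ⟩
          D ℕ.* b ℕ.* (ρ ℕ.* l′)      ≤⟨ ℕ.*-monoʳ-≤ (D ℕ.* b) ≤C ⟩
          D ℕ.* b ℕ.* C               ∎
          where
          open ℕ.≤-Reasoning
          ring₁ : ∀ ρ D w → 15 ℕ.* (ρ ℕ.* (D ℕ.* w)) ≡ ρ ℕ.* D ℕ.* (15 ℕ.* w)
          ring₁ = ℕR.solve-∀
          ring₂ : ∀ ρ D b l → ρ ℕ.* D ℕ.* (b ℕ.* l) ≡ D ℕ.* b ℕ.* (ρ ℕ.* l)
          ring₂ = ℕR.solve-∀

      -- The error term stands on the right to avoid subtraction. The main term is bounded by
      -- `count-upper`, the error term by `count-lower`.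
      totalArea-lower : D ℕ.* (2 ℕ.* (n ℕ.* n)) ℕ.* length L ℕ.≤ 15 ℕ.* totalArea ℕ.+ D ℕ.* (K ℕ.* n) ℕ.* length L
      totalArea-lower = combine-bounds (2 ℕ.* (n ℕ.* n)) (K ℕ.* n) (subst (λ n → 2 ℕ.* (n ℕ.* n) ℕ.* length (quads n) ℕ.≤
          15 ℕ.* sumBy quadWeight (quads m) ℕ.+ K ℕ.* n ℕ.* length (quads m)) (sym n≡4+m) (lower-quads-bound m))
        count-upper area-lower count-lower
        where
        combine-bounds : ∀ b c {l w l′ A C} → b ℕ.* l ℕ.≤ 15 ℕ.* w ℕ.+ c ℕ.* l′ → C ℕ.≤ ρ ℕ.* l →
          ρ ℕ.* (D ℕ.* w) ℕ.≤ A → ρ ℕ.* l′ ℕ.≤ C → D ℕ.* b ℕ.* C ℕ.≤ 15 ℕ.* A ℕ.+ D ℕ.* c ℕ.* C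
        combine-bounds b c {l} {w} {l′} {A} {C} bl≤ C≤ ≤A ≤C = begin
          D ℕ.* b ℕ.* C                                         ≤⟨ ℕ.*-monoʳ-≤ (D ℕ.* b) C≤ ⟩
          D ℕ.* b ℕ.* (ρ ℕ.* l)                                 ≡⟨ ring₁ ρ D b l ⟩
          ρ ℕ.* D ℕ.* (b ℕ.* l)                                 ≤⟨ ℕ.*-monoʳ-≤ (ρ ℕ.* D) bl≤ ⟩
          ρ ℕ.* D ℕ.* (15 ℕ.* w ℕ.+ c ℕ.* l′)                   ≡⟨ ring₂ ρ D w c l′ ⟩
          15 ℕ.* (ρ ℕ.* (D ℕ.* w)) ℕ.+ D ℕ.* c ℕ.* (ρ ℕ.* l′)   ≤⟨ ℕ.+-mono-≤ (ℕ.*-monoʳ-≤ 15 ≤A) (ℕ.*-monoʳ-≤ (D ℕ.* c) ≤C) ⟩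
          15 ℕ.* A ℕ.+ D ℕ.* c ℕ.* C                            ∎
          where
          open ℕ.≤-Reasoning
          ring₁ : ∀ ρ D b l → D ℕ.* b ℕ.* (ρ ℕ.* l) ≡ ρ ℕ.* D ℕ.* (b ℕ.* l)
          ring₁ = ℕR.solve-∀
          ring₂ : ∀ ρ D w c l → ρ ℕ.* D ℕ.* (15 ℕ.* w ℕ.+ c ℕ.* l) ≡ 15 ℕ.* (ρ ℕ.* (D ℕ.* w)) ℕ.+ D ℕ.* c ℕ.* (ρ ℕ.* l)
          ring₂ = ℕR.solve-∀

-- Containment of rational squares, tested at vertices

ℚ-ring : AlmostCommutativeRing 0ℓ 0ℓ
ℚ-ring = fromCommutativeRing ℚ.+-*-commutativeRing λ x → dec⇒maybe (0ℚ ℚ.≟ x)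

0≤p*q : ∀ {p q} → 0ℚ ℚ.≤ p → 0ℚ ℚ.≤ q → 0ℚ ℚ.≤ p ℚ.* q
0≤p*q {p} {q} 0≤p 0≤q = ℚ.nonNegative⁻¹ (p ℚ.* q)
  {{ℚ.nonNeg*nonNeg⇒nonNeg p {{ℚ.nonNegative 0≤p}} q {{ℚ.nonNegative 0≤q}}}}

0≤p+q : ∀ {p q} → 0ℚ ℚ.≤ p → 0ℚ ℚ.≤ q → 0ℚ ℚ.≤ p ℚ.+ q
0≤p+q = ℚ.+-mono-≤

p≤q⇒0≤q-p : ∀ {p q} → p ℚ.≤ q → 0ℚ ℚ.≤ q ℚ.- p
p≤q⇒0≤q-p {p} {q} p≤q = subst (ℚ._≤ q ℚ.- p) (ℚ.+-inverseʳ p) (ℚ.+-monoˡ-≤ (ℚ.- p) p≤q)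

0≤q-p⇒p≤q : ∀ {p q} → 0ℚ ℚ.≤ q ℚ.- p → p ℚ.≤ q
0≤q-p⇒p≤q {p} {q} 0≤q-p = subst₂ ℚ._≤_ (ℚ.+-identityˡ p) (ring p q) (ℚ.+-monoˡ-≤ p 0≤q-p)
  where
  ring : ∀ p q → q ℚ.- p ℚ.+ p ≡ q
  ring = solve-∀ ℚ-ring

0≤r*p⇒0≤p : ∀ {r p} → 0ℚ ℚ.< r → 0ℚ ℚ.≤ r ℚ.* p → 0ℚ ℚ.≤ p
0≤r*p⇒0≤p {r} {p} 0<r 0≤rp =
  ℚ.*-cancelˡ-≤-pos r {{ℚ.positive 0<r}} (subst (ℚ._≤ r ℚ.* p) (sym (ℚ.*-zeroʳ r)) 0≤rp)

affine : ℚ → Point → Point → ℚ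
affine k g z = k ℚ.+ z · g

-- With s and t the coordinates of z in the frame of the square and D its area, D² times an affine function
-- at z is the bilinear combination of its values at the vertices, with the weights (D - s)(D - t),
-- s (D - t), s t and (D - s) t.
affine-≥0-on-square : ∀ k g c a z → let D = a · a in 0ℚ ℚ.< D →
  0ℚ ℚ.≤ affine k g c → 0ℚ ℚ.≤ affine k g (c ⊕ a) →
  0ℚ ℚ.≤ affine k g ((c ⊕ a) ⊕ perp a) → 0ℚ ℚ.≤ affine k g (c ⊕ perp a) →
  z ∈□ square c a → 0ℚ ℚ.≤ affine k g z
affine-≥0-on-square k g@(g₁ , g₂) c@(c₁ , c₂) a@(a₁ , a₂) z@(z₁ , z₂) 0<D F₀ F₁ F₂ F₃ (0≤s , s≤D , 0≤t , t≤D) =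
  0≤r*p⇒0≤p 0<D (0≤r*p⇒0≤p 0<D (subst (0ℚ ℚ.≤_) (sym total)
    (0≤p+q (0≤p+q (0≤p+q
      (0≤p*q (0≤p*q 0≤D-s 0≤D-t) F₀)
      (0≤p*q (0≤p*q 0≤s 0≤D-t) (subst (0ℚ ℚ.≤_) (ring₁ k c₁ c₂ a₁ a₂ g₁ g₂) F₁)))
      (0≤p*q (0≤p*q 0≤s 0≤t) (subst (0ℚ ℚ.≤_) (ring₂ k c₁ c₂ a₁ a₂ g₁ g₂) F₂)))
      (0≤p*q (0≤p*q 0≤D-s 0≤t) (subst (0ℚ ℚ.≤_) (ring₁ k c₁ c₂ (ℚ.- a₂) a₁ g₁ g₂) F₃)))))
  where
  D s t F A B : ℚ
  D = a · a
  s = (z ⊖ c) · a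
  t = (z ⊖ c) · perp a
  F = affine k g c
  A = a · g
  B = perp a · g
  0≤D-s = p≤q⇒0≤q-p s≤D
  0≤D-t = p≤q⇒0≤q-p t≤D
  ring₁ : ∀ k c₁ c₂ a₁ a₂ g₁ g₂ → k ℚ.+ ((c₁ ℚ.+ a₁) ℚ.* g₁ ℚ.+ (c₂ ℚ.+ a₂) ℚ.* g₂) ≡
    k ℚ.+ (c₁ ℚ.* g₁ ℚ.+ c₂ ℚ.* g₂) ℚ.+ (a₁ ℚ.* g₁ ℚ.+ a₂ ℚ.* g₂)
  ring₁ = solve-∀ ℚ-ring
  ring₂ : ∀ k c₁ c₂ a₁ a₂ g₁ g₂ → k ℚ.+ ((c₁ ℚ.+ a₁ ℚ.+ ℚ.- a₂) ℚ.* g₁ ℚ.+ (c₂ ℚ.+ a₂ ℚ.+ a₁) ℚ.* g₂) ≡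
    k ℚ.+ (c₁ ℚ.* g₁ ℚ.+ c₂ ℚ.* g₂) ℚ.+ (a₁ ℚ.* g₁ ℚ.+ a₂ ℚ.* g₂) ℚ.+ (ℚ.- a₂ ℚ.* g₁ ℚ.+ a₁ ℚ.* g₂)
  ring₂ = solve-∀ ℚ-ring
  coordinates : ∀ k c₁ c₂ a₁ a₂ g₁ g₂ z₁ z₂ →
    (a₁ ℚ.* a₁ ℚ.+ a₂ ℚ.* a₂) ℚ.* (k ℚ.+ (z₁ ℚ.* g₁ ℚ.+ z₂ ℚ.* g₂)) ≡
    (a₁ ℚ.* a₁ ℚ.+ a₂ ℚ.* a₂) ℚ.* (k ℚ.+ (c₁ ℚ.* g₁ ℚ.+ c₂ ℚ.* g₂)) ℚ.+
    ((z₁ ℚ.- c₁) ℚ.* a₁ ℚ.+ (z₂ ℚ.- c₂) ℚ.* a₂) ℚ.* (a₁ ℚ.* g₁ ℚ.+ a₂ ℚ.* g₂) ℚ.+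
    ((z₁ ℚ.- c₁) ℚ.* (ℚ.- a₂) ℚ.+ (z₂ ℚ.- c₂) ℚ.* a₁) ℚ.* (ℚ.- a₂ ℚ.* g₁ ℚ.+ a₁ ℚ.* g₂)
  coordinates = solve-∀ ℚ-ring
  bilinear : ∀ D s t F A B → D ℚ.* (D ℚ.* F ℚ.+ s ℚ.* A ℚ.+ t ℚ.* B) ≡
    (D ℚ.- s) ℚ.* (D ℚ.- t) ℚ.* F ℚ.+ s ℚ.* (D ℚ.- t) ℚ.* (F ℚ.+ A) ℚ.+ s ℚ.* t ℚ.* (F ℚ.+ A ℚ.+ B) ℚ.+
    (D ℚ.- s) ℚ.* t ℚ.* (F ℚ.+ B)
  bilinear = solve-∀ ℚ-ring
  total : D ℚ.* (D ℚ.* affine k g z) ≡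
    (D ℚ.- s) ℚ.* (D ℚ.- t) ℚ.* F ℚ.+ s ℚ.* (D ℚ.- t) ℚ.* (F ℚ.+ A) ℚ.+ s ℚ.* t ℚ.* (F ℚ.+ A ℚ.+ B) ℚ.+
    (D ℚ.- s) ℚ.* t ℚ.* (F ℚ.+ B)
  total = trans (cong (D ℚ.*_) (coordinates k c₁ c₂ a₁ a₂ g₁ g₂ z₁ z₂)) (bilinear D s t F A B)

-- Each of the four inequalities that define P says that an affine function is nonnegative, and this
-- passes from the vertices of M to all of M.
⊆□-from-vertices : ∀ M P → 0ℚ ℚ.< area M → All (_∈□ P) (vertices M) → M ⊆□ P
⊆□-from-vertices (square m a) (square c@(c₁ , c₂) e@(e₁ , e₂)) 0<D (v₀ ∷ v₁ ∷ v₂ ∷ v₃ ∷ []) z z∈M =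
  from (lower e) (λ x v → to (lower e) x (proj₁ v)) ,
  0≤q-p⇒p≤q (from (upper e) (λ x v → to (upper e) x (p≤q⇒0≤q-p (proj₁ (proj₂ v))))) ,
  from (lower (perp e)) (λ x v → to (lower (perp e)) x (proj₁ (proj₂ (proj₂ v)))) ,
  0≤q-p⇒p≤q (from (upper (perp e)) (λ x v → to (upper (perp e)) x (p≤q⇒0≤q-p (proj₂ (proj₂ (proj₂ v))))))
  where
  E : ℚ
  E = e · e
  IsAffine : (Point → ℚ) → Set
  IsAffine f = ∃₂ λ k g → ∀ z → f z ≡ affine k g z
  lower : ∀ h → IsAffine (λ z → (z ⊖ c) · h)
  lower (h₁ , h₂) = ℚ.- (c · (h₁ , h₂)) , (h₁ , h₂) , λ (z₁ , z₂) → ring c₁ c₂ h₁ h₂ z₁ z₂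
    where
    ring : ∀ c₁ c₂ h₁ h₂ z₁ z₂ → (z₁ ℚ.- c₁) ℚ.* h₁ ℚ.+ (z₂ ℚ.- c₂) ℚ.* h₂ ≡
      ℚ.- (c₁ ℚ.* h₁ ℚ.+ c₂ ℚ.* h₂) ℚ.+ (z₁ ℚ.* h₁ ℚ.+ z₂ ℚ.* h₂)
    ring = solve-∀ ℚ-ring
  upper : ∀ h → IsAffine (λ z → E ℚ.- (z ⊖ c) · h)
  upper (h₁ , h₂) = E ℚ.+ c · (h₁ , h₂) , (ℚ.- h₁ , ℚ.- h₂) , λ (z₁ , z₂) → ring E c₁ c₂ h₁ h₂ z₁ z₂
    where
    ring : ∀ E c₁ c₂ h₁ h₂ z₁ z₂ → E ℚ.- ((z₁ ℚ.- c₁) ℚ.* h₁ ℚ.+ (z₂ ℚ.- c₂) ℚ.* h₂) ≡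
      E ℚ.+ (c₁ ℚ.* h₁ ℚ.+ c₂ ℚ.* h₂) ℚ.+ (z₁ ℚ.* (ℚ.- h₁) ℚ.+ z₂ ℚ.* (ℚ.- h₂))
    ring = solve-∀ ℚ-ring
  to : ∀ {f} ((k , g , _) : IsAffine f) z → 0ℚ ℚ.≤ f z → 0ℚ ℚ.≤ affine k g z
  to (_ , _ , f≡) z = subst (0ℚ ℚ.≤_) (f≡ z)
  from : ∀ {f} ((k , g , f≡) : IsAffine f) → (∀ v → v ∈□ square c e → 0ℚ ℚ.≤ affine k g v) → 0ℚ ℚ.≤ f z
  from (k , g , f≡) pos = subst (0ℚ ℚ.≤_) (sym (f≡ z))
    (affine-≥0-on-square k g m a z 0<D (pos m v₀) (pos (m ⊕ a) v₁) (pos ((m ⊕ a) ⊕ perp a) v₂) (pos (m ⊕ perp a) v₃) z∈M)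

area-positive : ∀ M → Canonical M → 0ℚ ℚ.< area M
area-positive (square _ (a , b)) (0<a , 0≤b) = ℚ.+-mono-<-≤ (subst (ℚ._< a ℚ.* a) (ℚ.*-zeroʳ a)
  (ℚ.*-monoʳ-<-pos a {{ℚ.positive 0<a}} 0<a)) (0≤p*q 0≤b 0≤b)

-- At the vertices both frame coordinates are 0 or the area. The lemma lets M ⊆ P be evaluated at
-- the vertices of M.
vertex∈□ : ∀ M → Canonical M → All (_∈□ M) (vertices M)
vertex∈□ M@(square (c₁ , c₂) (a , b)) can =
  at (c₁ , c₂) 0ℚ 0ℚ (ring₀ c₁ c₂ a b) ℚ.≤-refl 0≤1 ℚ.≤-refl 0≤1 ∷
  at ((c₁ , c₂) ⊕ (a , b)) 1ℚ 0ℚ (ring₁ c₁ c₂ a b) 0≤1 ℚ.≤-refl ℚ.≤-refl 0≤1 ∷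
  at (((c₁ , c₂) ⊕ (a , b)) ⊕ perp (a , b)) 1ℚ 1ℚ (ring₂ c₁ c₂ a b) 0≤1 ℚ.≤-refl 0≤1 ℚ.≤-refl ∷
  at ((c₁ , c₂) ⊕ perp (a , b)) 0ℚ 1ℚ (ring₃ c₁ c₂ a b) ℚ.≤-refl 0≤1 0≤1 ℚ.≤-refl ∷ []
  where
  A : ℚ
  A = area M
  0≤A : 0ℚ ℚ.≤ A
  0≤A = ℚ.<⇒≤ (area-positive M can)
  0≤1 : 0ℚ ℚ.≤ 1ℚ
  0≤1 = ℚ.nonNegative⁻¹ 1ℚ
  0≤λA : ∀ {l} → 0ℚ ℚ.≤ l → 0ℚ ℚ.≤ l ℚ.* A
  0≤λA 0≤l = 0≤p*q 0≤l 0≤A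
  λA≤A : ∀ {l} → l ℚ.≤ 1ℚ → l ℚ.* A ℚ.≤ A
  λA≤A {l} l≤1 = subst (l ℚ.* A ℚ.≤_) (ℚ.*-identityˡ A) (ℚ.*-monoʳ-≤-nonNeg A {{ℚ.nonNegative 0≤A}} l≤1)
  at : ∀ z l m → (z ⊖ (c₁ , c₂)) · (a , b) ≡ l ℚ.* A × (z ⊖ (c₁ , c₂)) · perp (a , b) ≡ m ℚ.* A →
    0ℚ ℚ.≤ l → l ℚ.≤ 1ℚ → 0ℚ ℚ.≤ m → m ℚ.≤ 1ℚ → z ∈□ M
  at z l m (s≡ , t≡) 0≤l l≤1 0≤m m≤1 =
    subst (0ℚ ℚ.≤_) (sym s≡) (0≤λA 0≤l) , subst (ℚ._≤ A) (sym s≡) (λA≤A l≤1) ,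
    subst (0ℚ ℚ.≤_) (sym t≡) (0≤λA 0≤m) , subst (ℚ._≤ A) (sym t≡) (λA≤A m≤1)
  ring₀ : ∀ c₁ c₂ a b →
    (c₁ ℚ.- c₁) ℚ.* a ℚ.+ (c₂ ℚ.- c₂) ℚ.* b ≡ 0ℚ ℚ.* (a ℚ.* a ℚ.+ b ℚ.* b) ×
    (c₁ ℚ.- c₁) ℚ.* (ℚ.- b) ℚ.+ (c₂ ℚ.- c₂) ℚ.* a ≡ 0ℚ ℚ.* (a ℚ.* a ℚ.+ b ℚ.* b)
  ring₀ c₁ c₂ a b = trans (r c₁ c₂ a b) (sym (ℚ.*-zeroˡ (a ℚ.* a ℚ.+ b ℚ.* b))) ,
    trans (r c₁ c₂ (ℚ.- b) a) (sym (ℚ.*-zeroˡ (a ℚ.* a ℚ.+ b ℚ.* b)))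
    where
    r : ∀ c₁ c₂ a b → (c₁ ℚ.- c₁) ℚ.* a ℚ.+ (c₂ ℚ.- c₂) ℚ.* b ≡ 0ℚ
    r = solve-∀ ℚ-ring
  ring₁ : ∀ c₁ c₂ a b →
    (c₁ ℚ.+ a ℚ.- c₁) ℚ.* a ℚ.+ (c₂ ℚ.+ b ℚ.- c₂) ℚ.* b ≡ 1ℚ ℚ.* (a ℚ.* a ℚ.+ b ℚ.* b) ×
    (c₁ ℚ.+ a ℚ.- c₁) ℚ.* (ℚ.- b) ℚ.+ (c₂ ℚ.+ b ℚ.- c₂) ℚ.* a ≡ 0ℚ ℚ.* (a ℚ.* a ℚ.+ b ℚ.* b)
  ring₁ c₁ c₂ a b = trans (r c₁ c₂ a b) (sym (ℚ.*-identityˡ (a ℚ.* a ℚ.+ b ℚ.* b))) ,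
    trans (r′ c₁ c₂ a b) (sym (ℚ.*-zeroˡ (a ℚ.* a ℚ.+ b ℚ.* b)))
    where
    r : ∀ c₁ c₂ a b → (c₁ ℚ.+ a ℚ.- c₁) ℚ.* a ℚ.+ (c₂ ℚ.+ b ℚ.- c₂) ℚ.* b ≡ a ℚ.* a ℚ.+ b ℚ.* b
    r = solve-∀ ℚ-ring
    r′ : ∀ c₁ c₂ a b → (c₁ ℚ.+ a ℚ.- c₁) ℚ.* (ℚ.- b) ℚ.+ (c₂ ℚ.+ b ℚ.- c₂) ℚ.* a ≡ 0ℚ
    r′ = solve-∀ ℚ-ring
  ring₂ : ∀ c₁ c₂ a b →
    (c₁ ℚ.+ a ℚ.+ ℚ.- b ℚ.- c₁) ℚ.* a ℚ.+ (c₂ ℚ.+ b ℚ.+ a ℚ.- c₂) ℚ.* b ≡ 1ℚ ℚ.* (a ℚ.* a ℚ.+ b ℚ.* b) ×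
    (c₁ ℚ.+ a ℚ.+ ℚ.- b ℚ.- c₁) ℚ.* (ℚ.- b) ℚ.+ (c₂ ℚ.+ b ℚ.+ a ℚ.- c₂) ℚ.* a ≡ 1ℚ ℚ.* (a ℚ.* a ℚ.+ b ℚ.* b)
  ring₂ c₁ c₂ a b = trans (r c₁ c₂ a b) (sym (ℚ.*-identityˡ (a ℚ.* a ℚ.+ b ℚ.* b))) ,
    trans (r′ c₁ c₂ a b) (sym (ℚ.*-identityˡ (a ℚ.* a ℚ.+ b ℚ.* b)))
    where
    r : ∀ c₁ c₂ a b → (c₁ ℚ.+ a ℚ.+ ℚ.- b ℚ.- c₁) ℚ.* a ℚ.+ (c₂ ℚ.+ b ℚ.+ a ℚ.- c₂) ℚ.* b ≡ a ℚ.* a ℚ.+ b ℚ.* b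
    r = solve-∀ ℚ-ring
    r′ : ∀ c₁ c₂ a b → (c₁ ℚ.+ a ℚ.+ ℚ.- b ℚ.- c₁) ℚ.* (ℚ.- b) ℚ.+ (c₂ ℚ.+ b ℚ.+ a ℚ.- c₂) ℚ.* a ≡ a ℚ.* a ℚ.+ b ℚ.* b
    r′ = solve-∀ ℚ-ring
  ring₃ : ∀ c₁ c₂ a b →
    (c₁ ℚ.+ ℚ.- b ℚ.- c₁) ℚ.* a ℚ.+ (c₂ ℚ.+ a ℚ.- c₂) ℚ.* b ≡ 0ℚ ℚ.* (a ℚ.* a ℚ.+ b ℚ.* b) ×
    (c₁ ℚ.+ ℚ.- b ℚ.- c₁) ℚ.* (ℚ.- b) ℚ.+ (c₂ ℚ.+ a ℚ.- c₂) ℚ.* a ≡ 1ℚ ℚ.* (a ℚ.* a ℚ.+ b ℚ.* b)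
  ring₃ c₁ c₂ a b = trans (r c₁ c₂ a b) (sym (ℚ.*-zeroˡ (a ℚ.* a ℚ.+ b ℚ.* b))) ,
    trans (r′ c₁ c₂ a b) (sym (ℚ.*-identityˡ (a ℚ.* a ℚ.+ b ℚ.* b)))
    where
    r : ∀ c₁ c₂ a b → (c₁ ℚ.+ ℚ.- b ℚ.- c₁) ℚ.* a ℚ.+ (c₂ ℚ.+ a ℚ.- c₂) ℚ.* b ≡ 0ℚ
    r = solve-∀ ℚ-ring
    r′ : ∀ c₁ c₂ a b → (c₁ ℚ.+ ℚ.- b ℚ.- c₁) ℚ.* (ℚ.- b) ℚ.+ (c₂ ℚ.+ a ℚ.- c₂) ℚ.* a ≡ a ℚ.* a ℚ.+ b ℚ.* b
    r′ = solve-∀ ℚ-ring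

-- The embedding of the integers in the rationals

abstract
  ι : ℤ → ℚ
  ι k = k / 1

  ι-def : ∀ k → k / 1 ≡ ι k
  ι-def k = refl

  ι-0 : ι 0ℤ ≡ 0ℚ
  ι-0 = refl

  ι-1 : ι 1ℤ ≡ 1ℚ
  ι-1 = refl

  toℚᵘ-ι : ∀ k → ℚ.toℚᵘ (ι k) ℚᵘ.≃ mkℚᵘ k 0
  toℚᵘ-ι k = ℚ.toℚᵘ-fromℚᵘ (mkℚᵘ k 0)

  ι-+ : ∀ i j → ι (i ℤ.+ j) ≡ ι i ℚ.+ ι j
  ι-+ i j = ℚ.toℚᵘ-injective (ℚᵘ.≃-trans (toℚᵘ-ι (i ℤ.+ j)) (ℚᵘ.≃-sym (ℚᵘ.≃-trans (ℚ.toℚᵘ-homo-+ (ι i) (ι j))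
    (ℚᵘ.≃-trans (ℚᵘ.+-cong (toℚᵘ-ι i) (toℚᵘ-ι j)) (*≡* (ring i j))))))
    where
    ring : ∀ i j → (i ℤ.* 1ℤ ℤ.+ j ℤ.* 1ℤ) ℤ.* 1ℤ ≡ (i ℤ.+ j) ℤ.* 1ℤ
    ring = ℤR.solve-∀

  ι-* : ∀ i j → ι (i ℤ.* j) ≡ ι i ℚ.* ι j
  ι-* i j = ℚ.toℚᵘ-injective (ℚᵘ.≃-trans (toℚᵘ-ι (i ℤ.* j)) (ℚᵘ.≃-sym (ℚᵘ.≃-trans (ℚ.toℚᵘ-homo-* (ι i) (ι j))
    (ℚᵘ.≃-trans (ℚᵘ.*-cong (toℚᵘ-ι i) (toℚᵘ-ι j)) (*≡* refl)))))

  ι-neg : ∀ i → ι (ℤ.- i) ≡ ℚ.- ι i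
  ι-neg i = ℚ.toℚᵘ-injective (ℚᵘ.≃-trans (toℚᵘ-ι (ℤ.- i)) (ℚᵘ.≃-sym (ℚᵘ.≃-trans (ℚ.toℚᵘ-homo‿- (ι i))
    (ℚᵘ.≃-trans (ℚᵘ.-‿cong (toℚᵘ-ι i)) (*≡* refl)))))

  ι-mono-≤ : ∀ {i j} → i ℤ.≤ j → ι i ℚ.≤ ι j
  ι-mono-≤ {i} {j} i≤j = ℚ.toℚᵘ-cancel-≤ (ℚᵘ.≤-respˡ-≃ (ℚᵘ.≃-sym (toℚᵘ-ι i)) (ℚᵘ.≤-respʳ-≃ (ℚᵘ.≃-sym (toℚᵘ-ι j))
    (*≤* (ℤ.*-monoʳ-≤-nonNeg 1ℤ i≤j))))

  ι-cancel-≤ : ∀ {i j} → ι i ℚ.≤ ι j → i ℤ.≤ j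
  ι-cancel-≤ {i} {j} ιi≤ιj with ℚᵘ.≤-respˡ-≃ (toℚᵘ-ι i) (ℚᵘ.≤-respʳ-≃ (toℚᵘ-ι j) (ℚ.toℚᵘ-mono-≤ ιi≤ιj))
  ... | *≤* i≤j = ℤ.*-cancelʳ-≤-pos i j 1ℤ i≤j

ι-injective : ∀ {i j} → ι i ≡ ι j → i ≡ j
ι-injective eq = ℤ.≤-antisym (ι-cancel-≤ (ℚ.≤-reflexive eq)) (ι-cancel-≤ (ℚ.≤-reflexive (sym eq)))

ι-mono-< : ∀ {i j} → i ℤ.< j → ι i ℚ.< ι j
ι-mono-< i<j = ℚ.≰⇒> (λ ιj≤ιi → ℤ.<⇒≱ i<j (ι-cancel-≤ ιj≤ιi))

ι-cancel-< : ∀ {i j} → ι i ℚ.< ι j → i ℤ.< j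
ι-cancel-< ιi<ιj = ℤ.≰⇒> (λ j≤i → ℚ.<-irrefl refl (ℚ.<-≤-trans ιi<ιj (ι-mono-≤ j≤i)))

ιᵛ : Vec → Point
ιᵛ (a , b) = ι a , ι b

-- Miniatures of resolution n as integer squares scaled by 1/n

module Transfer (C : Vec) (p q : ℤ) (d : ℕ) (p²+q²≡D : p ℤ.* p ℤ.+ q ℤ.* q ≡ + suc d) (n-1 : ℕ) where
  open Frame p q d p²+q²≡D
  open Miniatures p q d p²+q²≡D

  n : ℕ
  n = suc n-1

  outer : Square
  outer = square (ιᵛ C) (ι p , ι q)

  N : ℚ
  N = ι (+ n)

  abstract
    δ : ℚ
    δ = + 1 / n

    δ-def : + 1 / n ≡ δ
    δ-def = refl

    N*δ≡1 : N ℚ.* δ ≡ 1ℚ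
    N*δ≡1 = ℚ.toℚᵘ-injective (ℚᵘ.≃-trans (ℚ.toℚᵘ-homo-* N δ)
      (ℚᵘ.≃-trans (ℚᵘ.*-cong (toℚᵘ-ι (+ n)) (ℚ.toℚᵘ-fromℚᵘ (mkℚᵘ (+ 1) n-1))) (*≡* (ring (+ n)))))
      where
      ring : ∀ n → n ℤ.* 1ℤ ℤ.* 1ℤ ≡ 1ℤ ℤ.* (1ℤ ℤ.* n)
      ring = ℤR.solve-∀

  N*xδ≡x : ∀ x → N ℚ.* (x ℚ.* δ) ≡ x
  N*xδ≡x x = trans (ring N x δ) (trans (cong (x ℚ.*_) N*δ≡1) (ℚ.*-identityʳ x))
    where
    ring : ∀ N x δ → N ℚ.* (x ℚ.* δ) ≡ x ℚ.* (N ℚ.* δ)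
    ring = solve-∀ ℚ-ring

  Nx*δ≡x : ∀ x → N ℚ.* x ℚ.* δ ≡ x
  Nx*δ≡x x = trans (ℚ.*-assoc N x δ) (N*xδ≡x x)

  0<N : 0ℚ ℚ.< N
  0<N = subst (ℚ._< N) ι-0 (ι-mono-< (ℤ.+<+ (s≤s z≤n)))

  0<δ : 0ℚ ℚ.< δ
  0<δ = ℚ.*-cancelˡ-<-nonNeg N {{ℚ.nonNegative (ℚ.<⇒≤ 0<N)}}
    (subst₂ ℚ._<_ (trans ι-0 (sym (ℚ.*-zeroʳ N))) (trans ι-1 (sym N*δ≡1)) (ι-mono-< (ℤ.+<+ (s≤s z≤n))))

  grid : ℤ → ℚ
  grid k = ι k ℚ.* δ

  grid-mono-≤ : ∀ {i j} → i ℤ.≤ j → grid i ℚ.≤ grid j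
  grid-mono-≤ i≤j = ℚ.*-monoʳ-≤-nonNeg δ {{ℚ.nonNegative (ℚ.<⇒≤ 0<δ)}} (ι-mono-≤ i≤j)

  grid-cancel-≤ : ∀ {i j} → grid i ℚ.≤ grid j → i ℤ.≤ j
  grid-cancel-≤ i≤j = ι-cancel-≤ (ℚ.*-cancelʳ-≤-pos δ {{ℚ.positive 0<δ}} i≤j)

  grid-mono-< : ∀ {i j} → i ℤ.< j → grid i ℚ.< grid j
  grid-mono-< i<j = ℚ.*-monoˡ-<-pos δ {{ℚ.positive 0<δ}} (ι-mono-< i<j)

  grid-cancel-< : ∀ {i j} → grid i ℚ.< grid j → i ℤ.< j
  grid-cancel-< i<j = ι-cancel-< (ℚ.*-cancelʳ-<-nonNeg δ {{ℚ.nonNegative (ℚ.<⇒≤ 0<δ)}} i<j)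

  grid-injective : ∀ {i j} → grid i ≡ grid j → i ≡ j
  grid-injective eq = ι-injective (trans (sym (N*xδ≡x _)) (trans (cong (N ℚ.*_) eq) (N*xδ≡x _)))

  grid-0 : grid 0ℤ ≡ 0ℚ
  grid-0 = trans (cong (ℚ._* δ) ι-0) (ℚ.*-zeroˡ δ)

  grid-+ : ∀ i j → grid (i ℤ.+ j) ≡ grid i ℚ.+ grid j
  grid-+ i j = trans (cong (ℚ._* δ) (ι-+ i j)) (ℚ.*-distribʳ-+ δ (ι i) (ι j))

  grid-neg : ∀ i → grid (ℤ.- i) ≡ ℚ.- grid i
  grid-neg i = trans (cong (ℚ._* δ) (ι-neg i)) (sym (ℚ.neg-distribˡ-* (ι i) δ))

  grid-* : ∀ i j → grid (i ℤ.* j) ≡ grid i ℚ.* ι j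
  grid-* i j = trans (cong (ℚ._* δ) (ι-* i j)) (ring (ι i) (ι j) δ)
    where
    ring : ∀ x y d → x ℚ.* y ℚ.* d ≡ x ℚ.* d ℚ.* y
    ring = solve-∀ ℚ-ring

  grid-n* : ∀ i → grid (+ n ℤ.* i) ≡ ι i
  grid-n* i = trans (cong (ℚ._* δ) (ι-* (+ n) i)) (Nx*δ≡x (ι i))

  vec : Vec → Point
  vec (a , b) = grid a , grid b

  -- This is C + w/n: vectors are measured from the corner of the outer square in units of 1/n,
  -- while the numerator n C + w exhibits the point as a grid point.
  point : Vec → Point
  point (a , b) = grid (+ n ℤ.* proj₁ C ℤ.+ a) , grid (+ n ℤ.* proj₂ C ℤ.+ b)

  toSquare : Rep → Square
  toSquare (w , v) = square (point w) (vec v)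

  vec-rot : ∀ v → vec (rot v) ≡ perp (vec v)
  vec-rot (a , b) = cong (_, grid a) (grid-neg b)

  point-+ : ∀ w v → point (w +ᵛ v) ≡ point w ⊕ vec v
  point-+ (w₁ , w₂) (v₁ , v₂) = cong₂ _,_ (shift (proj₁ C) w₁ v₁) (shift (proj₂ C) w₂ v₂)
    where
    shift : ∀ c w v → grid (+ n ℤ.* c ℤ.+ (w ℤ.+ v)) ≡ grid (+ n ℤ.* c ℤ.+ w) ℚ.+ grid v
    shift c w v = trans (cong grid (sym (ℤ.+-assoc (+ n ℤ.* c) w v))) (grid-+ (+ n ℤ.* c ℤ.+ w) v)

  point-⊖ : ∀ w → point w ⊖ ιᵛ C ≡ vec w
  point-⊖ (w₁ , w₂) = cong₂ _,_ (shift (proj₁ C) w₁) (shift (proj₂ C) w₂)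
    where
    ring : ∀ c w → c ℚ.+ w ℚ.- c ≡ w
    ring = solve-∀ ℚ-ring
    shift : ∀ c w → grid (+ n ℤ.* c ℤ.+ w) ℚ.- ι c ≡ grid w
    shift c w = trans (cong (ℚ._- ι c) (trans (grid-+ (+ n ℤ.* c) w) (cong (ℚ._+ grid w) (grid-n* c)))) (ring (ι c) (grid w))

  vertices-toSquare : ∀ w v → vertices (toSquare (w , v)) ≡
    point w ∷ point (w +ᵛ v) ∷ point (w +ᵛ v +ᵛ rot v) ∷ point (w +ᵛ rot v) ∷ []
  vertices-toSquare w v = cong (point w ∷_) (cong₂ _∷_ (sym (point-+ w v)) (cong₂ _∷_
    (trans (cong₂ _⊕_ (sym (point-+ w v)) (sym (vec-rot v))) (sym (point-+ (w +ᵛ v) (rot v))))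
    (cong (_∷ []) (trans (cong (point w ⊕_) (sym (vec-rot v))) (sym (point-+ w (rot v)))))))

  point-· : ∀ w x y → (point w ⊖ ιᵛ C) · (ι x , ι y) ≡ grid (proj₁ w ℤ.* x ℤ.+ proj₂ w ℤ.* y)
  point-· w x y = trans (cong (_· (ι x , ι y)) (point-⊖ w))
    (sym (trans (grid-+ (proj₁ w ℤ.* x) (proj₂ w ℤ.* y)) (cong₂ ℚ._+_ (grid-* (proj₁ w) x) (grid-* (proj₂ w) y))))

  area-outer : area outer ≡ ι (+ D)
  area-outer = trans (cong₂ ℚ._+_ (sym (ι-* p p)) (sym (ι-* q q)))
    (trans (sym (ι-+ (p ℤ.* p) (q ℤ.* q))) (cong ι p²+q²≡D))

  -- Dot products of grid vectors with the outer edge come in units of 1/n, so the bound D in `_∈□_`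
  -- becomes the side n D of the box.
  area≡grid : area outer ≡ grid (+ (n ℕ.* D))
  area≡grid = trans area-outer (sym (trans (cong grid (ℤ.pos-* n D)) (grid-n* (+ D))))

  frame₁ : ∀ w → (point w ⊖ ιᵛ C) · (ι p , ι q) ≡ grid (proj₁ (frame w))
  frame₁ w = point-· w p q

  frame₂ : ∀ w → (point w ⊖ ιᵛ C) · perp (ι p , ι q) ≡ grid (proj₂ (frame w))
  frame₂ w = trans (cong (λ z → (point w ⊖ ιᵛ C) · (z , ι p)) (sym (ι-neg q))) (point-· w (ℤ.- q) p)

  ∈□⇒inBox : ∀ w → point w ∈□ outer → InBox (n ℕ.* D) (frame w)
  ∈□⇒inBox w (a , b , c , e) =
    grid-cancel-≤ (subst₂ ℚ._≤_ (sym grid-0) (frame₁ w) a) , grid-cancel-≤ (subst₂ ℚ._≤_ (frame₁ w) area≡grid b) ,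
    grid-cancel-≤ (subst₂ ℚ._≤_ (sym grid-0) (frame₂ w) c) , grid-cancel-≤ (subst₂ ℚ._≤_ (frame₂ w) area≡grid e)

  inBox⇒∈□ : ∀ w → InBox (n ℕ.* D) (frame w) → point w ∈□ outer
  inBox⇒∈□ w (a , b , c , e) =
    subst₂ ℚ._≤_ grid-0 (sym (frame₁ w)) (grid-mono-≤ a) , subst₂ ℚ._≤_ (sym (frame₁ w)) (sym area≡grid) (grid-mono-≤ b) ,
    subst₂ ℚ._≤_ grid-0 (sym (frame₂ w)) (grid-mono-≤ c) , subst₂ ℚ._≤_ (sym (frame₂ w)) (sym area≡grid) (grid-mono-≤ e)

  inside≡inBox : ∀ w v → Inside (n ℕ.* D) (frame w , frame v) ≡
    (InBox (n ℕ.* D) (frame w) × InBox (n ℕ.* D) (frame (w +ᵛ v)) ×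
     InBox (n ℕ.* D) (frame (w +ᵛ v +ᵛ rot v)) × InBox (n ℕ.* D) (frame (w +ᵛ rot v)))
  inside≡inBox w v = cong (InBox (n ℕ.* D) (frame w) ×_) (cong₂ _×_ (box (sym (frame-+ w v))) (cong₂ _×_
    (box (sym (trans (frame-+ (w +ᵛ v) (rot v)) (cong₂ _+ᵛ_ (frame-+ w v) (frame-rot v)))))
    (box (sym (trans (frame-+ w (rot v)) (cong (frame w +ᵛ_) (frame-rot v)))))))
    where
    box : ∀ {x y} → x ≡ y → InBox (n ℕ.* D) x ≡ InBox (n ℕ.* D) y
    box = cong (InBox (n ℕ.* D))

  toSquare-injective : ∀ {r s} → toSquare r ≡ toSquare s → r ≡ s
  toSquare-injective {(w₁ , w₂) , (v₁ , v₂)} {(x₁ , x₂) , (u₁ , u₂)} eq =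
    cong₂ _,_
      (cong₂ _,_ (cancel (+ n ℤ.* proj₁ C) (grid-injective (cong (λ z → proj₁ (corner z)) eq)))
        (cancel (+ n ℤ.* proj₂ C) (grid-injective (cong (λ z → proj₂ (corner z)) eq))))
      (cong₂ _,_ (grid-injective (cong (λ z → proj₁ (edge z)) eq)) (grid-injective (cong (λ z → proj₂ (edge z)) eq)))
    where
    open import Algebra.Properties.AbelianGroup ℤ.+-0-abelianGroup using (∙-cancelˡ)
    cancel : ∀ c {w x} → c ℤ.+ w ≡ c ℤ.+ x → w ≡ x
    cancel c = ∙-cancelˡ c _ _

  area-toSquare : ∀ w v → area (toSquare (w , v)) ≡ ι (+ norm² v) ℚ.* (δ ℚ.* δ)
  area-toSquare w (a , b) = trans (ring (ι a) (ι b) δ) (cong (ℚ._* (δ ℚ.* δ))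
    (trans (cong₂ ℚ._+_ (sym (ι-* a a)) (sym (ι-* b b)))
      (trans (sym (ι-+ (a ℤ.* a) (b ℤ.* b))) (cong ι (sym (+norm² a b))))))
    where
    ring : ∀ a b d → a ℚ.* d ℚ.* (a ℚ.* d) ℚ.+ b ℚ.* d ℚ.* (b ℚ.* d) ≡ (a ℚ.* a ℚ.+ b ℚ.* b) ℚ.* (d ℚ.* d)
    ring = solve-∀ ℚ-ring

  onGrid-point : ∀ w → OnGridPoint n (point w)
  onGrid-point (a , b) = onGrid (+ n ℤ.* proj₁ C ℤ.+ a) , onGrid (+ n ℤ.* proj₂ C ℤ.+ b)
    where
    onGrid : ∀ k → OnGrid n (grid k)
    onGrid k = k , trans (cong (ℚ._* grid k) (ι-def (+ n))) (trans (N*xδ≡x (ι k)) (sym (ι-def k)))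

  toMiniature : ∀ {r} → IsMini n r → IsMiniature n outer (toSquare r)
  toMiniature {w , v} (fq@(0<v₁ , 0≤v₂) , ins) =
    let b₀ , b₁ , b₂ , b₃ = subst id (inside≡inBox w v) ins
    in can , nonDegenerate ,
      ⊆□-from-vertices (toSquare (w , v)) outer (area-positive (toSquare (w , v)) can)
        (subst (All (_∈□ outer)) (sym (vertices-toSquare w v))
        (inBox⇒∈□ w b₀ ∷ inBox⇒∈□ (w +ᵛ v) b₁ ∷ inBox⇒∈□ (w +ᵛ v +ᵛ rot v) b₂ ∷ inBox⇒∈□ (w +ᵛ rot v) b₃ ∷ [])) ,
      subst (All (OnGridPoint n)) (sym (vertices-toSquare w v))
        (onGrid-point w ∷ onGrid-point (w +ᵛ v) ∷ onGrid-point (w +ᵛ v +ᵛ rot v) ∷ onGrid-point (w +ᵛ rot v) ∷ [])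
    where
    can : Canonical (toSquare (w , v))
    can = subst (ℚ._< grid (proj₁ v)) grid-0 (grid-mono-< 0<v₁) , subst (ℚ._≤ grid (proj₂ v)) grid-0 (grid-mono-≤ 0≤v₂)
    nonDegenerate : NonDegenerate (toSquare (w , v))
    nonDegenerate eq = ℚ.<-irrefl (sym (cong proj₁ eq)) (proj₁ can)

  onGrid⇒grid : ∀ {x} → OnGrid n x → ∃ λ k → x ≡ grid k
  onGrid⇒grid {x} (k , Nx≡k) = k , trans (sym (Nx*δ≡x x))
    (cong (ℚ._* δ) (trans (cong (ℚ._* x) (sym (ι-def (+ n)))) (trans Nx≡k (ι-def k))))

  vertices-onGrid⇒toSquare : ∀ M → All (OnGridPoint n) (vertices M) → ∃ λ r → M ≡ toSquare r
  vertices-onGrid⇒toSquare (square (c₁ , c₂) (e₁ , e₂)) ((gc₁ , gc₂) ∷ (ge₁ , ge₂) ∷ _) =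
    let w₁ , c₁≡ , v₁ , e₁≡ = coordinate (proj₁ C) gc₁ ge₁
        w₂ , c₂≡ , v₂ , e₂≡ = coordinate (proj₂ C) gc₂ ge₂
    in ((w₁ , w₂) , (v₁ , v₂)) , cong₂ square (cong₂ _,_ c₁≡ c₂≡) (cong₂ _,_ e₁≡ e₂≡)
    where
    ringℤ : ∀ c k → k ≡ c ℤ.+ (k ℤ.- c)
    ringℤ = ℤR.solve-∀
    ringℚ : ∀ c e → e ≡ c ℚ.+ e ℚ.+ ℚ.- c
    ringℚ = solve-∀ ℚ-ring
    coordinate : ∀ C {c e} → OnGrid n c → OnGrid n (c ℚ.+ e) →
      ∃ λ w → c ≡ grid (+ n ℤ.* C ℤ.+ w) × (∃ λ v → e ≡ grid v)
    coordinate C {c} {e} gc gce =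
      let k , c≡ = onGrid⇒grid gc
          l , c+e≡ = onGrid⇒grid gce
      in k ℤ.- + n ℤ.* C , trans c≡ (cong grid (ringℤ (+ n ℤ.* C) k)) ,
         l ℤ.- k , trans (ringℚ c e) (trans (cong₂ (λ x y → x ℚ.+ ℚ.- y) c+e≡ c≡)
           (sym (trans (grid-+ l (ℤ.- k)) (cong (grid l ℚ.+_) (grid-neg k)))))

  toRep : ∀ M → IsMiniature n outer M → ∃ λ r → M ≡ toSquare r × IsMini n r
  toRep M (can , _ , M⊆ , onGrid) =
    let r , M≡ = vertices-onGrid⇒toSquare M onGrid
    in r , M≡ , mini r (subst Canonical M≡ can)
      (subst (λ M → All (_∈□ outer) (vertices M)) M≡ (All.map (λ {z} → M⊆ z) (vertex∈□ M can)))
    where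
    mini : ∀ r → Canonical (toSquare r) → All (_∈□ outer) (vertices (toSquare r)) → IsMini n r
    mini (w , v) (0<v₁ , 0≤v₂) vs =
      fq , subst id (sym (inside≡inBox w v)) (boxes w (w +ᵛ v) (w +ᵛ v +ᵛ rot v) (w +ᵛ rot v) (subst (All (_∈□ outer)) (vertices-toSquare w v) vs))
      where
      fq : FirstQuadrant v
      fq = grid-cancel-< (subst (ℚ._< grid (proj₁ v)) (sym grid-0) 0<v₁) , grid-cancel-≤ (subst (ℚ._≤ grid (proj₂ v)) (sym grid-0) 0≤v₂)
      boxes : ∀ a b c e → All (_∈□ outer) (point a ∷ point b ∷ point c ∷ point e ∷ []) →
        InBox (n ℕ.* D) (frame a) × InBox (n ℕ.* D) (frame b) × InBox (n ℕ.* D) (frame c) × InBox (n ℕ.* D) (frame e)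
      boxes a b c e (v₀ ∷ v₁ ∷ v₂ ∷ v₃ ∷ []) = ∈□⇒inBox a v₀ , ∈□⇒inBox b v₁ , ∈□⇒inBox c v₂ , ∈□⇒inBox e v₃

-- The limit

ν : ℕ → ℚ
ν k = ι (+ k)

ν-+ : ∀ x y → ν (x ℕ.+ y) ≡ ν x ℚ.+ ν y
ν-+ x y = ι-+ (+ x) (+ y)

ν-* : ∀ x y → ν (x ℕ.* y) ≡ ν x ℚ.* ν y
ν-* x y = trans (cong ι (ℤ.pos-* x y)) (ι-* (+ x) (+ y))

ν-mono-≤ : ∀ {x y} → x ℕ.≤ y → ν x ℚ.≤ ν y
ν-mono-≤ x≤y = ι-mono-≤ (ℤ.+≤+ x≤y)

0≤ν : ∀ x → 0ℚ ℚ.≤ ν x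
0≤ν x = subst (ℚ._≤ ν x) ι-0 (ν-mono-≤ z≤n)

-- The denominator of ε serves as k, since k ε is then the numerator, a positive integer.
archimedean : ∀ {ε} → 0ℚ ℚ.< ε → ∃ λ k → 1ℚ ℚ.≤ ν k ℚ.* ε
archimedean {mkℚ (+ zero) _ _} (ℚ.*<* (ℤ.+<+ ()))
archimedean {mkℚ -[1+ _ ] _ _} (ℚ.*<* ())
archimedean {ε@(mkℚ (+ suc m) d-1 _)} _ = suc d-1 , ℚ.toℚᵘ-cancel-≤
  (ℚᵘ.≤-respʳ-≃ (ℚᵘ.≃-sym (ℚᵘ.≃-trans (ℚ.toℚᵘ-homo-* (ν (suc d-1)) ε) (ℚᵘ.*-congʳ {ℚ.toℚᵘ ε} (toℚᵘ-ι (+ suc d-1)))))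
    (*≤* (ℤ.+≤+ (subst (ℕ._≤ suc d-1 ℕ.* suc m ℕ.* 1) (ring (suc d-1)) (ℕ.*-monoˡ-≤ 1 (ℕ.*-monoʳ-≤ (suc d-1) (s≤s (z≤n {m}))))))))
  where
  ring : ∀ d → d ℕ.* 1 ℕ.* 1 ≡ 1 ℕ.* (1 ℕ.* d)
  ring = ℕR.solve-∀

norm²-positive : ∀ v → v ≢ (0ℤ , 0ℤ) → ∃ λ d → norm² v ≡ suc d
norm²-positive (+ 0 , + 0) v≢0 = ⊥-elim (v≢0 refl)
norm²-positive (+ suc _ , _) _ = _ , refl
norm²-positive (-[1+ _ ] , _) _ = _ , refl
norm²-positive (+ 0 , + suc _) _ = _ , refl
norm²-positive (+ 0 , -[1+ _ ]) _ = _ , refl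

latticeSquare-coordinates : ∀ P → LatticeSquare P → ∃ λ C → ∃₂ λ p q → ∃ λ d →
  p ℤ.* p ℤ.+ q ℤ.* q ≡ + suc d × P ≡ square (ιᵛ C) (ι p , ι q)
latticeSquare-coordinates (square (c₁ , c₂) (e₁ , e₂)) (nd , (ic₁ , ic₂) ∷ (ie₁ , ie₂) ∷ _) =
  let C₁ , c₁≡ , p , e₁≡ = coordinate ic₁ ie₁
      C₂ , c₂≡ , q , e₂≡ = coordinate ic₂ ie₂
      d , d≡ = norm²-positive (p , q) λ pq≡0 → nd (cong₂ _,_
        (trans e₁≡ (trans (cong ι (cong proj₁ pq≡0)) ι-0)) (trans e₂≡ (trans (cong ι (cong proj₂ pq≡0)) ι-0)))
  in (C₁ , C₂) , p , q , d , trans (sym (+norm² p q)) (cong +_ d≡) ,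
     cong₂ square (cong₂ _,_ c₁≡ c₂≡) (cong₂ _,_ e₁≡ e₂≡)
  where
  ring : ∀ c e → e ≡ c ℚ.+ e ℚ.+ ℚ.- c
  ring = solve-∀ ℚ-ring
  coordinate : ∀ {c e} → IsInt c → IsInt (c ℚ.+ e) → ∃ λ k → c ≡ ι k × (∃ λ l → e ≡ ι l)
  coordinate {c} {e} (k , c≡) (l , c+e≡) = k , trans c≡ (ι-def k) , l ℤ.- k ,
    trans (ring c e) (trans (cong₂ (λ x y → x ℚ.+ ℚ.- y) (trans c+e≡ (ι-def l)) (trans c≡ (ι-def k)))
      (sym (trans (ι-+ l (ℤ.- k)) (cong (ι l ℚ.+_) (ι-neg k)))))

2/15 : ℚ
2/15 = + 2 / 15

15*2/15≡2 : ν 15 ℚ.* 2/15 ≡ ν 2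
15*2/15≡2 = trans (cong (ℚ._* 2/15) (sym (ι-def (+ 15)))) (trans refl (ι-def (+ 2)))

∣p∣<q : ∀ {p q} → p ℚ.< q → ℚ.- p ℚ.< q → ℚ.∣ p ∣ ℚ.< q
∣p∣<q {p} {q} p<q -p<q with ℚ.∣p∣≡p∨∣p∣≡-p p
... | inj₁ ∣p∣≡p = subst (ℚ._< q) (sym ∣p∣≡p) p<q
... | inj₂ ∣p∣≡-p = subst (ℚ._< q) (sym ∣p∣≡-p) -p<q

module Limit (C : Vec) (p q : ℤ) (d : ℕ) (p²+q²≡D : p ℤ.* p ℤ.+ q ℤ.* q ≡ + suc d) (n-1 : ℕ) where
  open Frame p q d p²+q²≡D
  open Miniatures p q d p²+q²≡D
  open Counting p q d p²+q²≡D
  open Transfer C p q d p²+q²≡D n-1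

  enumeration : ∃ λ L → Enumerates n outer L
  enumeration = map toSquare (miniatures n) , Unique.map⁺ toSquare-injective (unique-miniatures n) ,
    λ M → mk⇔ (to M) (from M)
    where
    to : ∀ M → M ∈ map toSquare (miniatures n) → IsMiniature n outer M
    to M M∈ = let r , r∈ , M≡ = ∈-map⁻ toSquare M∈
              in subst (IsMiniature n outer) (sym M≡) (toMiniature (∈-miniatures⁻ n r∈))
    from : ∀ M → IsMiniature n outer M → M ∈ map toSquare (miniatures n)
    from M mini = let r , M≡ , r-mini = toRep M mini
                  in subst (_∈ map toSquare (miniatures n)) (sym M≡) (∈-map⁺ toSquare (∈-miniatures⁺ n r-mini))

  -- The limit concerns every enumerating list, not just the one constructed above, so an arbitrary
  -- one must be pulled back to integer listings before the counting applies.
  representatives : ∀ L → All (IsMiniature n outer) L → ∃ λ R → L ≡ map toSquare R × All (IsMini n) R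
  representatives [] [] = [] , refl , []
  representatives (M ∷ L) (mini ∷ minis) =
    let r , M≡ , r-mini = toRep M mini
        R , L≡ , R-minis = representatives L minis
    in r ∷ R , cong₂ _∷_ M≡ L≡ , r-mini ∷ R-minis

  sum-area : ∀ R → sumℚ (map area (map toSquare R)) ≡ ν (sumBy (norm² ∘ proj₂) R) ℚ.* (δ ℚ.* δ)
  sum-area [] = sym (trans (cong (ℚ._* (δ ℚ.* δ)) ι-0) (ℚ.*-zeroˡ (δ ℚ.* δ)))
  sum-area ((w , v) ∷ R) = trans (cong₂ ℚ._+_ (area-toSquare w v) (sum-area R))
    (sym (trans (cong (ℚ._* (δ ℚ.* δ)) (ν-+ (norm² v) (sumBy (norm² ∘ proj₂) R))) (ℚ.*-distribʳ-+ (δ ℚ.* δ) (ν (norm² v)) (ν (sumBy (norm² ∘ proj₂) R)))))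

  avgArea-toSquare : ∀ R → 1 ℕ.≤ length R → ∃ λ γ → ν (length R) ℚ.* γ ≡ 1ℚ × 0ℚ ℚ.≤ γ ×
    avgArea (map toSquare R) ≡ ν (sumBy (norm² ∘ proj₂) R) ℚ.* (δ ℚ.* δ) ℚ.* γ
  avgArea-toSquare (r ∷ R) _ = γ.δ , γ.N*δ≡1 , ℚ.<⇒≤ γ.0<δ ,
    cong₂ ℚ._*_ (sum-area (r ∷ R)) (trans (cong (λ k → + 1 / suc k) (length-map toSquare R)) γ.δ-def)
    -- This instance has the number of miniatures as its resolution, so its `δ` is the reciprocal
    -- that occurs in the average.
    where module γ = Transfer C p q d p²+q²≡D (length R)

  -- Both hypotheses are the integer bounds on the total area a and the number c of miniatures, where D is the
  -- area of the outer square; dividing by N² c turns them into bounds with the error term D K / N.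
  average-error : ∀ a c γ → c ℚ.* γ ≡ 1ℚ → 0ℚ ℚ.≤ γ → let D = ν D; K = ν K in
    ν 15 ℚ.* a ℚ.≤ D ℚ.* (ν 2 ℚ.* (N ℚ.* N) ℚ.+ K ℚ.* N) ℚ.* c →
    D ℚ.* (ν 2 ℚ.* (N ℚ.* N)) ℚ.* c ℚ.≤ ν 15 ℚ.* a ℚ.+ D ℚ.* (K ℚ.* N) ℚ.* c →
    let y = a ℚ.* (δ ℚ.* δ) ℚ.* γ ℚ.- 2/15 ℚ.* D in
    ν 15 ℚ.* y ℚ.≤ D ℚ.* K ℚ.* δ × ν 15 ℚ.* (ℚ.- y) ℚ.≤ D ℚ.* K ℚ.* δ
  average-error a c γ cγ≡1 0≤γ upper lower = above , below
    where
    Dν Kν s : ℚ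
    Dν = ν D
    Kν = ν K
    s = δ ℚ.* δ ℚ.* γ
    0≤s : 0ℚ ℚ.≤ s
    0≤s = 0≤p*q (0≤p*q (ℚ.<⇒≤ 0<δ) (ℚ.<⇒≤ 0<δ)) 0≤γ
    times-s : ∀ {u v} → u ℚ.≤ v → u ℚ.* s ℚ.≤ v ℚ.* s
    times-s = ℚ.*-monoʳ-≤-nonNeg s {{ℚ.nonNegative 0≤s}}
    scaled-main : Dν ℚ.* (ν 2 ℚ.* (N ℚ.* N)) ℚ.* c ℚ.* s ≡ Dν ℚ.* ν 2
    scaled-main = trans (ring Dν (ν 2) N c δ γ) (trans (cong₂ (λ x y → Dν ℚ.* ν 2 ℚ.* (x ℚ.* x ℚ.* y)) N*δ≡1 cγ≡1) (ℚ.*-identityʳ _))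
      where
      ring : ∀ D t N c δ γ → D ℚ.* (t ℚ.* (N ℚ.* N)) ℚ.* c ℚ.* (δ ℚ.* δ ℚ.* γ) ≡
        D ℚ.* t ℚ.* (N ℚ.* δ ℚ.* (N ℚ.* δ) ℚ.* (c ℚ.* γ))
      ring = solve-∀ ℚ-ring
    scaled-error : Dν ℚ.* (Kν ℚ.* N) ℚ.* c ℚ.* s ≡ Dν ℚ.* Kν ℚ.* δ
    scaled-error = trans (ring Dν Kν N c δ γ) (trans (cong₂ (λ x y → Dν ℚ.* Kν ℚ.* δ ℚ.* (x ℚ.* y)) N*δ≡1 cγ≡1) (ℚ.*-identityʳ _))
      where
      ring : ∀ D K N c δ γ → D ℚ.* (K ℚ.* N) ℚ.* c ℚ.* (δ ℚ.* δ ℚ.* γ) ≡ D ℚ.* K ℚ.* δ ℚ.* (N ℚ.* δ ℚ.* (c ℚ.* γ))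
      ring = solve-∀ ℚ-ring
    scaled-y : ν 15 ℚ.* (a ℚ.* (δ ℚ.* δ) ℚ.* γ ℚ.- 2/15 ℚ.* Dν) ≡ ν 15 ℚ.* a ℚ.* s ℚ.- Dν ℚ.* ν 2
    scaled-y = trans (ring (ν 15) a δ γ 2/15 Dν) (cong (λ z → ν 15 ℚ.* a ℚ.* s ℚ.- Dν ℚ.* z) 15*2/15≡2)
      where
      ring : ∀ f a δ γ t D → f ℚ.* (a ℚ.* (δ ℚ.* δ) ℚ.* γ ℚ.- t ℚ.* D) ≡ f ℚ.* a ℚ.* (δ ℚ.* δ ℚ.* γ) ℚ.- D ℚ.* (f ℚ.* t)
      ring = solve-∀ ℚ-ring
    above : ν 15 ℚ.* (a ℚ.* (δ ℚ.* δ) ℚ.* γ ℚ.- 2/15 ℚ.* Dν) ℚ.≤ Dν ℚ.* Kν ℚ.* δ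
    above = subst₂ ℚ._≤_ (sym scaled-y)
      (trans (cong (ℚ._- Dν ℚ.* ν 2) (trans (split Dν (ν 2 ℚ.* (N ℚ.* N)) (Kν ℚ.* N) c s) (cong₂ ℚ._+_ scaled-main scaled-error)))
        (cancel (Dν ℚ.* ν 2) (Dν ℚ.* Kν ℚ.* δ)))
      (ℚ.+-monoˡ-≤ (ℚ.- (Dν ℚ.* ν 2)) (times-s upper))
      where
      split : ∀ D t u c s → D ℚ.* (t ℚ.+ u) ℚ.* c ℚ.* s ≡ D ℚ.* t ℚ.* c ℚ.* s ℚ.+ D ℚ.* u ℚ.* c ℚ.* s
      split = solve-∀ ℚ-ring
      cancel : ∀ x y → x ℚ.+ y ℚ.- x ≡ y
      cancel = solve-∀ ℚ-ring
    below : ν 15 ℚ.* (ℚ.- (a ℚ.* (δ ℚ.* δ) ℚ.* γ ℚ.- 2/15 ℚ.* Dν)) ℚ.≤ Dν ℚ.* Kν ℚ.* δ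
    below = subst₂ ℚ._≤_
      (trans (cong (ℚ._- ν 15 ℚ.* a ℚ.* s) scaled-main)
        (trans (swap (Dν ℚ.* ν 2) (ν 15 ℚ.* a ℚ.* s)) (trans (cong ℚ.-_ (sym scaled-y)) (neg (ν 15) _))))
      (trans (distrib (ν 15 ℚ.* a) (Dν ℚ.* (Kν ℚ.* N) ℚ.* c) s) scaled-error)
      (ℚ.+-monoˡ-≤ (ℚ.- (ν 15 ℚ.* a ℚ.* s)) (times-s lower))
      where
      swap : ∀ x y → x ℚ.- y ≡ ℚ.- (y ℚ.- x)
      swap = solve-∀ ℚ-ring
      neg : ∀ x y → ℚ.- (x ℚ.* y) ≡ x ℚ.* (ℚ.- y)
      neg = solve-∀ ℚ-ring
      distrib : ∀ x y s → (x ℚ.+ y) ℚ.* s ℚ.- x ℚ.* s ≡ y ℚ.* s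
      distrib = solve-∀ ℚ-ring

  average-close : ∀ {ε k m} → 0ℚ ℚ.< ε → 1ℚ ℚ.≤ ν k ℚ.* ε → n ≡ 4 ℕ.+ m → D ℕ.* K ℕ.* k ℕ.< n →
    ∀ L → Enumerates n outer L → ℚ.∣ avgArea L ℚ.- 2/15 ℚ.* area outer ∣ ℚ.< ε
  average-close {ε} {k} {m} 0<ε 1≤kε n≡4+m DKk<n L (uL , L⇔) =
    let R , L≡ , minis = representatives L (All.tabulate (λ {M} → Equivalence.to (L⇔ M)))
    in subst (λ L → ℚ.∣ avgArea L ℚ.- 2/15 ℚ.* area outer ∣ ℚ.< ε) (sym L≡) (close R minis
      (AllPairs.map (λ r≢ r≡ → r≢ (cong toSquare r≡)) (AllPairs.map⁻ (subst Unique L≡ uL)))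
      (λ {r} mini → let s , s∈ , r≡ = ∈-map⁻ toSquare (subst (toSquare r ∈_) L≡ (Equivalence.from (L⇔ (toSquare r)) (toMiniature mini)))
                    in subst (_∈ R) (sym (toSquare-injective r≡)) s∈))
    where
    -- Since 1 ≤ k ε, the error D K/n is at most (D K k/n) ε, and D K k < n.
    DKδ<ε : ν D ℚ.* ν K ℚ.* δ ℚ.< ε
    DKδ<ε = ℚ.≤-<-trans
      (subst₂ ℚ._≤_ (ℚ.*-identityʳ _) (trans (ring (ν D) (ν K) δ (ν k) ε)
          (cong (λ z → z ℚ.* δ ℚ.* ε) (sym (trans (ν-* (D ℕ.* K) k) (cong (ℚ._* ν k) (ν-* D K))))))
        (ℚ.*-monoˡ-≤-nonNeg (ν D ℚ.* ν K ℚ.* δ) {{ℚ.nonNegative (0≤p*q (0≤p*q (0≤ν D) (0≤ν K)) (ℚ.<⇒≤ 0<δ))}} 1≤kε))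
      (subst (grid (+ (D ℕ.* K ℕ.* k)) ℚ.* ε ℚ.<_) (trans (cong (ℚ._* ε) N*δ≡1) (ℚ.*-identityˡ ε))
        (ℚ.*-monoˡ-<-pos ε {{ℚ.positive 0<ε}} (grid-mono-< (ℤ.+<+ DKk<n))))
      where
      ring : ∀ D K δ k ε → D ℚ.* K ℚ.* δ ℚ.* (k ℚ.* ε) ≡ D ℚ.* K ℚ.* k ℚ.* δ ℚ.* ε
      ring = solve-∀ ℚ-ring
    -- 15 y < ε ≤ 15 ε, and 15 cancels.
    below-ε : ∀ {y} → ν 15 ℚ.* y ℚ.≤ ν D ℚ.* ν K ℚ.* δ → y ℚ.< ε
    below-ε {y} 15y≤ = ℚ.*-cancelˡ-<-nonNeg (ν 15) {{ℚ.nonNegative (0≤ν 15)}} (ℚ.≤-<-trans 15y≤ (ℚ.<-≤-trans DKδ<ε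
      (subst (ℚ._≤ ν 15 ℚ.* ε) (trans (cong (ℚ._* ε) ι-1) (ℚ.*-identityˡ ε))
        (ℚ.*-monoʳ-≤-nonNeg ε {{ℚ.nonNegative (ℚ.<⇒≤ 0<ε)}} (ν-mono-≤ {1} {15} (s≤s z≤n))))))
    close : ∀ R → All (IsMini n) R → Unique R → (∀ {r} → IsMini n r → r ∈ R) →
      ℚ.∣ avgArea (map toSquare R) ℚ.- 2/15 ℚ.* area outer ∣ ℚ.< ε
    close R minis uR ⊆R =
      let γ , cγ≡1 , 0≤γ , avg≡ = avgArea-toSquare R (length-pos uR (All.lookup minis) ⊆R n≡4+m)
          above , below = average-error (ν A) (ν (length R)) γ cγ≡1 0≤γ
            (subst₂ ℚ._≤_ (ν-* 15 A) upper≡ (ν-mono-≤ (totalArea-upper uR (All.lookup minis) ⊆R n≡4+m)))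
            (subst₂ ℚ._≤_ lower≡ lower′≡ (ν-mono-≤ (totalArea-lower uR (All.lookup minis) ⊆R n≡4+m)))
      in subst (λ z → ℚ.∣ z ∣ ℚ.< ε) (sym (cong₂ (λ x y → x ℚ.- 2/15 ℚ.* y) avg≡ area-outer))
        (∣p∣<q (below-ε above) (below-ε below))
      where
      A : ℕ
      A = sumBy (norm² ∘ proj₂) R
      main≡ : ν (2 ℕ.* (n ℕ.* n)) ≡ ν 2 ℚ.* (N ℚ.* N)
      main≡ = trans (ν-* 2 (n ℕ.* n)) (cong (ν 2 ℚ.*_) (ν-* n n))
      product≡ : ∀ {x y} → ν x ≡ y → ν (D ℕ.* x ℕ.* length R) ≡ ν D ℚ.* y ℚ.* ν (length R)
      product≡ {x} x≡ = trans (ν-* (D ℕ.* x) (length R)) (cong (ℚ._* ν (length R)) (trans (ν-* D x) (cong (ν D ℚ.*_) x≡)))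
      upper≡ : ν (D ℕ.* (2 ℕ.* (n ℕ.* n) ℕ.+ K ℕ.* n) ℕ.* length R) ≡ ν D ℚ.* (ν 2 ℚ.* (N ℚ.* N) ℚ.+ ν K ℚ.* N) ℚ.* ν (length R)
      upper≡ = product≡ (trans (ν-+ (2 ℕ.* (n ℕ.* n)) (K ℕ.* n)) (cong₂ ℚ._+_ main≡ (ν-* K n)))
      lower≡ : ν (D ℕ.* (2 ℕ.* (n ℕ.* n)) ℕ.* length R) ≡ ν D ℚ.* (ν 2 ℚ.* (N ℚ.* N)) ℚ.* ν (length R)
      lower≡ = product≡ main≡
      lower′≡ : ν (15 ℕ.* A ℕ.+ D ℕ.* (K ℕ.* n) ℕ.* length R) ≡ ν 15 ℚ.* ν A ℚ.+ ν D ℚ.* (ν K ℚ.* N) ℚ.* ν (length R)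
      lower′≡ = trans (ν-+ (15 ℕ.* A) _) (cong₂ ℚ._+_ (ν-* 15 A) (product≡ (ν-* K n)))

theorem2 : (P : Square) → LatticeSquare P →
    ((n : ℕ) → 1 ≤ n → ∃ λ (L : List Square) → Enumerates n P L) ×
    ((ε : ℚ) → 0ℚ < ε →
    ∃ λ (N : ℕ) → 1 ≤ N ×
    ((n : ℕ) → N ≤ n → (L : List Square) → Enumerates n P L →
    ∣ avgArea L - (+ 2 / 15) * area P ∣ < ε))
theorem2 P lattice with latticeSquare-coordinates P lattice
... | C , p , q , d , p²+q²≡D , refl =
  (λ { (suc n-1) _ → Limit.enumeration C p q d p²+q²≡D n-1 }) ,
  λ ε 0<ε → let k , 1≤kε = archimedean 0<ε in
    -- The summand 5 ensures n ≥ 4, so that n = 4 + m with m = (n - 1) - 3; the product ensures D K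
    -- k < n, with k chosen from ε alone.
    5 ℕ.+ suc d ℕ.* K ℕ.* k , s≤s z≤n ,
    λ { (suc n-1) N≤n → Limit.average-close C p q d p²+q²≡D n-1 {ε} {k} {n-1 ℕ.∸ 3} 0<ε 1≤kε
          (cong suc (sym (ℕ.m+[n∸m]≡n (ℕ.≤-trans (s≤s (s≤s (s≤s z≤n))) (ℕ.s≤s⁻¹ N≤n)))))
          (ℕ.≤-trans (ℕ.m≤n+m (suc (suc d ℕ.* K ℕ.* k)) 4) (ℕ.≤-trans (ℕ.≤-reflexive (ℕ.+-suc 4 _)) N≤n)) }
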